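{- Let $\mathbf{T}$ be a tree chosen uniformly at random from the $n^{n-2}$ labelled trees on vertex set $\{1,\ldots,n\}$, and for $0\le k\le n$ let $X_k$ be the number of independent sets of size $k$ in $\mathbf{T}$. Then asymptotically almost surely (i.e., with probability tending to $1$ as $n\to\infty$) the sequence $(X_0,X_1,\ldots,X_\ell)$ is weakly increasing, where $\ell=0.28096n$ (i.e. $X_k\le X_{k+1}$ for every integer $k$ with $0\le k<k+1\le 0.28096n$).
   Context: An independent set in a graph is a set of mutually non-adjacent vertices. -}

module Defs where

open import Data.Bool using (Bool; true; false; _∧_; not; T)
open import Data.Nat using (ℕ; zero; suc; _≤_; _<_; _+_; _*_)
open import Data.Fin using (Fin)
open import Data.Fin.Subset using (Subset; ∣_∣)
open import Data.List using (List; []; _∷_; map; _++_; length; allFin)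
open import Data.List.Relation.Unary.Unique.Propositional using (Unique)
open import Data.Vec using (Vec; lookup; _∷_; [])
open import Data.Product using (Σ; ∃; ∃-syntax; _×_)
open import Relation.Binary.PropositionalEquality using (_≡_)
open import Relation.Nullary using (¬_)
open import Data.Nat using (_≡ᵇ_)
open import Data.List using (foldr; filterᵇ)

AdjMat : ℕ → Set
AdjMat n = Vec (Vec Bool n) n

Adj : ∀ {n} → AdjMat n → Fin n → Fin n → Set
Adj M i j = T (lookup (lookup M i) j)

IsSimpleGraph : ∀ {n} → AdjMat n → Set
IsSimpleGraph M = (∀ i j → lookup (lookup M i) j ≡ lookup (lookup M j) i)
                × (∀ i → lookup (lookup M i) i ≡ false)

data IsWalk {n} (M : AdjMat n) : List (Fin n) → Set where
  walk-one  : ∀ v → IsWalk M (v ∷ [])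
  walk-cons : ∀ u v vs → Adj M u v → IsWalk M (v ∷ vs) → IsWalk M (u ∷ v ∷ vs)

data StartsEnds {n} : List (Fin n) → Fin n → Fin n → Set where
  se-one  : ∀ v → StartsEnds (v ∷ []) v v
  se-cons : ∀ u w vs v → StartsEnds (w ∷ vs) w v → StartsEnds (u ∷ w ∷ vs) u v

IsPath : ∀ {n} → AdjMat n → List (Fin n) → Fin n → Fin n → Set
IsPath M p u v = IsWalk M p × Unique p × StartsEnds p u v

Connected : ∀ {n} → AdjMat n → Set
Connected M = ∀ u v → ∃[ p ] IsPath M p u v

HasCycle : ∀ {n} → AdjMat n → Set
HasCycle {n} M = ∃[ p ] ∃[ u ] ∃[ v ] (IsPath M p u v × 3 ≤ length p × Adj M v u)

IsTree : ∀ {n} → AdjMat n → Set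
IsTree M = IsSimpleGraph M × Connected M × ¬ HasCycle M

allSubsets : ∀ n → List (Subset n)
allSubsets zero    = [] ∷ []
allSubsets (suc n) = map (true ∷_) (allSubsets n) ++ map (false ∷_) (allSubsets n)

allᵇ : ∀ {A : Set} → (A → Bool) → List A → Bool
allᵇ p = foldr (λ x b → p x ∧ b) true

isIndependentᵇ : ∀ {n} → AdjMat n → Subset n → Bool
isIndependentᵇ {n} M S =
  allᵇ (λ i → allᵇ (λ j → not (lookup S i ∧ lookup S j ∧ lookup (lookup M i) j)) (allFin n)) (allFin n)

X : ∀ {n} → ℕ → AdjMat n → ℕ
X {n} k M = length (filterᵇ (λ S → isIndependentᵇ M S ∧ (∣ S ∣ ≡ᵇ k)) (allSubsets n))

-- (X₀, …, X_ℓ) weakly increasing with ℓ = 0.28096 n,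
-- i.e. X_k ≤ X_{k+1} whenever k + 1 ≤ 0.28096 n  (⇔ 100000 (k+1) ≤ 28096 n)
InitiallyIncreasing : ∀ {n} → AdjMat n → Set
InitiallyIncreasing {n} M = ∀ k → 100000 * suc k ≤ 28096 * n → X k M ≤ X (suc k) M

{-# OPTIONS --safe #-}
module Submission where

-- For an independent set I let free(I) be the number of vertices outside I without a neighbour in I. Counting pairs
-- (I, v) gives (k + 1) X_{k+1} = Σ free(I) over the independent k-sets I, so X_{k+1} ≥ c X_k holds up to lower order terms
-- as soon as only a vanishing proportion of the independent k-sets have free(I) ≤ c k.
--
-- A tree is the graph of a map f : [n] → [n] (peel off leaves), and n^n exceeds n^(n-2) only by a polynomial factor, so
-- the expected number of pairs (f, I) with free(I) small can be computed for a uniformly random map f. The values of f on I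
-- throw k balls into n - k boxes; a tilted, lazy version of this process and Bernoulli's inequality give an exponential
-- upper bound for the number of exceptional I. It is compared with a lower bound for X_k valid in every tree outside a
-- negligible set: first C(n + 1 - k, k) ≤ X_k at k = n / 5, the value for a path, and from there on the growth
-- X_{k+1} ≥ c X_k already established, in short blocks of k. The path bound alone would just suffice for an optimal large
-- deviation estimate; the growth of X_k along the blocks pays for the simpler estimate used here.

open import Defs
open import Data.Bool using (Bool; true; false; _∧_; _∨_; not; T; if_then_else_)
import Data.Bool as Bool
open import Data.Bool.Properties using (T-≡)
open import Data.Empty using (⊥; ⊥-elim)
open import Data.Fin using (Fin; zero; suc)
import Data.Fin.Properties as Fin
open import Data.Fin.Subset using (Subset; ∣_∣)
open import Data.Fin.Subset.Properties using (∣p∣≤n; ∣⊥∣≡0; ∣⊤∣≡n)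
open import Data.List using (List; []; _∷_; map; _++_; length; allFin; filterᵇ; concatMap; upTo)
open import Data.List.Membership.Propositional using (_∈_)
import Data.List.Membership.DecPropositional as DecMembership
open import Data.List.Membership.Propositional.Properties using (∈-map⁺; ∈-++⁺ˡ; ∈-++⁺ʳ; ∈-concatMap⁺; ∈-upTo⁺; ∈-allFin)
open import Data.List.Properties using (map-tabulate; length-tabulate; length-upTo)
open import Data.List.Relation.Unary.All as All using (All; []; _∷_)
open import Data.List.Relation.Unary.All.Properties using (¬Any⇒All¬; ++⁺)
open import Data.List.Relation.Unary.AllPairs using ([]; _∷_)
open import Data.List.Relation.Unary.Any as Any using (here; there)
open import Data.List.Relation.Unary.Unique.Propositional using (Unique)
open import Data.Nat
open import Data.Nat.Combinatorics using (nCk+nC[k+1]≡[n+1]C[k+1]; k>n⇒nCk≡0; nCn≡1) renaming (_C_ to _choose_)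
open import Data.Nat.DivMod using (_/_; _%_; m≡m%n+[m/n]*n; m%n<n; /-monoˡ-≤; m*n/n≡m)
open import Data.Nat.Properties
open import Data.Nat.Tactic.RingSolver using (solve-∀)
open import Data.Product using (∃; ∃-syntax; _×_; _,_; proj₁; proj₂)
open import Data.Sum using (_⊎_; inj₁; inj₂)
open import Data.Vec as Vec using (Vec; lookup; _∷_; []; _[_]≔_)
open import Data.Vec.Properties using (≡-dec; lookup∘update; lookup∘update′; lookup∘tabulate; lookup-replicate; tabulate∘lookup; tabulate-cong; []≔-lookup)
open import Function using (_∘_; id; Equivalence)
open import Relation.Binary.Definitions using (DecidableEquality)
open import Relation.Binary.PropositionalEquality
open import Relation.Nullary using (¬_; Dec; yes; no; does; ¬?)
open import Relation.Nullary.Decidable using (_×-dec_; dec-true; dec-false)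

-- Finite sums and extensions of independent sets

-- All estimates are exact inequalities between natural numbers. With `q` the integer part of
-- `n / D`, a quantity of exponential size is compared with the `q`-th power of a quotient of
-- explicit integers; rounding costs powers of `n` and a factor `2 ^ D`. Every block leaves a margin
-- `η / (η + 1)` per unit of `q`, whose `q`-th power beats the total polynomial loss of order
-- `n ^ 5`. The obstacle is a circularity: growth at `k` requires the exceptional sets to be rare
-- compared with `X_k`, and a good lower bound for `X_k` requires growth before `k`. Inside a block
-- everything is therefore measured against `X` at the left end, and the growth won there feeds the
-- next block. Two chains of blocks are run. The first starts from `X_0 = 1` and has crude growth
-- rates, which suffice for monotonicity up to `n / 5`. The second starts afresh at `m = n / 5`,
-- where the path bound is about `C(4m, m)`, of order `(256 / 27) ^ m` and far above what the first
-- chain has accumulated. Two tilts, of the free vertices and of the number of balls, are free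
-- parameters of each block; what remains is a finite list of integer inequalities.

private
  variable
    𝔸 𝔹 : Set

∑ : List 𝔸 → (𝔸 → ℕ) → ℕ
∑ []       f = 0
∑ (x ∷ xs) f = f x + ∑ xs f

∑-cong : (xs : List 𝔸) {f g : 𝔸 → ℕ} → (∀ x → f x ≡ g x) → ∑ xs f ≡ ∑ xs g
∑-cong []       e = refl
∑-cong (x ∷ xs) e = cong₂ _+_ (e x) (∑-cong xs e)

∑-mono : (xs : List 𝔸) {f g : 𝔸 → ℕ} → (∀ x → f x ≤ g x) → ∑ xs f ≤ ∑ xs g
∑-mono []       e = z≤n
∑-mono (x ∷ xs) e = +-mono-≤ (e x) (∑-mono xs e)

∑-++ : (xs ys : List 𝔸) (f : 𝔸 → ℕ) → ∑ (xs ++ ys) f ≡ ∑ xs f + ∑ ys f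
∑-++ []       ys f = refl
∑-++ (x ∷ xs) ys f = trans (cong (f x +_) (∑-++ xs ys f)) (sym (+-assoc (f x) _ _))

∑-map : (g : 𝔸 → 𝔹) (xs : List 𝔸) (f : 𝔹 → ℕ) → ∑ (map g xs) f ≡ ∑ xs (f ∘ g)
∑-map g []       f = refl
∑-map g (x ∷ xs) f = cong (f (g x) +_) (∑-map g xs f)

∑-concatMap : (g : 𝔸 → List 𝔹) (xs : List 𝔸) (f : 𝔹 → ℕ) →
              ∑ (concatMap g xs) f ≡ ∑ xs (λ x → ∑ (g x) f)
∑-concatMap g []       f = refl
∑-concatMap g (x ∷ xs) f = trans (∑-++ (g x) _ f) (cong (∑ (g x) f +_) (∑-concatMap g xs f))

∑-+ : (xs : List 𝔸) (f g : 𝔸 → ℕ) → ∑ xs (λ x → f x + g x) ≡ ∑ xs f + ∑ xs g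
∑-+ []       f g = refl
∑-+ (x ∷ xs) f g = trans (cong (f x + g x +_) (∑-+ xs f g)) (+-+-interchange (f x) (g x) _ _)
  where
  +-+-interchange : ∀ a b c d → (a + b) + (c + d) ≡ (a + c) + (b + d)
  +-+-interchange = solve-∀

∑-*ˡ : (xs : List 𝔸) (c : ℕ) (f : 𝔸 → ℕ) → ∑ xs (λ x → c * f x) ≡ c * ∑ xs f
∑-*ˡ []       c f = sym (*-zeroʳ c)
∑-*ˡ (x ∷ xs) c f = trans (cong (c * f x +_) (∑-*ˡ xs c f)) (sym (*-distribˡ-+ c (f x) _))

∑-*ʳ : (xs : List 𝔸) (c : ℕ) (f : 𝔸 → ℕ) → ∑ xs (λ x → f x * c) ≡ ∑ xs f * c
∑-*ʳ xs c f = trans (∑-cong xs (λ x → *-comm (f x) c)) (trans (∑-*ˡ xs c f) (*-comm c _))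

∑-const : (xs : List 𝔸) (c : ℕ) → ∑ xs (λ _ → c) ≡ length xs * c
∑-const []       c = refl
∑-const (x ∷ xs) c = cong (c +_) (∑-const xs c)

∑-zero : (xs : List 𝔸) → ∑ xs (λ _ → 0) ≡ 0
∑-zero xs = trans (∑-const xs 0) (*-zeroʳ (length xs))

∑-swap : (xs : List 𝔸) (ys : List 𝔹) (f : 𝔸 → 𝔹 → ℕ) →
         ∑ xs (λ x → ∑ ys (f x)) ≡ ∑ ys (λ y → ∑ xs (λ x → f x y))
∑-swap []       ys f = sym (∑-zero ys)
∑-swap (x ∷ xs) ys f =
  trans (cong (∑ ys (f x) +_) (∑-swap xs ys f)) (sym (∑-+ ys (f x) _))

∑-mono-All : {P : 𝔸 → Set} {xs : List 𝔸} {f g : 𝔸 → ℕ} → All P xs →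
             (∀ x → P x → f x ≤ g x) → ∑ xs f ≤ ∑ xs g
∑-mono-All []         e = z≤n
∑-mono-All (px ∷ pxs) e = +-mono-≤ (e _ px) (∑-mono-All pxs e)

∑-allFin : ∀ {n} (f : Fin (suc n) → ℕ) → ∑ (allFin (suc n)) f ≡ f zero + ∑ (allFin n) (f ∘ suc)
∑-allFin {n} f = cong (f zero +_)
  (trans (cong (λ l → ∑ l f) (sym (map-tabulate id suc))) (∑-map suc (allFin n) f))

⟦_⟧ : Bool → ℕ
⟦ true  ⟧ = 1
⟦ false ⟧ = 0

⟦⟧-mono : {b c : Bool} → (b ≡ true → c ≡ true) → ⟦ b ⟧ ≤ ⟦ c ⟧
⟦⟧-mono {false} h = z≤n
⟦⟧-mono {true}  h = ≤-reflexive (sym (cong ⟦_⟧ (h refl)))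

⟦⟧-∧ : ∀ b c → ⟦ b ∧ c ⟧ ≡ ⟦ b ⟧ * ⟦ c ⟧
⟦⟧-∧ false c = refl
⟦⟧-∧ true  c = sym (+-identityʳ _)

length-filterᵇ : (p : 𝔸 → Bool) (xs : List 𝔸) → length (filterᵇ p xs) ≡ ∑ xs (⟦_⟧ ∘ p)
length-filterᵇ p []       = refl
length-filterᵇ p (x ∷ xs) with p x
... | true  = cong suc (length-filterᵇ p xs)
... | false = length-filterᵇ p xs

∈⇒≤∑ : {xs : List 𝔸} {x : 𝔸} (f : 𝔸 → ℕ) → x ∈ xs → f x ≤ ∑ xs f
∈⇒≤∑ f (here refl) = m≤m+n _ _
∈⇒≤∑ f (there {x = y} i) = ≤-trans (∈⇒≤∑ f i) (m≤n+m _ (f y))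

∧-split : ∀ {b c} → b ∧ c ≡ true → b ≡ true × c ≡ true
∧-split {true} {true} e = refl , refl

∧-intro : ∀ {b c} → b ≡ true → c ≡ true → b ∧ c ≡ true
∧-intro refl refl = refl

≡ᵇ⇒≡′ : ∀ {m n} → (m ≡ᵇ n) ≡ true → m ≡ n
≡ᵇ⇒≡′ {m} {n} e = ≡ᵇ⇒≡ m n (subst T (sym e) _)

≡⇒≡ᵇ′ : ∀ {m n} → m ≡ n → (m ≡ᵇ n) ≡ true
≡⇒≡ᵇ′ {m} refl = go m
  where
  go : ∀ k → (k ≡ᵇ k) ≡ true
  go zero    = refl
  go (suc k) = go k

-- Counting through a fibre: each x is the image g b of some listed b with p b,
-- and distinct x have disjoint fibres.
length≤∑ : (_≟A_ : DecidableEquality 𝔸) (g : 𝔹 → 𝔸) (E : List 𝔹) (p : 𝔹 → Bool) (xs : List 𝔸) →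
           Unique xs → All (λ x → ∃ λ b → b ∈ E × g b ≡ x × p b ≡ true) xs →
           length xs ≤ ∑ E (⟦_⟧ ∘ p)
length≤∑ {𝔸 = 𝔸} {𝔹 = 𝔹} _≟A_ g E p xs u a = begin
  length xs                                                     ≡⟨ sym (*-identityʳ _) ⟩
  length xs * 1                                                 ≡⟨ sym (∑-const xs 1) ⟩
  ∑ xs (λ _ → 1)                                                ≤⟨ ∑-mono-All a covered ⟩
  ∑ xs (λ x → ∑ E (λ b → ⟦ does (g b ≟A x) ⟧ * ⟦ p b ⟧))        ≡⟨ ∑-swap xs E _ ⟩
  ∑ E (λ b → ∑ xs (λ x → ⟦ does (g b ≟A x) ⟧ * ⟦ p b ⟧))        ≡⟨ ∑-cong E (λ b → ∑-*ʳ xs ⟦ p b ⟧ _) ⟩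
  ∑ E (λ b → ∑ xs (λ x → ⟦ does (g b ≟A x) ⟧) * ⟦ p b ⟧)        ≤⟨ ∑-mono E (λ b → *-monoˡ-≤ ⟦ p b ⟧ (once (g b) u)) ⟩
  ∑ E (λ b → 1 * ⟦ p b ⟧)                                       ≡⟨ ∑-cong E (λ b → *-identityˡ _) ⟩
  ∑ E (⟦_⟧ ∘ p)                                                 ∎
  where
  open ≤-Reasoning
  covered : ∀ x → (∃ λ b → b ∈ E × g b ≡ x × p b ≡ true) → 1 ≤ ∑ E (λ b → ⟦ does (g b ≟A x) ⟧ * ⟦ p b ⟧)
  covered x (b , b∈ , e , pb) = ≤-trans
    (≤-reflexive (sym (cong₂ (λ c d → ⟦ c ⟧ * ⟦ d ⟧) (dec-true (g b ≟A x) e) pb)))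
    (∈⇒≤∑ (λ b → ⟦ does (g b ≟A x) ⟧ * ⟦ p b ⟧) b∈)
  absent : ∀ y {ys} → All (λ z → ¬ y ≡ z) ys → ∑ ys (λ x → ⟦ does (y ≟A x) ⟧) ≡ 0
  absent y []       = refl
  absent y (_∷_ {x = z} q qs) with y ≟A z
  ... | yes e = ⊥-elim (q e)
  ... | no _  = absent y qs
  once : ∀ y {ys} → Unique ys → ∑ ys (λ x → ⟦ does (y ≟A x) ⟧) ≤ 1
  once y []        = z≤n
  once y (_∷_ {x = z} q qs) with y ≟A z
  ... | yes refl = ≤-reflexive (cong suc (absent y q))
  ... | no _     = once y qs

allᵇ-∈ : (p : 𝔸 → Bool) {xs : List 𝔸} → allᵇ p xs ≡ true → ∀ {x} → x ∈ xs → p x ≡ true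
allᵇ-∈ p e (here refl) = proj₁ (∧-split e)
allᵇ-∈ p {y ∷ xs} e (there i)   = allᵇ-∈ p (proj₂ (∧-split {p y} e)) i

allᵇ-intro : (p : 𝔸 → Bool) (xs : List 𝔸) → (∀ x → p x ≡ true) → allᵇ p xs ≡ true
allᵇ-intro p []       h = refl
allᵇ-intro p (x ∷ xs) h = ∧-intro (h x) (allᵇ-intro p xs h)

∑-subsets : ∀ {n} (F : Subset (suc n) → ℕ) →
  ∑ (allSubsets (suc n)) F ≡ ∑ (allSubsets n) (F ∘ (true ∷_)) + ∑ (allSubsets n) (F ∘ (false ∷_))
∑-subsets {n} F = trans (∑-++ (map (true ∷_) (allSubsets n)) _ F)
  (cong₂ _+_ (∑-map (true ∷_) (allSubsets n) F) (∑-map (false ∷_) (allSubsets n) F))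

-- Inserting `v` is a bijection from the sets avoiding `v` onto those containing it. Both double
-- countings rest on it: the extensions of independent sets and the split of independent sets at a
-- leaf.
∑-toggle : ∀ {n} (v : Fin n) (F : Subset n → ℕ) →
  ∑ (allSubsets n) (λ S → ⟦ not (lookup S v) ⟧ * F (S [ v ]≔ true)) ≡ ∑ (allSubsets n) (λ S → ⟦ lookup S v ⟧ * F S)
∑-toggle {suc n} zero F = begin
  ∑ (allSubsets (suc n)) (λ S → ⟦ not (lookup S zero) ⟧ * F (S [ zero ]≔ true)) ≡⟨ ∑-subsets (λ S → ⟦ not (lookup S zero) ⟧ * F (S [ zero ]≔ true)) ⟩
  ∑ (allSubsets n) (λ S → 0) + ∑ (allSubsets n) (λ S → 1 * F (true ∷ S))        ≡⟨ +-comm (∑ (allSubsets n) (λ S → 0)) _ ⟩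
  ∑ (allSubsets n) (λ S → 1 * F (true ∷ S)) + ∑ (allSubsets n) (λ S → 0)        ≡⟨ sym (∑-subsets (λ S → ⟦ lookup S zero ⟧ * F S)) ⟩
  ∑ (allSubsets (suc n)) (λ S → ⟦ lookup S zero ⟧ * F S) ∎
  where open ≡-Reasoning
∑-toggle {suc n} (suc v) F = begin
  ∑ (allSubsets (suc n)) (λ S → ⟦ not (lookup S (suc v)) ⟧ * F (S [ suc v ]≔ true)) ≡⟨ ∑-subsets (λ S → ⟦ not (lookup S (suc v)) ⟧ * F (S [ suc v ]≔ true)) ⟩
  _ ≡⟨ cong₂ _+_ (∑-toggle v (F ∘ (true ∷_))) (∑-toggle v (F ∘ (false ∷_))) ⟩
  _ ≡⟨ sym (∑-subsets (λ S → ⟦ lookup S (suc v) ⟧ * F S)) ⟩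
  ∑ (allSubsets (suc n)) (λ S → ⟦ lookup S (suc v) ⟧ * F S) ∎
  where open ≡-Reasoning

∣∣-∑ : ∀ {n} (S : Subset n) → ∑ (allFin n) (λ v → ⟦ lookup S v ⟧) ≡ ∣ S ∣
∣∣-∑ []          = refl
∣∣-∑ {suc n} (true ∷ S)  = trans (∑-allFin {n} (λ v → ⟦ lookup (true ∷ S) v ⟧)) (cong suc (∣∣-∑ S))
∣∣-∑ {suc n} (false ∷ S) = trans (∑-allFin {n} (λ v → ⟦ lookup (false ∷ S) v ⟧)) (∣∣-∑ S)

∣insert∣ : ∀ {n} (S : Subset n) v → lookup S v ≡ false → ∣ S [ v ]≔ true ∣ ≡ suc ∣ S ∣
∣insert∣ (false ∷ S) zero    e = refl
∣insert∣ (true ∷ S)  (suc v) e = cong suc (∣insert∣ S v e)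
∣insert∣ (false ∷ S) (suc v) e = ∣insert∣ S v e

Independent : ∀ {n} → AdjMat n → Subset n → Set
Independent M S = ∀ i j → lookup S i ≡ true → lookup S j ≡ true → lookup (lookup M i) j ≡ false

private
  nand₃ : ∀ {a b c} → not (a ∧ b ∧ c) ≡ true → a ≡ true → b ≡ true → c ≡ false
  nand₃ {true} {true} {false} e refl refl = refl

  nand₃-intro : ∀ a b c → (a ≡ true → b ≡ true → c ≡ false) → not (a ∧ b ∧ c) ≡ true
  nand₃-intro false b     c h = refl
  nand₃-intro true  false c h = refl
  nand₃-intro true  true  c h rewrite h refl refl = refl

independent : ∀ {n} (M : AdjMat n) S → isIndependentᵇ M S ≡ true → Independent M S
independent M S e i j = nand₃ {lookup S i} {lookup S j}
  (allᵇ-∈ (λ j → not (lookup S i ∧ lookup S j ∧ lookup (lookup M i) j)) {allFin _}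
    (allᵇ-∈ (λ i → allᵇ (λ j → not (lookup S i ∧ lookup S j ∧ lookup (lookup M i) j)) (allFin _)) e (∈-allFin i)) (∈-allFin j))

independentᵇ : ∀ {n} (M : AdjMat n) S → Independent M S → isIndependentᵇ M S ≡ true
independentᵇ {n} M S h = allᵇ-intro _ (allFin n) λ i → allᵇ-intro _ (allFin n) λ j →
  nand₃-intro (lookup S i) (lookup S j) _ (h i j)

indepOfSizeᵇ : ∀ {n} → AdjMat n → ℕ → Subset n → Bool
indepOfSizeᵇ M k S = isIndependentᵇ M S ∧ (∣ S ∣ ≡ᵇ k)

X-∑ : ∀ {n} k (M : AdjMat n) → X k M ≡ ∑ (allSubsets n) (λ S → ⟦ indepOfSizeᵇ M k S ⟧)
X-∑ {n} k M = length-filterᵇ (indepOfSizeᵇ M k) (allSubsets n)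

freeᵇ : ∀ {n} → AdjMat n → Subset n → Fin n → Bool
freeᵇ {n} M S v = not (lookup S v) ∧ allᵇ (λ u → not (lookup S u ∧ lookup (lookup M u) v)) (allFin n)

free : ∀ {n} → AdjMat n → Subset n → ℕ
free {n} M S = ∑ (allFin n) (λ v → ⟦ freeᵇ M S v ⟧)

private
  nand₂ : ∀ {a c} → not (a ∧ c) ≡ true → a ≡ true → c ≡ false
  nand₂ {true} {false} e refl = refl

  not-true : ∀ {b} → not b ≡ true → b ≡ false
  not-true {false} e = refl

insert-independent : ∀ {n} (M : AdjMat n) → IsSimpleGraph M → ∀ S v →
  Independent M S → freeᵇ M S v ≡ true → Independent M (S [ v ]≔ true)
insert-independent {n} M (symM , loopless) S v ind fr i j Si Sj with i Fin.≟ v | j Fin.≟ v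
... | yes refl | yes refl = loopless i
... | yes refl | no j≢v   = trans (symM i j) (nand₂ (allᵇ-∈ (λ u → not (lookup S u ∧ lookup (lookup M u) v)) (proj₂ (∧-split {not (lookup S v)} fr)) (∈-allFin j))
                              (trans (sym (lookup∘update′ j≢v S true)) Sj))
... | no i≢v   | yes refl = nand₂ (allᵇ-∈ (λ u → not (lookup S u ∧ lookup (lookup M u) v)) (proj₂ (∧-split {not (lookup S v)} fr)) (∈-allFin i))
                              (trans (sym (lookup∘update′ i≢v S true)) Si)
... | no i≢v   | no j≢v   = ind i j (trans (sym (lookup∘update′ i≢v S true)) Si) (trans (sym (lookup∘update′ j≢v S true)) Sj)

-- Both sides count pairs (I, v) with I independent of size k and I ∪ {v} independent of size k + 1.
∑-free≤ : ∀ {n} (M : AdjMat n) → IsSimpleGraph M → ∀ k →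
  ∑ (allSubsets n) (λ S → ⟦ indepOfSizeᵇ M k S ⟧ * free M S) ≤ suc k * X (suc k) M
∑-free≤ {n} M sg k = begin
  ∑ 𝒮 (λ S → ⟦ indepOfSizeᵇ M k S ⟧ * free M S)
    ≡⟨ ∑-cong 𝒮 (λ S → sym (∑-*ˡ (allFin n) ⟦ indepOfSizeᵇ M k S ⟧ _)) ⟩
  ∑ 𝒮 (λ S → ∑ (allFin n) (λ v → ⟦ indepOfSizeᵇ M k S ⟧ * ⟦ freeᵇ M S v ⟧))
    ≤⟨ ∑-mono 𝒮 (λ S → ∑-mono (allFin n) (λ v → step S v)) ⟩
  ∑ 𝒮 (λ S → ∑ (allFin n) (λ v → ⟦ not (lookup S v) ⟧ * ⟦ indepOfSizeᵇ M (suc k) (S [ v ]≔ true) ⟧))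
    ≡⟨ ∑-swap 𝒮 (allFin n) _ ⟩
  ∑ (allFin n) (λ v → ∑ 𝒮 (λ S → ⟦ not (lookup S v) ⟧ * ⟦ indepOfSizeᵇ M (suc k) (S [ v ]≔ true) ⟧))
    ≡⟨ ∑-cong (allFin n) (λ v → ∑-toggle v (λ S → ⟦ indepOfSizeᵇ M (suc k) S ⟧)) ⟩
  ∑ (allFin n) (λ v → ∑ 𝒮 (λ S → ⟦ lookup S v ⟧ * ⟦ indepOfSizeᵇ M (suc k) S ⟧))
    ≡⟨ ∑-swap (allFin n) 𝒮 _ ⟩
  ∑ 𝒮 (λ S → ∑ (allFin n) (λ v → ⟦ lookup S v ⟧ * ⟦ indepOfSizeᵇ M (suc k) S ⟧))
    ≡⟨ ∑-cong 𝒮 (λ S → trans (∑-*ʳ (allFin n) ⟦ indepOfSizeᵇ M (suc k) S ⟧ _) (size S)) ⟩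
  ∑ 𝒮 (λ S → suc k * ⟦ indepOfSizeᵇ M (suc k) S ⟧)
    ≡⟨ ∑-*ˡ 𝒮 (suc k) _ ⟩
  suc k * ∑ 𝒮 (λ S → ⟦ indepOfSizeᵇ M (suc k) S ⟧)
    ≡⟨ cong (suc k *_) (sym (X-∑ (suc k) M)) ⟩
  suc k * X (suc k) M ∎
  where
  open ≤-Reasoning
  𝒮 = allSubsets n
  step : ∀ S v → ⟦ indepOfSizeᵇ M k S ⟧ * ⟦ freeᵇ M S v ⟧ ≤ ⟦ not (lookup S v) ⟧ * ⟦ indepOfSizeᵇ M (suc k) (S [ v ]≔ true) ⟧
  step S v = subst₂ _≤_ (⟦⟧-∧ (indepOfSizeᵇ M k S) (freeᵇ M S v)) (⟦⟧-∧ (not (lookup S v)) (indepOfSizeᵇ M (suc k) (S [ v ]≔ true))) (⟦⟧-mono λ e →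
    let p , fr = ∧-split {indepOfSizeᵇ M k S} e
        ind , sz = ∧-split {isIndependentᵇ M S} p
        v∉S = proj₁ (∧-split {not (lookup S v)} fr)
    in ∧-intro v∉S (∧-intro
         (independentᵇ M (S [ v ]≔ true) (insert-independent M sg S v (independent M S ind) fr))
         (≡⇒≡ᵇ′ (trans (∣insert∣ S v (not-true v∉S)) (cong suc (≡ᵇ⇒≡′ sz))))))
  size : ∀ S → ∑ (allFin n) (λ v → ⟦ lookup S v ⟧) * ⟦ indepOfSizeᵇ M (suc k) S ⟧ ≡ suc k * ⟦ indepOfSizeᵇ M (suc k) S ⟧
  size S with indepOfSizeᵇ M (suc k) S in eq
  ... | true  = cong (_* 1) (trans (∣∣-∑ S) (≡ᵇ⇒≡′ (proj₂ (∧-split {isIndependentᵇ M S} eq))))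
  ... | false = trans (*-zeroʳ (∑ (allFin n) (λ v → ⟦ lookup S v ⟧))) (sym (*-zeroʳ (suc k)))

bad : ∀ {n} → AdjMat n → ℕ → ℕ → ℕ
bad {n} M k t = ∑ (allSubsets n) (λ S → ⟦ indepOfSizeᵇ M k S ⟧ * ⟦ free M S ≤ᵇ t ⟧)

-- An independent `k`-set either has at least `t + 1` free vertices or is counted by `bad`, so the
-- inequality holds set by set before `∑-free≤` is applied.
extensions≤ : ∀ {n} (M : AdjMat n) → IsSimpleGraph M → ∀ k t →
  suc t * X k M ≤ suc k * X (suc k) M + suc t * bad M k t
extensions≤ {n} M sg k t = begin
  suc t * X k M ≡⟨ cong (suc t *_) (X-∑ k M) ⟩
  suc t * ∑ 𝒮 (λ S → ⟦ indepOfSizeᵇ M k S ⟧) ≡⟨ sym (∑-*ˡ 𝒮 (suc t) _) ⟩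
  ∑ 𝒮 (λ S → suc t * ⟦ indepOfSizeᵇ M k S ⟧) ≤⟨ ∑-mono 𝒮 pointwise ⟩
  ∑ 𝒮 (λ S → ⟦ indepOfSizeᵇ M k S ⟧ * free M S + suc t * (⟦ indepOfSizeᵇ M k S ⟧ * ⟦ free M S ≤ᵇ t ⟧)) ≡⟨ ∑-+ 𝒮 _ _ ⟩
  ∑ 𝒮 (λ S → ⟦ indepOfSizeᵇ M k S ⟧ * free M S) + ∑ 𝒮 (λ S → suc t * (⟦ indepOfSizeᵇ M k S ⟧ * ⟦ free M S ≤ᵇ t ⟧))
    ≤⟨ +-mono-≤ (∑-free≤ M sg k) (≤-reflexive (∑-*ˡ 𝒮 (suc t) _)) ⟩
  suc k * X (suc k) M + suc t * bad M k t ∎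
  where
  open ≤-Reasoning
  𝒮 = allSubsets n
  pointwise : ∀ S → suc t * ⟦ indepOfSizeᵇ M k S ⟧ ≤ ⟦ indepOfSizeᵇ M k S ⟧ * free M S + suc t * (⟦ indepOfSizeᵇ M k S ⟧ * ⟦ free M S ≤ᵇ t ⟧)
  pointwise S with indepOfSizeᵇ M k S | free M S ≤ᵇ t in eq
  ... | false | _     = ≤-reflexive (cong (suc t *_) refl)
  ... | true  | true  = m≤n+m (suc t * 1) (1 * free M S)
  ... | true  | false = ≤-trans (≤-reflexive (*-identityʳ (suc t)))
        (≤-trans (≰⇒> {free M S} λ le → subst T eq (≤⇒≤ᵇ le)) (≤-trans (≤-reflexive (sym (*-identityˡ (free M S)))) (m≤m+n (1 * free M S) (suc t * (1 * 0)))))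

-- Forests

Edge : ∀ {n} → AdjMat n → Fin n → Fin n → Set
Edge M u v = lookup (lookup M u) v ≡ true

adj⇒edge : ∀ {n} (M : AdjMat n) u v → Adj M u v → Edge M u v
adj⇒edge M u v = Equivalence.to T-≡

edge⇒adj : ∀ {n} (M : AdjMat n) u v → Edge M u v → Adj M u v
edge⇒adj M u v = Equivalence.from T-≡

module Forest {n} (M : AdjMat n) (simple : IsSimpleGraph M) (acyclic : ¬ HasCycle M) where

  private
    flip-edge : ∀ {u v} → Edge M u v → Edge M v u
    flip-edge {u} {v} e = trans (sym (proj₁ simple u v)) e

    no-loop : ∀ {u} → ¬ Edge M u u
    no-loop {u} e with trans (sym e) (proj₂ simple u)
    ... | ()

  -- The last component says that cutting the walk at `w` adds no vertices; applied to predicates of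
  -- the form "differs from `u`" it preserves distinctness.
  prefix : ∀ v vs w → w ∈ v ∷ vs → IsWalk M (v ∷ vs) → Unique (v ∷ vs) →
    ∃ λ ts → IsWalk M (v ∷ ts) × Unique (v ∷ ts) × StartsEnds (v ∷ ts) v w ×
             (∀ {P : Fin n → Set} → All P vs → All P ts)
  prefix v vs .v (here refl) _ _ = [] , walk-one v , [] ∷ [] , se-one v , (λ _ → [])
  prefix v (y ∷ ys) w (there i) (walk-cons _ _ _ vy wlk) (v∉ ∷ uq) with prefix y ys w i wlk uq
  ... | ts , wlk′ , uq′ , se , sub = y ∷ ts , walk-cons v y ts vy wlk′ , (transfer v∉ ∷ uq′) , se-cons v y ts w se , transfer
    where
    transfer : ∀ {P : Fin n → Set} → All P (y ∷ ys) → All P (y ∷ ts)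
    transfer (p ∷ ps) = p ∷ sub ps

  -- Such an edge would close the part of the walk from `u` to `w` into a cycle, of length at least
  -- three because `x` lies in between.
  no-chord : ∀ u x ys w → IsWalk M (u ∷ x ∷ ys) → Unique (u ∷ x ∷ ys) → w ∈ ys → ¬ Edge M w u
  no-chord u x ys w (walk-cons _ _ _ ux wlk) ((u≢x ∷ u∉) ∷ (x∉ ∷ uq)) i e with prefix x ys w (there i) wlk (x∉ ∷ uq)
  ... | [] , _ , _ , se-one _ , _ = All.lookup x∉ i refl
  ... | t ∷ ts , wlk′ , uq′ , se , sub = acyclic
    (u ∷ x ∷ t ∷ ts , u , w , (walk-cons u x (t ∷ ts) ux wlk′ , ((u≢x ∷ sub u∉) ∷ uq′) , se-cons u x (t ∷ ts) w se) ,
     s≤s (s≤s (s≤s z≤n)) , edge⇒adj M w u e)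

  -- Degree at most one inside `S`. In the second form `x` is a neighbour of `v` that may lie
  -- outside `S`; it later serves as the value of the map at `v`.
  LeafIn : Subset n → Fin n → Set
  LeafIn S v = (∀ w → lookup S w ≡ true → ¬ Edge M v w) ⊎
               (∃ λ x → Edge M v x × (∀ w → lookup S w ≡ true → Edge M v w → w ≡ x))

  open DecMembership (Fin._≟_ {n}) using (_∈?_)

  -- A walk of distinct vertices of S is extended until its head has no neighbour in S off the walk.
  grow : ∀ fuel S u rest → lookup S u ≡ true → IsWalk M (u ∷ rest) → Unique (u ∷ rest) →
         n < fuel + length (u ∷ rest) → ∃ λ v → lookup S v ≡ true × LeafIn S v
  -- The fuel cannot run out: by then the walk would have more than `n` distinct vertices.
  grow zero S u rest u∈S wlk uq bound = ⊥-elim (<⇒≱ bound (begin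
    length (u ∷ rest)               ≤⟨ length≤∑ Fin._≟_ id (allFin n) (λ _ → true) (u ∷ rest) uq
                                         (All.universal (λ x → x , ∈-allFin x , refl , refl) _) ⟩
    ∑ (allFin n) (λ _ → 1)          ≡⟨ ∑-const (allFin n) 1 ⟩
    length (allFin n) * 1           ≡⟨ *-identityʳ _ ⟩
    length (allFin n)               ≡⟨ length-tabulate {n = n} id ⟩
    n                               ∎))
    where
    open ≤-Reasoning
  grow (suc fuel) S u rest u∈S wlk uq bound
    with Fin.any? (λ w → (lookup S w Bool.≟ true) ×-dec ((lookup (lookup M u) w Bool.≟ true) ×-dec ¬? (w ∈? (u ∷ rest))))
  ... | yes (w , w∈S , e , w∉) = grow fuel S w (u ∷ rest) w∈S
          (walk-cons w u rest (edge⇒adj M w u (flip-edge e)) wlk) (¬Any⇒All¬ (u ∷ rest) w∉ ∷ uq)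
          (≤-trans bound (≤-reflexive (sym (+-suc fuel _))))
  ... | no none = u , u∈S , leaf rest wlk uq λ w w∈S e → on-walk w w∈S e (w ∈? (u ∷ rest))
    where
    on-walk : ∀ w → lookup S w ≡ true → Edge M u w → Dec (w ∈ u ∷ rest) → w ∈ u ∷ rest
    on-walk w w∈S e (yes i) = i
    on-walk w w∈S e (no ¬i) = ⊥-elim (none (w , w∈S , e , ¬i))
    leaf : ∀ rest → IsWalk M (u ∷ rest) → Unique (u ∷ rest) →
           (∀ w → lookup S w ≡ true → Edge M u w → w ∈ u ∷ rest) → LeafIn S u
    leaf [] wlk uq on = inj₁ λ w w∈S e → case-nil w e (on w w∈S e)
      where
      case-nil : ∀ w → Edge M u w → w ∈ u ∷ [] → ⊥
      case-nil w e (here refl) = no-loop e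
    leaf (x ∷ ys) wlk@(walk-cons _ _ _ ux _) uq on = inj₂ (x , adj⇒edge M u x ux , λ w w∈S e → case-cons w e (on w w∈S e))
      where
      case-cons : ∀ w → Edge M u w → w ∈ u ∷ x ∷ ys → w ≡ x
      case-cons w e (here refl)         = ⊥-elim (no-loop e)
      case-cons w e (there (here refl)) = refl
      case-cons w e (there (there i))   = ⊥-elim (no-chord u x ys w wlk uq i (flip-edge e))

  leaf-in : ∀ S u → lookup S u ≡ true → ∃ λ v → lookup S v ≡ true × LeafIn S v
  leaf-in S u u∈S = grow n S u [] u∈S (walk-one u) ([] ∷ []) (≤-reflexive (sym (+-comm n 1)))

member-of : ∀ {n s} (S : Subset n) → suc s ≤ ∣ S ∣ → ∃ λ u → lookup S u ≡ true
member-of (true ∷ S)  h = zero , refl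
member-of (false ∷ S) h = let u , e = member-of S h in suc u , e

delete : ∀ {n} → Subset n → Fin n → Subset n
delete S v = S [ v ]≔ false

∣delete∣ : ∀ {n} (S : Subset n) v → lookup S v ≡ true → suc ∣ delete S v ∣ ≡ ∣ S ∣
∣delete∣ (true ∷ S)  zero    e = refl
∣delete∣ (true ∷ S)  (suc v) e = cong suc (∣delete∣ S v e)
∣delete∣ (false ∷ S) (suc v) e = ∣delete∣ S v e

∣delete∣≥ : ∀ {n} (S : Subset n) v → ∣ S ∣ ≤ suc ∣ delete S v ∣
∣delete∣≥ (true ∷ S)  zero    = ≤-refl
∣delete∣≥ (false ∷ S) zero    = n≤1+n _
∣delete∣≥ (true ∷ S)  (suc v) = s≤s (∣delete∣≥ S v)
∣delete∣≥ (false ∷ S) (suc v) = ∣delete∣≥ S v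

delete-⊆ : ∀ {n} (S : Subset n) v w → lookup (delete S v) w ≡ true → lookup S w ≡ true × w ≢ v
delete-⊆ S v w e with w Fin.≟ v
... | yes refl with trans (sym e) (lookup∘update w S false)
...   | ()
delete-⊆ S v w e | no w≢v = trans (sym (lookup∘update′ w≢v S false)) e , w≢v

∈-allSubsets : ∀ {n} (S : Subset n) → S ∈ allSubsets n
∈-allSubsets []          = here refl
∈-allSubsets (true ∷ S)  = ∈-++⁺ˡ (∈-map⁺ (true ∷_) (∈-allSubsets S))
∈-allSubsets {suc n} (false ∷ S) = ∈-++⁺ʳ (map (true ∷_) (allSubsets n)) (∈-map⁺ (false ∷_) (∈-allSubsets S))

C-mono : ∀ {m n} k → m ≤ n → m choose k ≤ n choose k
C-mono {m} {n} k m≤n = subst (λ x → m choose k ≤ x choose k) (m+[n∸m]≡n m≤n) (grow′ (n ∸ m))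
  where
  step : ∀ j k → j choose k ≤ suc j choose k
  step j zero    = ≤-refl
  step j (suc k) = ≤-trans (m≤n+m _ (j choose k)) (≤-reflexive (nCk+nC[k+1]≡[n+1]C[k+1] j k))
  grow′ : ∀ d → m choose k ≤ (m + d) choose k
  grow′ zero    = ≤-reflexive (cong (_choose k) (sym (+-identityʳ m)))
  grow′ (suc d) = ≤-trans (grow′ d) (≤-trans (step (m + d) k) (≤-reflexive (cong (_choose k) (sym (+-suc m d)))))

_⊆ᵇ_ : ∀ {n} → Subset n → Subset n → Bool
_⊆ᵇ_ {n} I S = allᵇ (λ v → not (lookup I v ∧ not (lookup S v))) (allFin n)

⊆ᵇ-sound : ∀ {n} (I S : Subset n) → I ⊆ᵇ S ≡ true → ∀ v → lookup I v ≡ true → lookup S v ≡ true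
⊆ᵇ-sound {n} I S e v v∈I = imp (allᵇ-∈ (λ v → not (lookup I v ∧ not (lookup S v))) {allFin n} e (∈-allFin v)) v∈I
  where
  imp : ∀ {a b} → not (a ∧ not b) ≡ true → a ≡ true → b ≡ true
  imp {true} {true} _ _ = refl

⊆ᵇ-complete : ∀ {n} (I S : Subset n) → (∀ v → lookup I v ≡ true → lookup S v ≡ true) → I ⊆ᵇ S ≡ true
⊆ᵇ-complete {n} I S h = allᵇ-intro _ (allFin n) λ v → imp (lookup I v) (lookup S v) (h v)
  where
  imp : ∀ a b → (a ≡ true → b ≡ true) → not (a ∧ not b) ≡ true
  imp false b     h = refl
  imp true  true  h = refl
  imp true  false h = h refl

-- Independent sets in a forest are at least as many as in a path

module PathBound {n} (M : AdjMat n) (simple : IsSimpleGraph M) (acyclic : ¬ HasCycle M) where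
  open Forest M simple acyclic

  inside : Subset n → ℕ → Subset n → Bool
  inside S k I = indepOfSizeᵇ M k I ∧ (I ⊆ᵇ S)

  Y : Subset n → ℕ → ℕ
  Y S k = ∑ (allSubsets n) (λ I → ⟦ inside S k I ⟧)

  Y-zero : ∀ S → 1 ≤ Y S 0
  Y-zero S = ≤-trans (≤-reflexive (sym (cong ⟦_⟧ ∅-inside))) (∈⇒≤∑ (λ I → ⟦ inside S 0 I ⟧) (∈-allSubsets ∅))
    where
    ∅ : Subset n
    ∅ = Vec.replicate n false
    ∅-empty : ∀ {v} {A : Set} → lookup ∅ v ≡ true → A
    ∅-empty {v} e with trans (sym e) (lookup-replicate v false)
    ... | ()
    ∅-inside : inside S 0 ∅ ≡ true
    ∅-inside = ∧-intro (∧-intro (independentᵇ M ∅ (λ i j e _ → ∅-empty e)) (≡⇒≡ᵇ′ (∣⊥∣≡0 n)))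
                       (⊆ᵇ-complete ∅ S (λ v e → ∅-empty e))

  -- Independent subsets of S are split by whether they contain v.
  Y-split : ∀ S v x k → lookup S v ≡ true → (∀ w → lookup S w ≡ true → Edge M v w → w ≡ x) →
            Y (delete S v) (suc k) + Y (delete (delete S v) x) k ≤ Y S (suc k)
  Y-split S v x k v∈S only = begin
    Y (delete S v) (suc k) + Y (delete (delete S v) x) k
      ≤⟨ +-mono-≤ (∑-mono 𝒮 avoid) (∑-mono 𝒮 extend) ⟩
    ∑ 𝒮 (λ I → ⟦ not (lookup I v) ⟧ * ⟦ inside S (suc k) I ⟧) + ∑ 𝒮 (λ I → ⟦ not (lookup I v) ⟧ * ⟦ inside S (suc k) (I [ v ]≔ true) ⟧)
      ≡⟨ cong (∑ 𝒮 (λ I → ⟦ not (lookup I v) ⟧ * ⟦ inside S (suc k) I ⟧) +_) (∑-toggle v (λ I → ⟦ inside S (suc k) I ⟧)) ⟩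
    ∑ 𝒮 (λ I → ⟦ not (lookup I v) ⟧ * ⟦ inside S (suc k) I ⟧) + ∑ 𝒮 (λ I → ⟦ lookup I v ⟧ * ⟦ inside S (suc k) I ⟧)
      ≡⟨ sym (∑-+ 𝒮 _ _) ⟩
    ∑ 𝒮 (λ I → ⟦ not (lookup I v) ⟧ * ⟦ inside S (suc k) I ⟧ + ⟦ lookup I v ⟧ * ⟦ inside S (suc k) I ⟧)
      ≡⟨ ∑-cong 𝒮 (λ I → either (lookup I v) ⟦ inside S (suc k) I ⟧) ⟩
    Y S (suc k) ∎
    where
    open ≤-Reasoning
    𝒮 = allSubsets n
    either : ∀ b m → ⟦ not b ⟧ * m + ⟦ b ⟧ * m ≡ m
    either true  m = *-identityˡ m
    either false m = trans (+-identityʳ (1 * m)) (*-identityˡ m)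
    false-if : ∀ {b} → ¬ b ≡ true → not b ≡ true
    false-if {false} _ = refl
    false-if {true}  h = ⊥-elim (h refl)
    not-false : ∀ {b} → not b ≡ true → b ≡ false
    not-false {false} _ = refl
    avoid : ∀ I → ⟦ inside (delete S v) (suc k) I ⟧ ≤ ⟦ not (lookup I v) ⟧ * ⟦ inside S (suc k) I ⟧
    avoid I = ≤-trans (⟦⟧-mono {c = not (lookup I v) ∧ inside S (suc k) I} λ e →
        let p , sub = ∧-split {indepOfSizeᵇ M (suc k) I} e
            sub′ = λ w w∈I → delete-⊆ S v w (⊆ᵇ-sound I (delete S v) sub w w∈I)
        in ∧-intro (false-if λ v∈I → proj₂ (sub′ v v∈I) refl) (∧-intro p (⊆ᵇ-complete I S λ w w∈I → proj₁ (sub′ w w∈I))))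
      (≤-reflexive (⟦⟧-∧ (not (lookup I v)) (inside S (suc k) I)))
    extend : ∀ I → ⟦ inside (delete (delete S v) x) k I ⟧ ≤ ⟦ not (lookup I v) ⟧ * ⟦ inside S (suc k) (I [ v ]≔ true) ⟧
    extend I = ≤-trans (⟦⟧-mono {c = not (lookup I v) ∧ inside S (suc k) (I [ v ]≔ true)} λ e →
        let p , sub = ∧-split {indepOfSizeᵇ M k I} e
            ind , sz = ∧-split {isIndependentᵇ M I} p
            sub₁ = λ w w∈I → delete-⊆ (delete S v) x w (⊆ᵇ-sound I (delete (delete S v) x) sub w w∈I)
            sub₂ = λ w w∈I → delete-⊆ S v w (proj₁ (sub₁ w w∈I))
            v∉I = false-if λ v∈I → proj₂ (sub₂ v v∈I) refl
            fr = ∧-intro v∉I (allᵇ-intro (λ u → not (lookup I u ∧ lookup (lookup M u) v)) (allFin n)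
                   λ u → false-if λ uv → let u∈I , e = ∧-split {lookup I u} uv in
                     proj₂ (sub₁ u u∈I) (only u (proj₁ (sub₂ u u∈I)) (trans (sym (proj₁ simple u v)) e)))
        in ∧-intro v∉I (∧-intro
             (∧-intro (independentᵇ M (I [ v ]≔ true) (insert-independent M simple I v (independent M I ind) fr))
                      (≡⇒≡ᵇ′ (trans (∣insert∣ I v (not-false v∉I)) (cong suc (≡ᵇ⇒≡′ sz)))))
             (⊆ᵇ-complete (I [ v ]≔ true) S λ w → into w (sub₂ w))))
      (≤-reflexive (⟦⟧-∧ (not (lookup I v)) (inside S (suc k) (I [ v ]≔ true))))
      where
      into : ∀ w → (lookup I w ≡ true → lookup S w ≡ true × w ≢ v) → lookup (I [ v ]≔ true) w ≡ true → lookup S w ≡ true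
      into w h e with w Fin.≟ v
      ... | yes refl = v∈S
      ... | no w≢v   = proj₁ (h (trans (sym (lookup∘update′ w≢v I true)) e))

  -- By Pascal's rule `F(s, k) = C(s + 1 - k, k)` satisfies `F(s, k + 1) = F(s - 1, k + 1) + F(s -
  -- 2, k)`, and `Y-split` gives the same recursion as an inequality, since removing a leaf and its
  -- neighbour costs at most two vertices. `s` is a lower bound for the size because `x` may already
  -- be missing; `b` carries the recursion, which also descends to `pred s`.
  Y-path : ∀ b s S k → s ≤ b → s ≤ ∣ S ∣ → (suc s ∸ k) choose k ≤ Y S k
  Y-path b s S zero s≤b s≤S = Y-zero S
  Y-path b zero S (suc k) s≤b s≤S = ≤-trans (≤-reflexive (k>n⇒nCk≡0 (s≤s (≤-trans (m∸n≤m 0 k) z≤n)))) z≤n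
  Y-path (suc b) (suc s) S (suc k) (s≤s s≤b) s≤S with member-of S s≤S
  ... | u , u∈S with leaf-in S u u∈S
  ...   | v , v∈S , leafness with sole leafness
    where
    sole : LeafIn S v → ∃ λ x → ∀ w → lookup S w ≡ true → Edge M v w → w ≡ x
    -- Without a neighbour in `S` any `x` would do; for `x = v` the second deletion changes nothing.
    sole (inj₁ none)         = v , λ w w∈S e → ⊥-elim (none w w∈S e)
    sole (inj₂ (x , _ , ob)) = x , ob
  ...     | x , only = begin
    (suc s ∸ k) choose suc k                                           ≤⟨ C-mono (suc k) (suc-∸ s k) ⟩
    suc (s ∸ k) choose suc k                                           ≡⟨ sym (nCk+nC[k+1]≡[n+1]C[k+1] (s ∸ k) k) ⟩
    (s ∸ k) choose k + (s ∸ k) choose suc k                                 ≡⟨ +-comm ((s ∸ k) choose k) _ ⟩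
    (suc s ∸ suc k) choose suc k + (s ∸ k) choose k                         ≤⟨ +-monoʳ-≤ _ (C-mono k (∸-monoˡ-≤ k (suc-pred≥ s))) ⟩
    (suc s ∸ suc k) choose suc k + (suc (pred s) ∸ k) choose k              ≤⟨ +-mono-≤ (Y-path b s (delete S v) (suc k) s≤b small)
                                                                       (Y-path b (pred s) (delete (delete S v) x) k (≤-trans pred[n]≤n s≤b)
                                                                         (pred-mono-≤ (≤-trans small (∣delete∣≥ (delete S v) x)))) ⟩
    Y (delete S v) (suc k) + Y (delete (delete S v) x) k          ≤⟨ Y-split S v x k v∈S only ⟩
    Y S (suc k) ∎
    where
    open ≤-Reasoning
    small : s ≤ ∣ delete S v ∣
    small = ≤-pred (≤-trans s≤S (≤-reflexive (sym (∣delete∣ S v v∈S))))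
    suc-pred≥ : ∀ s → s ≤ suc (pred s)
    suc-pred≥ zero    = z≤n
    suc-pred≥ (suc s) = ≤-refl
    suc-∸ : ∀ s k → suc s ∸ k ≤ suc (s ∸ k)
    suc-∸ s zero          = ≤-refl
    suc-∸ zero (suc k)    = ≤-trans (m∸n≤m 0 k) z≤n
    suc-∸ (suc s) (suc k) = suc-∸ s k

  X-path : ∀ k → (suc n ∸ k) choose k ≤ X k M
  X-path k = begin
    (suc n ∸ k) choose k ≤⟨ Y-path n n full k ≤-refl (≤-reflexive (sym (∣⊤∣≡n n))) ⟩
    Y full k        ≤⟨ ∑-mono (allSubsets n) (λ I → ⟦⟧-mono λ e → proj₁ (∧-split {indepOfSizeᵇ M k I} e)) ⟩
    ∑ (allSubsets n) (λ I → ⟦ indepOfSizeᵇ M k I ⟧) ≡⟨ sym (X-∑ k M) ⟩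
    X k M ∎
    where
    open ≤-Reasoning
    full : Subset n
    full = Vec.replicate n true

-- Trees as graphs of maps

G : ∀ {n} → Vec (Fin n) n → AdjMat n
G f = Vec.tabulate λ u → Vec.tabulate λ v → does (lookup f u Fin.≟ v) ∨ does (lookup f v Fin.≟ u)

lookup-G : ∀ {n} (f : Vec (Fin n) n) u v →
  lookup (lookup (G f) u) v ≡ does (lookup f u Fin.≟ v) ∨ does (lookup f v Fin.≟ u)
lookup-G f u v = trans (cong (λ r → lookup r v) (lookup∘tabulate _ u)) (lookup∘tabulate _ v)

lookup-ext : ∀ {A : Set} {n} {xs ys : Vec A n} → (∀ i → lookup xs i ≡ lookup ys i) → xs ≡ ys
lookup-ext {xs = xs} {ys} h = trans (sym (tabulate∘lookup xs)) (trans (tabulate-cong h) (tabulate∘lookup ys))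

module TreeMap {n} (M : AdjMat n) (simple : IsSimpleGraph M) (connected : Connected M) (acyclic : ¬ HasCycle M) (2≤n : 2 ≤ n) where
  open Forest M simple acyclic

  another : ∀ {m} → 2 ≤ m → (u : Fin m) → ∃ λ v → u ≢ v
  another (s≤s (s≤s _)) zero    = suc zero , λ ()
  another (s≤s (s≤s _)) (suc u) = zero , λ ()

  neighbour : ∀ u → ∃ λ w → Edge M u w
  neighbour u = let v , u≢v = another 2≤n u
                    p , wlk , _ , se = connected u v
                in first p v u≢v wlk se
    where
    first : ∀ p v → u ≢ v → IsWalk M p → StartsEnds p u v → ∃ λ w → Edge M u w
    first _ _ u≢v _ (se-one _) = ⊥-elim (u≢v refl)
    first _ _ _ (walk-cons _ w _ e _) (se-cons _ _ _ _ _) = w , adj⇒edge M u w e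

  Oriented : Subset n → (Fin n → Fin n) → Set
  Oriented S f = (∀ u → Edge M u (f u)) ×
                 (∀ u v → lookup S u ≡ true → lookup S v ≡ true → Edge M u v → f u ≡ v ⊎ f v ≡ u)

  -- A vertex `v` of degree at most one in `S` is sent to its only neighbour, which covers every
  -- edge at `v` inside `S`; the map for `S` without `v` covers the other edges. A vertex left
  -- without neighbours in `S`, such as the last one, gets an arbitrary neighbour in the tree, so
  -- that no foreign edge arises. Such a neighbour exists because the tree is connected and `2 ≤ n`.
  orient : ∀ b S → ∣ S ∣ ≤ b → ∃ (Oriented S)
  orient zero S le = (λ u → proj₁ (neighbour u)) , (λ u → proj₂ (neighbour u)) , λ u v u∈S _ _ → ⊥-elim (none S le u u∈S)
    where
    none : ∀ {m} (S : Subset m) → ∣ S ∣ ≤ 0 → ∀ u → ¬ lookup S u ≡ true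
    none (true ∷ S)  () u
    none (false ∷ S) le (suc u) e = none S le u e
  orient (suc b) S le with ∣ S ∣ in eq
  ... | zero  = orient b S (≤-trans (≤-reflexive eq) z≤n)
  ... | suc s with member-of S (≤-reflexive (sym eq))
  ...   | u₀ , u₀∈S with leaf-in S u₀ u₀∈S
  ...     | v , v∈S , leafness with orient b (delete S v) (≤-pred (≤-trans (≤-reflexive (trans (∣delete∣ S v v∈S) eq)) le))
  ...       | f , onEdges , covers = g leafness , g-edges leafness , g-covers leafness
    where
    target : LeafIn S v → Fin n
    target (inj₁ _)       = proj₁ (neighbour v)
    target (inj₂ (x , _)) = x
    target-edge : ∀ l → Edge M v (target l)
    target-edge (inj₁ _)           = proj₂ (neighbour v)
    target-edge (inj₂ (x , e , _)) = e
    target-sole : ∀ l w → lookup S w ≡ true → Edge M v w → target l ≡ w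
    target-sole (inj₁ none) w w∈S e         = ⊥-elim (none w w∈S e)
    target-sole (inj₂ (x , _ , ob)) w w∈S e = sym (ob w w∈S e)
    g : LeafIn S v → Fin n → Fin n
    g l u with u Fin.≟ v
    ... | yes _ = target l
    ... | no _  = f u
    g-edges : ∀ l u → Edge M u (g l u)
    g-edges l u with u Fin.≟ v
    ... | yes refl = target-edge l
    ... | no _     = onEdges u
    keep : ∀ u → u ≢ v → lookup S u ≡ true → lookup (delete S v) u ≡ true
    keep u u≢v u∈S = trans (lookup∘update′ u≢v S false) u∈S
    g-covers : ∀ l u w → lookup S u ≡ true → lookup S w ≡ true → Edge M u w → g l u ≡ w ⊎ g l w ≡ u
    g-covers l u w u∈S w∈S e with u Fin.≟ v | w Fin.≟ v
    ... | yes refl | _        = inj₁ (target-sole l w w∈S e)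
    ... | no _     | yes refl = inj₂ (target-sole l u u∈S (trans (sym (proj₁ simple u w)) e))
    ... | no u≢v   | no w≢v   = covers u w (keep u u≢v u∈S) (keep w w≢v w∈S) e

  tree-map : ∃ λ f → G f ≡ M
  tree-map with orient n (Vec.replicate n true) (∣p∣≤n (Vec.replicate n true))
  ... | f , onEdges , covers = Vec.tabulate f , lookup-ext λ u → lookup-ext λ v → trans (lookup-G (Vec.tabulate f) u v)
      (trans (cong₂ (λ a b → does (a Fin.≟ v) ∨ does (b Fin.≟ u)) (lookup∘tabulate f u) (lookup∘tabulate f v)) (agree u v))
    where
    agree : ∀ u v → does (f u Fin.≟ v) ∨ does (f v Fin.≟ u) ≡ lookup (lookup M u) v
    agree u v with f u Fin.≟ v | f v Fin.≟ u
    ... | yes refl | _        = sym (onEdges u)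
    ... | no _     | yes refl = sym (trans (proj₁ simple u v) (onEdges v))
    ... | no ≢₁    | no ≢₂    with lookup (lookup M u) v in eq
    ...   | false = refl
    ...   | true  with covers u v (lookup-replicate u true) (lookup-replicate v true) eq
    ...     | inj₁ e = ⊥-elim (≢₁ e)
    ...     | inj₂ e = ⊥-elim (≢₂ e)

-- Random maps and occupancy

^-distribʳ-* : ∀ a b n → (a * b) ^ n ≡ a ^ n * b ^ n
^-distribʳ-* a b zero    = refl
^-distribʳ-* a b (suc n) = trans (cong (a * b *_) (^-distribʳ-* a b n)) (interchange a b (a ^ n) (b ^ n))
  where
  interchange : ∀ a b c d → a * b * (c * d) ≡ a * c * (b * d)
  interchange = solve-∀

allMaps : ∀ m n → List (Vec (Fin m) n)
allMaps m zero    = [] ∷ []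
allMaps m (suc n) = concatMap (λ x → map (x ∷_) (allMaps m n)) (allFin m)

∑-maps : ∀ m n (W : Vec (Fin m) (suc n) → ℕ) →
         ∑ (allMaps m (suc n)) W ≡ ∑ (allFin m) (λ x → ∑ (allMaps m n) (λ g → W (x ∷ g)))
∑-maps m n W = trans (∑-concatMap _ (allFin m) W) (∑-cong (allFin m) (λ x → ∑-map (x ∷_) (allMaps m n) W))

∈-allMaps : ∀ {m n} (f : Vec (Fin m) n) → f ∈ allMaps m n
∈-allMaps []      = here refl
∈-allMaps {m} {suc n} (x ∷ f) = ∈-concatMap⁺ (λ x → map (x ∷_) (allMaps m n)) {xs = allFin m}
  (Any.map (λ { refl → ∈-map⁺ (x ∷_) (∈-allMaps f) }) (∈-allFin x))

∑-allFin-const : ∀ m c → ∑ (allFin m) (λ _ → c) ≡ m * c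
∑-allFin-const m c = trans (∑-const (allFin m) c) (cong (_* c) (length-tabulate {n = m} id))

merge : ∀ {A : Set} {n} → Subset n → Vec A n → Vec A n → Vec A n
merge []          []      []      = []
merge (true ∷ S)  (x ∷ g) (y ∷ h) = x ∷ merge S g h
merge (false ∷ S) (x ∷ g) (y ∷ h) = y ∷ merge S g h

lookup-merge-in : ∀ {A : Set} {n} (S : Subset n) (g h : Vec A n) v → lookup S v ≡ true → lookup (merge S g h) v ≡ lookup g v
lookup-merge-in (true ∷ S)  (x ∷ g) (y ∷ h) zero    e = refl
lookup-merge-in (true ∷ S)  (x ∷ g) (y ∷ h) (suc v) e = lookup-merge-in S g h v e
lookup-merge-in (false ∷ S) (x ∷ g) (y ∷ h) (suc v) e = lookup-merge-in S g h v e

lookup-merge-out : ∀ {A : Set} {n} (S : Subset n) (g h : Vec A n) v → lookup S v ≡ false → lookup (merge S g h) v ≡ lookup h v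
lookup-merge-out (false ∷ S) (x ∷ g) (y ∷ h) zero    e = refl
lookup-merge-out (true ∷ S)  (x ∷ g) (y ∷ h) (suc v) e = lookup-merge-out S g h v e
lookup-merge-out (false ∷ S) (x ∷ g) (y ∷ h) (suc v) e = lookup-merge-out S g h v e

-- Each map arises from `m ^ n` pairs, because the values of `g` off `S` and of `h` on `S` are
-- discarded. This makes the values on `S` and off `S` independent without introducing maps with
-- domain `S`.
∑-merge : ∀ m n (S : Subset n) (W : Vec (Fin m) n → ℕ) →
  ∑ (allMaps m n) (λ g → ∑ (allMaps m n) (λ h → W (merge S g h))) ≡ m ^ n * ∑ (allMaps m n) W
∑-merge m zero [] W = trans (cong (_+ 0) refl) (trans (+-identityʳ (∑ (allMaps m 0) W)) (sym (*-identityˡ _)))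
∑-merge m (suc n) (b ∷ S) W = begin
  ∑ (allMaps m (suc n)) (λ g → ∑ (allMaps m (suc n)) (λ h → W (merge (b ∷ S) g h)))
    ≡⟨ ∑-maps m n _ ⟩
  ∑ 𝓕 (λ x → ∑ 𝓜 (λ g → ∑ (allMaps m (suc n)) (λ h → W (merge (b ∷ S) (x ∷ g) h))))
    ≡⟨ ∑-cong 𝓕 (λ x → ∑-cong 𝓜 (λ g → ∑-maps m n _)) ⟩
  ∑ 𝓕 (λ x → ∑ 𝓜 (λ g → ∑ 𝓕 (λ y → ∑ 𝓜 (λ h → W (merge (b ∷ S) (x ∷ g) (y ∷ h))))))
    ≡⟨ ∑-cong 𝓕 (λ x → ∑-swap 𝓜 𝓕 _) ⟩
  ∑ 𝓕 (λ x → ∑ 𝓕 (λ y → ∑ 𝓜 (λ g → ∑ 𝓜 (λ h → W (merge (b ∷ S) (x ∷ g) (y ∷ h))))))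
    ≡⟨ by-head b ⟩
  ∑ 𝓕 (λ x → m * (m ^ n * ∑ 𝓜 (λ f → W (x ∷ f))))
    ≡⟨ trans (∑-*ˡ 𝓕 m _) (cong (m *_) (∑-*ˡ 𝓕 (m ^ n) _)) ⟩
  m * (m ^ n * ∑ 𝓕 (λ x → ∑ 𝓜 (λ f → W (x ∷ f))))
    ≡⟨ sym (*-assoc m (m ^ n) _) ⟩
  m ^ suc n * ∑ 𝓕 (λ x → ∑ 𝓜 (λ f → W (x ∷ f)))
    ≡⟨ cong (m ^ suc n *_) (sym (∑-maps m n W)) ⟩
  m ^ suc n * ∑ (allMaps m (suc n)) W ∎
  where
  open ≡-Reasoning
  𝓕 = allFin m
  𝓜 = allMaps m n
  by-head : ∀ b → ∑ 𝓕 (λ x → ∑ 𝓕 (λ y → ∑ 𝓜 (λ g → ∑ 𝓜 (λ h → W (merge (b ∷ S) (x ∷ g) (y ∷ h)))))) ≡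
                  ∑ 𝓕 (λ x → m * (m ^ n * ∑ 𝓜 (λ f → W (x ∷ f))))
  by-head true  = ∑-cong 𝓕 (λ x → trans (∑-allFin-const m _) (cong (m *_) (∑-merge m n S (λ f → W (x ∷ f)))))
  by-head false = trans (∑-allFin-const m _) (trans (sym (∑-*ˡ 𝓕 m _))
                    (∑-cong 𝓕 (λ y → cong (m *_) (∑-merge m n S (λ f → W (y ∷ f))))))

∏ : ∀ n → (Fin n → ℕ) → ℕ
∏ zero    f = 1
∏ (suc n) f = f zero * ∏ n (f ∘ suc)

∏-cong : ∀ n {f g : Fin n → ℕ} → (∀ i → f i ≡ g i) → ∏ n f ≡ ∏ n g
∏-cong zero    h = refl
∏-cong (suc n) h = cong₂ _*_ (h zero) (∏-cong n (h ∘ suc))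

∏-mono : ∀ n {f g : Fin n → ℕ} → (∀ i → f i ≤ g i) → ∏ n f ≤ ∏ n g
∏-mono zero    h = ≤-refl
∏-mono (suc n) h = *-mono-≤ (h zero) (∏-mono n (h ∘ suc))

∑-∏ : ∀ m n (φ : Fin n → Fin m → ℕ) →
  ∑ (allMaps m n) (λ h → ∏ n (λ v → φ v (lookup h v))) ≡ ∏ n (λ v → ∑ (allFin m) (φ v))
∑-∏ m zero    φ = refl
∑-∏ m (suc n) φ = begin
  ∑ (allMaps m (suc n)) (λ h → ∏ (suc n) (λ v → φ v (lookup h v)))
    ≡⟨ ∑-maps m n (λ h → ∏ (suc n) (λ v → φ v (lookup h v))) ⟩
  ∑ (allFin m) (λ x → ∑ (allMaps m n) (λ h → φ zero x * ∏ n (λ v → φ (suc v) (lookup h v))))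
    ≡⟨ ∑-cong (allFin m) (λ x → trans (∑-*ˡ (allMaps m n) (φ zero x) _) (cong (φ zero x *_) (∑-∏ m n (φ ∘ suc)))) ⟩
  ∑ (allFin m) (λ x → φ zero x * ∏ n (λ v → ∑ (allFin m) (φ (suc v))))
    ≡⟨ ∑-*ʳ (allFin m) _ (φ zero) ⟩
  ∑ (allFin m) (φ zero) * ∏ n (λ v → ∑ (allFin m) (φ (suc v))) ∎
  where open ≡-Reasoning

outside : ∀ {n} → Subset n → Subset n → ℕ
outside {n} S A = ∑ (allFin n) (λ v → ⟦ not (lookup S v) ∧ not (lookup A v) ⟧)

Disjoint : ∀ {n} → Subset n → Subset n → Set
Disjoint S A = ∀ v → lookup S v ≡ true → lookup A v ≡ false

outside-∷ : ∀ {n} b c (S A : Subset n) → outside (b ∷ S) (c ∷ A) ≡ ⟦ not b ∧ not c ⟧ + outside S A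
outside-∷ b c S A = ∑-allFin (λ v → ⟦ not (lookup (b ∷ S) v) ∧ not (lookup (c ∷ A) v) ⟧)

outside-total : ∀ {n} (S A : Subset n) → Disjoint S A → ∣ S ∣ + (∣ A ∣ + outside S A) ≡ n
outside-total [] [] d = refl
outside-total (true ∷ S) (true ∷ A) d with d zero refl
... | ()
outside-total (true ∷ S) (false ∷ A) d rewrite outside-∷ true false S A = cong suc (outside-total S A (d ∘ suc))
outside-total (false ∷ S) (true ∷ A) d rewrite outside-∷ false true S A =
  trans (+-suc ∣ S ∣ _) (cong suc (outside-total S A (d ∘ suc)))
outside-total (false ∷ S) (false ∷ A) d rewrite outside-∷ false false S A =
  trans (cong (∣ S ∣ +_) (+-suc ∣ A ∣ _)) (trans (+-suc ∣ S ∣ _) (cong suc (outside-total S A (d ∘ suc))))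

outside≡ : ∀ {n} (S A : Subset n) → Disjoint S A → outside S A ≡ n ∸ ∣ S ∣ ∸ ∣ A ∣
outside≡ {n} S A d = sym (begin
  n ∸ ∣ S ∣ ∸ ∣ A ∣                                        ≡⟨ cong (λ m → m ∸ ∣ S ∣ ∸ ∣ A ∣) (sym (outside-total S A d)) ⟩
  (∣ S ∣ + (∣ A ∣ + outside S A)) ∸ ∣ S ∣ ∸ ∣ A ∣          ≡⟨ cong (_∸ ∣ A ∣) (m+n∸m≡n ∣ S ∣ _) ⟩
  (∣ A ∣ + outside S A) ∸ ∣ A ∣                            ≡⟨ m+n∸m≡n ∣ A ∣ _ ⟩
  outside S A ∎)
  where open ≡-Reasoning

∏-classes : ∀ {n} (S A : Subset n) → Disjoint S A → ∀ c B C →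
  ∏ n (λ w → if lookup S w then c else if lookup A w then B else C) ≡ c ^ ∣ S ∣ * (B ^ ∣ A ∣ * C ^ outside S A)
∏-classes [] [] d c B C = refl
∏-classes (true ∷ S) (true ∷ A) d c B C with d zero refl
... | ()
∏-classes (true ∷ S) (false ∷ A) d c B C rewrite outside-∷ true false S A =
  trans (cong (c *_) (∏-classes S A (d ∘ suc) c B C)) (sym (*-assoc c _ _))
∏-classes (false ∷ S) (true ∷ A) d c B C rewrite outside-∷ false true S A =
  trans (cong (B *_) (∏-classes S A (d ∘ suc) c B C)) (move B (c ^ ∣ S ∣) (B ^ ∣ A ∣) (C ^ outside S A))
  where
  move : ∀ b x y z → b * (x * (y * z)) ≡ x * (b * y * z)
  move = solve-∀
∏-classes (false ∷ S) (false ∷ A) d c B C =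
  trans (cong (C *_) (∏-classes S A (d ∘ suc) c B C)) (trans (move C (c ^ ∣ S ∣) (B ^ ∣ A ∣) (C ^ outside S A))
    (cong (λ r → c ^ ∣ S ∣ * (B ^ ∣ A ∣ * C ^ r)) (sym (outside-∷ false false S A))))
  where
  move : ∀ b x y z → b * (x * (y * z)) ≡ x * (y * (b * z))
  move = solve-∀

∑-two : ∀ {n} (S : Subset n) a b → ∑ (allFin n) (λ x → if lookup S x then a else b) ≡ a * ∣ S ∣ + b * (n ∸ ∣ S ∣)
∑-two [] a b = sym (cong₂ _+_ (*-zeroʳ a) (*-zeroʳ b))
∑-two {suc n} (true ∷ S) a b = trans (∑-allFin (λ x → if lookup (true ∷ S) x then a else b))
  (trans (cong (a +_) (∑-two S a b)) (trans (sym (+-assoc a _ _)) (cong (_+ b * (n ∸ ∣ S ∣)) (sym (*-suc a ∣ S ∣)))))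
∑-two {suc n} (false ∷ S) a b = trans (∑-allFin (λ x → if lookup (false ∷ S) x then a else b))
  (trans (cong (b +_) (∑-two S a b)) (trans (swap b (a * ∣ S ∣) (b * (n ∸ ∣ S ∣)))
    (cong (a * ∣ S ∣ +_) (trans (sym (*-suc b (n ∸ ∣ S ∣))) (cong (b *_) (sym (+-∸-assoc 1 (∣p∣≤n S))))))))
  where
  swap : ∀ x y z → x + (y + z) ≡ y + (x + z)
  swap = solve-∀

image : ∀ {n m} → Subset m → Vec (Fin n) m → Subset n → Subset n
image []          []      A = A
image (true ∷ S)  (x ∷ g) A = image S g (A [ x ]≔ true)
image (false ∷ S) (x ∷ g) A = image S g A

lands : ∀ {n m} → Subset n → Subset m → Vec (Fin n) m → Bool
lands S₀ []          []      = true
lands S₀ (true ∷ S)  (x ∷ g) = not (lookup S₀ x) ∧ lands S₀ S g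
lands S₀ (false ∷ S) (x ∷ g) = lands S₀ S g

image-misses : ∀ {n m} (S : Subset m) (g : Vec (Fin n) m) A w → lookup (image S g A) w ≡ false →
  lookup A w ≡ false × (∀ u → lookup S u ≡ true → lookup g u ≢ w)
image-misses [] [] A w e = e , λ ()
image-misses (true ∷ S) (x ∷ g) A w e with image-misses S g (A [ x ]≔ true) w e
... | e′ , h with x Fin.≟ w
...   | yes refl with trans (sym e′) (lookup∘update w A true)
...     | ()
image-misses (true ∷ S) (x ∷ g) A w e | e′ , h | no x≢w =
  trans (sym (lookup∘update′ (x≢w ∘ sym) A true)) e′ , λ { zero _ → x≢w ; (suc u) → h u }
image-misses (false ∷ S) (x ∷ g) A w e with image-misses S g A w e
... | e′ , h = e′ , λ { (suc u) → h u }

lands-intro : ∀ {n m} (S₀ : Subset n) (S : Subset m) (g : Vec (Fin n) m) →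
  (∀ u → lookup S u ≡ true → lookup S₀ (lookup g u) ≡ false) → lands S₀ S g ≡ true
lands-intro S₀ [] [] h = refl
lands-intro S₀ (true ∷ S) (x ∷ g) h = ∧-intro (cong not (h zero refl)) (lands-intro S₀ S g (h ∘ suc))
lands-intro S₀ (false ∷ S) (x ∷ g) h = lands-intro S₀ S g (h ∘ suc)

lands-disjoint : ∀ {n m} (S₀ : Subset n) (S : Subset m) (g : Vec (Fin n) m) A →
  Disjoint S₀ A → lands S₀ S g ≡ true → Disjoint S₀ (image S g A)
insert-disjoint : ∀ {n} (S A : Subset n) x → Disjoint S A → lookup S x ≡ false → Disjoint S (A [ x ]≔ true)
insert-disjoint S A x d x∉S v v∈S with v Fin.≟ x
... | yes refl with trans (sym v∈S) x∉S
...   | ()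
insert-disjoint S A x d x∉S v v∈S | no v≢x = trans (lookup∘update′ v≢x A true) (d v v∈S)
lands-disjoint S₀ [] [] A d e = d
lands-disjoint S₀ (true ∷ S) (x ∷ g) A d e =
  lands-disjoint S₀ S g (A [ x ]≔ true) (insert-disjoint S₀ A x d (not-inv (proj₁ (∧-split e)))) (proj₂ (∧-split {not (lookup S₀ x)} e))
  where
  not-inv : ∀ {b} → not b ≡ true → b ≡ false
  not-inv {false} _ = refl
lands-disjoint S₀ (false ∷ S) (x ∷ g) A d e = lands-disjoint S₀ S g A d e

-- occ N B C k a is the sum of B ^ (occupied boxes) * C ^ (empty boxes) over all ways of
-- throwing k balls into N boxes of which a are occupied at the start.
occ : ℕ → ℕ → ℕ → ℕ → ℕ → ℕ
occ N B C zero    a = B ^ a * C ^ (N ∸ a)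
occ N B C (suc k) a = (N ∸ a) * occ N B C k (suc a) + a * occ N B C k a

module Occupancy {n} (S₀ : Subset n) (B C : ℕ) where
  N = n ∸ ∣ S₀ ∣

  -- The values on `S` are read one at a time; each of them opens a new box or falls into an
  -- occupied one, which is the recursion of `occ`. The `m - ∣ S ∣` discarded values contribute a
  -- factor `n` each, and `n ^ ∣ S ∣` on the left completes these to `n ^ m` without a subtraction.
  ∑-image : ∀ m (S : Subset m) A → Disjoint S₀ A →
    n ^ ∣ S ∣ * ∑ (allMaps n m) (λ g → ⟦ lands S₀ S g ⟧ * (B ^ ∣ image S g A ∣ * C ^ outside S₀ (image S g A)))
    ≡ n ^ m * occ N B C ∣ S ∣ ∣ A ∣
  ∑-image zero [] A d = cong (1 *_) (trans (+-identityʳ _) (trans (*-identityˡ _) (cong (λ r → B ^ ∣ A ∣ * C ^ r) (outside≡ S₀ A d))))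
  ∑-image (suc m) (false ∷ S) A d = begin
    n ^ ∣ S ∣ * ∑ (allMaps n (suc m)) (λ g → ⟦ lands S₀ (false ∷ S) g ⟧ * (B ^ ∣ image (false ∷ S) g A ∣ * C ^ outside S₀ (image (false ∷ S) g A)))
      ≡⟨ cong (n ^ ∣ S ∣ *_) (trans (∑-maps n m _) (∑-allFin-const n _)) ⟩
    n ^ ∣ S ∣ * (n * Z)   ≡⟨ comm₃ (n ^ ∣ S ∣) n Z ⟩
    n * (n ^ ∣ S ∣ * Z)   ≡⟨ cong (n *_) (∑-image m S A d) ⟩
    n * (n ^ m * occ N B C ∣ S ∣ ∣ A ∣) ≡⟨ sym (*-assoc n (n ^ m) _) ⟩
    n ^ suc m * occ N B C ∣ S ∣ ∣ A ∣ ∎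
    where
    open ≡-Reasoning
    Z = ∑ (allMaps n m) (λ g → ⟦ lands S₀ S g ⟧ * (B ^ ∣ image S g A ∣ * C ^ outside S₀ (image S g A)))
    comm₃ : ∀ x y z → x * (y * z) ≡ y * (x * z)
    comm₃ = solve-∀
  ∑-image (suc m) (true ∷ S) A d = begin
    n ^ suc ∣ S ∣ * ∑ (allMaps n (suc m)) (λ g → ⟦ lands S₀ (true ∷ S) g ⟧ * (B ^ ∣ image (true ∷ S) g A ∣ * C ^ outside S₀ (image (true ∷ S) g A)))
      ≡⟨ cong (n ^ suc ∣ S ∣ *_) (trans (∑-maps n m _) (∑-cong (allFin n) (λ x → factor x))) ⟩
    n * n ^ ∣ S ∣ * ∑ (allFin n) (λ x → ⟦ not (lookup S₀ x) ⟧ * Z (A [ x ]≔ true))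
      ≡⟨ *-assoc n (n ^ ∣ S ∣) _ ⟩
    n * (n ^ ∣ S ∣ * ∑ (allFin n) (λ x → ⟦ not (lookup S₀ x) ⟧ * Z (A [ x ]≔ true)))
      ≡⟨ cong (n *_) (sym (∑-*ˡ (allFin n) (n ^ ∣ S ∣) _)) ⟩
    n * ∑ (allFin n) (λ x → n ^ ∣ S ∣ * (⟦ not (lookup S₀ x) ⟧ * Z (A [ x ]≔ true)))
      ≡⟨ cong (n *_) (∑-cong (allFin n) step) ⟩
    n * ∑ (allFin n) (λ x → n ^ m * (⟦ not (lookup S₀ x) ∧ not (lookup A x) ⟧ * O (suc ∣ A ∣) + ⟦ lookup A x ⟧ * O ∣ A ∣))
      ≡⟨ cong (n *_) (trans (∑-*ˡ (allFin n) (n ^ m) _) (cong (n ^ m *_) (trans (∑-+ (allFin n) _ _)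
          (cong₂ _+_ (trans (∑-*ʳ (allFin n) (O (suc ∣ A ∣)) _) (cong (_* O (suc ∣ A ∣)) (outside≡ S₀ A d)))
                     (trans (∑-*ʳ (allFin n) (O ∣ A ∣) _) (cong (_* O ∣ A ∣) (∣∣-∑ A))))))) ⟩
    n * (n ^ m * ((N ∸ ∣ A ∣) * O (suc ∣ A ∣) + ∣ A ∣ * O ∣ A ∣))
      ≡⟨ sym (*-assoc n (n ^ m) _) ⟩
    n ^ suc m * occ N B C (suc ∣ S ∣) ∣ A ∣ ∎
    where
    open ≡-Reasoning
    O : ℕ → ℕ
    O = occ N B C ∣ S ∣
    z : Subset n → Vec (Fin n) m → ℕ
    z A g = B ^ ∣ image S g A ∣ * C ^ outside S₀ (image S g A)
    Z : Subset n → ℕ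
    Z A = ∑ (allMaps n m) (λ g → ⟦ lands S₀ S g ⟧ * z A g)
    factor : ∀ x → ∑ (allMaps n m) (λ g → ⟦ not (lookup S₀ x) ∧ lands S₀ S g ⟧ * z (A [ x ]≔ true) g) ≡ ⟦ not (lookup S₀ x) ⟧ * Z (A [ x ]≔ true)
    factor x = trans (∑-cong (allMaps n m) (λ g → trans (cong (_* z (A [ x ]≔ true) g) (⟦⟧-∧ (not (lookup S₀ x)) _)) (*-assoc ⟦ not (lookup S₀ x) ⟧ _ _)))
                     (∑-*ˡ (allMaps n m) ⟦ not (lookup S₀ x) ⟧ _)
    step : ∀ x → n ^ ∣ S ∣ * (⟦ not (lookup S₀ x) ⟧ * Z (A [ x ]≔ true)) ≡
                 n ^ m * (⟦ not (lookup S₀ x) ∧ not (lookup A x) ⟧ * O (suc ∣ A ∣) + ⟦ lookup A x ⟧ * O ∣ A ∣)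
    step x with lookup S₀ x in eS | lookup A x in eA
    ... | true  | true  with trans (sym eA) (d x eS)
    ...   | ()
    step x | true  | false = trans (*-zeroʳ (n ^ ∣ S ∣)) (sym (*-zeroʳ (n ^ m)))
    step x | false | true  = trans (cong (n ^ ∣ S ∣ *_) (*-identityˡ _)) (trans
      (trans (∑-image m S (A [ x ]≔ true) (insert-disjoint S₀ A x d eS))
             (cong (λ A′ → n ^ m * O ∣ A′ ∣) (trans (cong (λ b → A [ x ]≔ b) (sym eA)) ([]≔-lookup A x))))
      (cong (n ^ m *_) (sym (*-identityˡ _))))
    step x | false | false = trans (cong (n ^ ∣ S ∣ *_) (*-identityˡ _)) (trans
      (trans (∑-image m S (A [ x ]≔ true) (insert-disjoint S₀ A x d eS))
             (cong (λ a → n ^ m * O a) (∣insert∣ A x eA)))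
      (cong (n ^ m *_) (sym (trans (+-identityʳ _) (*-identityˡ _)))))

-- Exponential moments of the number of free vertices of a random map

weight : ∀ {n} → ℕ → ℕ → AdjMat n → Subset n → ℕ
weight {n} σ τ M S = ⟦ isIndependentᵇ M S ⟧ * ∏ n (λ w → if lookup S w then 1 else if freeᵇ M S w then σ else τ)

module Moment {n} (σ τ : ℕ) (σ≤τ : σ ≤ τ) (S : Subset n) where

  ∅ : Subset n
  ∅ = Vec.replicate n false

  -- Total weight of a vertex outside `S` over its `n` possible values: `B` if it is itself a value
  -- of the map on `S` and hence never free, `C` otherwise, when it fails to be free exactly for the
  -- values in `S`.
  B C : ℕ
  B = n * τ
  C = τ * ∣ S ∣ + σ * (n ∸ ∣ S ∣)

  φ : Subset n → Fin n → Fin n → ℕ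
  φ A w x = if lookup S w then 1 else if lookup A w then τ else if lookup S x then τ else σ

  G-edge₁ : ∀ (f : Vec (Fin n) n) u → lookup (lookup (G f) u) (lookup f u) ≡ true
  G-edge₁ f u = trans (lookup-G f u (lookup f u))
    (cong (_∨ does (lookup f (lookup f u) Fin.≟ u)) (dec-true (lookup f u Fin.≟ lookup f u) refl))

  at-most : ∀ b → (if b then σ else τ) ≤ τ
  at-most true  = σ≤τ
  at-most false = ≤-refl

  -- An edge between `w` outside `S` and `u` in `S` means `f u = w` or `f w = u`. The former is
  -- decided by the values on `S`, the latter by the value at `w` alone. Once the values on `S` are
  -- fixed, the bound is thus a product over `w` and can be summed one coordinate at a time.
  weight-merge : ∀ g h → weight σ τ (G (merge S g h)) S ≤ ⟦ lands S S g ⟧ * ∏ n (λ w → φ (image S g ∅) w (lookup h w))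
  weight-merge g h with isIndependentᵇ (G (merge S g h)) S in eq
  ... | false = z≤n
  ... | true = *-mono-≤ (≤-reflexive (sym (cong ⟦_⟧ landing))) (∏-mono n bound)
    where
    f = merge S g h
    ind : Independent (G f) S
    ind = independent (G f) S eq
    landing : lands S S g ≡ true
    landing = lands-intro S S g avoid
      where
      avoid : ∀ u → lookup S u ≡ true → lookup S (lookup g u) ≡ false
      avoid u u∈S with lookup S (lookup g u) in e
      ... | false = refl
      ... | true  = trans (sym (G-edge₁ f u))
                      (ind u (lookup f u) u∈S (trans (cong (lookup S) (lookup-merge-in S g h u u∈S)) e))
    bound : ∀ w → (if lookup S w then 1 else if freeᵇ (G f) S w then σ else τ) ≤ φ (image S g ∅) w (lookup h w)
    bound w with lookup S w in w∉S
    ... | true  = ≤-refl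
    ... | false with lookup (image S g ∅) w in missed
    ...   | true = at-most (allᵇ (λ u → not (lookup S u ∧ lookup (lookup (G f) u) w)) (allFin n))
    ...   | false with lookup S (lookup h w) in hw∉S
    ...     | true = at-most (allᵇ (λ u → not (lookup S u ∧ lookup (lookup (G f) u) w)) (allFin n))
    ...     | false = ≤-reflexive (cong (λ b → if b then σ else τ)
        (allᵇ-intro (λ u → not (lookup S u ∧ lookup (lookup (G f) u) w)) (allFin n) no-edge))
      where
      no-edge : ∀ u → not (lookup S u ∧ lookup (lookup (G f) u) w) ≡ true
      no-edge u with lookup S u in u∈S
      ... | false = refl
      ... | true  = cong not (trans (lookup-G f u w) (cong₂ _∨_ (dec-false (lookup f u Fin.≟ w) left) (dec-false (lookup f w Fin.≟ u) right)))
        where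
        left : lookup f u ≢ w
        left e = proj₂ (image-misses S g ∅ w missed) u u∈S (trans (sym (lookup-merge-in S g h u u∈S)) e)
        right : lookup f w ≢ u
        right e with trans (sym u∈S) (trans (cong (lookup S) (trans (sym e) (lookup-merge-out S g h w w∉S))) hw∉S)
        ... | ()

  ∑-φ : ∀ A w → ∑ (allFin n) (φ A w) ≡ (if lookup S w then n else if lookup A w then B else C)
  ∑-φ A w with lookup S w
  ... | true = trans (∑-allFin-const n 1) (*-identityʳ n)
  ... | false with lookup A w
  ...   | true  = ∑-allFin-const n τ
  ...   | false = ∑-two S τ σ

  open Occupancy S B C using (∑-image)

  ∑-weight : .{{NonZero n}} → ∑ (allMaps n n) (λ f → weight σ τ (G f) S) ≤ occ (n ∸ ∣ S ∣) B C ∣ S ∣ 0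
  ∑-weight = *-cancelˡ-≤ (n ^ n) {{m^n≢0 n n}} (begin
    n ^ n * ∑ 𝓜 (λ f → weight σ τ (G f) S)
      ≡⟨ sym (∑-merge n n S (λ f → weight σ τ (G f) S)) ⟩
    ∑ 𝓜 (λ g → ∑ 𝓜 (λ h → weight σ τ (G (merge S g h)) S))
      ≤⟨ ∑-mono 𝓜 (λ g → ∑-mono 𝓜 (λ h → weight-merge g h)) ⟩
    ∑ 𝓜 (λ g → ∑ 𝓜 (λ h → ⟦ lands S S g ⟧ * ∏ n (λ w → φ (image S g ∅) w (lookup h w))))
      ≡⟨ ∑-cong 𝓜 (λ g → trans (∑-*ˡ 𝓜 ⟦ lands S S g ⟧ _) (cong (⟦ lands S S g ⟧ *_)
           (trans (∑-∏ n n (φ (image S g ∅))) (∏-cong n (∑-φ (image S g ∅)))))) ⟩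
    ∑ 𝓜 (λ g → ⟦ lands S S g ⟧ * ∏ n (λ w → if lookup S w then n else if lookup (image S g ∅) w then B else C))
      ≡⟨ ∑-cong 𝓜 classes ⟩
    ∑ 𝓜 (λ g → n ^ ∣ S ∣ * (⟦ lands S S g ⟧ * (B ^ ∣ image S g ∅ ∣ * C ^ outside S (image S g ∅))))
      ≡⟨ ∑-*ˡ 𝓜 (n ^ ∣ S ∣) _ ⟩
    n ^ ∣ S ∣ * ∑ 𝓜 (λ g → ⟦ lands S S g ⟧ * (B ^ ∣ image S g ∅ ∣ * C ^ outside S (image S g ∅)))
      ≡⟨ ∑-image n S ∅ ∅-disjoint ⟩
    n ^ n * occ (n ∸ ∣ S ∣) B C (∣ S ∣) (∣ ∅ ∣)
      ≡⟨ cong (λ a → n ^ n * occ (n ∸ ∣ S ∣) B C (∣ S ∣) a) (∣⊥∣≡0 n) ⟩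
    n ^ n * occ (n ∸ ∣ S ∣) B C ∣ S ∣ 0 ∎)
    where
    open ≤-Reasoning
    𝓜 = allMaps n n
    ∅-disjoint : Disjoint S ∅
    ∅-disjoint v _ = lookup-replicate v false
    swap₃ : ∀ x y z → x * (y * z) ≡ y * (x * z)
    swap₃ = solve-∀
    classes : ∀ g → ⟦ lands S S g ⟧ * ∏ n (λ w → if lookup S w then n else if lookup (image S g ∅) w then B else C)
                  ≡ n ^ ∣ S ∣ * (⟦ lands S S g ⟧ * (B ^ ∣ image S g ∅ ∣ * C ^ outside S (image S g ∅)))
    classes g with lands S S g in eq
    ... | false = sym (*-zeroʳ (n ^ ∣ S ∣))
    ... | true  = trans (cong (1 *_) (∏-classes S (image S g ∅) (lands-disjoint S S g ∅ ∅-disjoint eq) n B C))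
                        (swap₃ 1 (n ^ ∣ S ∣) (B ^ ∣ image S g ∅ ∣ * C ^ outside S (image S g ∅)))

-- σ ^ free * τ ^ (non-free) in a form without subtraction.
∏-free : ∀ {n} σ τ (S : Subset n) (b : Fin n → Bool) → (∀ w → lookup S w ≡ true → b w ≡ false) →
  τ ^ ∑ (allFin n) (λ w → ⟦ b w ⟧) * ∏ n (λ w → if lookup S w then 1 else if b w then σ else τ)
  ≡ σ ^ ∑ (allFin n) (λ w → ⟦ b w ⟧) * τ ^ (n ∸ ∣ S ∣)
∏-free σ τ [] b h = refl
∏-free {suc n} σ τ (true ∷ S) b h = trans (cong (λ s → τ ^ s * (1 * P)) head) (trans
    (cong (τ ^ s *_) (*-identityˡ P))
    (trans (∏-free σ τ S (b ∘ suc) (h ∘ suc)) (cong (λ s → σ ^ s * τ ^ (n ∸ ∣ S ∣)) (sym head))))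
  where
  s = ∑ (allFin n) (λ w → ⟦ b (suc w) ⟧)
  P = ∏ n (λ w → if lookup S w then 1 else if b (suc w) then σ else τ)
  head : ∑ (allFin (suc n)) (λ w → ⟦ b w ⟧) ≡ s
  head = trans (∑-allFin (λ w → ⟦ b w ⟧)) (cong (λ c → ⟦ c ⟧ + s) (h zero refl))
∏-free {suc n} σ τ (false ∷ S) b h = trans (cong (λ s → τ ^ s * ((if b zero then σ else τ) * P)) (∑-allFin (λ w → ⟦ b w ⟧)))
  (trans (by-head (b zero)) (cong₂ (λ s r → σ ^ s * τ ^ r) (sym (∑-allFin (λ w → ⟦ b w ⟧))) (sym (+-∸-assoc 1 (∣p∣≤n S)))))
  where
  s = ∑ (allFin n) (λ w → ⟦ b (suc w) ⟧)
  P = ∏ n (λ w → if lookup S w then 1 else if b (suc w) then σ else τ)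
  ih : τ ^ s * P ≡ σ ^ s * τ ^ (n ∸ ∣ S ∣)
  ih = ∏-free σ τ S (b ∘ suc) (h ∘ suc)
  mv : ∀ t u σ P → t * u * (σ * P) ≡ t * σ * (u * P)
  mv = solve-∀
  mv′ : ∀ t σ u v → t * σ * (u * v) ≡ σ * u * (t * v)
  mv′ = solve-∀
  mv″ : ∀ t u P → u * (t * P) ≡ t * (u * P)
  mv″ = solve-∀
  by-head : ∀ c → τ ^ (⟦ c ⟧ + s) * ((if c then σ else τ) * P) ≡ σ ^ (⟦ c ⟧ + s) * τ ^ suc (n ∸ ∣ S ∣)
  by-head true  = trans (mv τ (τ ^ s) σ P) (trans (cong (τ * σ *_) ih) (mv′ τ σ (σ ^ s) (τ ^ (n ∸ ∣ S ∣))))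
  by-head false = trans (mv″ τ (τ ^ s) P) (trans (cong (τ *_) ih) (mv″ (σ ^ s) τ (τ ^ (n ∸ ∣ S ∣))))

-- Markov's inequality for the number of free vertices.
bad-weight : ∀ {n} σ τ → σ ≤ τ → ∀ (M : AdjMat n) k t S →
  ⟦ indepOfSizeᵇ M k S ⟧ * ⟦ free M S ≤ᵇ t ⟧ * (σ ^ t * τ ^ (n ∸ k)) ≤ τ ^ t * (⟦ ∣ S ∣ ≡ᵇ k ⟧ * weight σ τ M S)
bad-weight {n} σ τ σ≤τ M k t S with isIndependentᵇ M S | ∣ S ∣ ≡ᵇ k in ek | free M S ≤ᵇ t in et
... | false | _     | _     = z≤n
... | true  | false | _     = z≤n
... | true  | true  | false = z≤n
... | true  | true  | true  = begin
  1 * (σ ^ t * τ ^ (n ∸ k))                   ≡⟨ *-identityˡ _ ⟩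
  σ ^ t * τ ^ (n ∸ k)                         ≡⟨ cong₂ (λ e m → σ ^ e * τ ^ (n ∸ m)) (sym t-split) (sym (≡ᵇ⇒≡′ {∣ S ∣} ek)) ⟩
  σ ^ (d + F) * τ ^ (n ∸ ∣ S ∣)               ≡⟨ cong (_* τ ^ (n ∸ ∣ S ∣)) (^-distribˡ-+-* σ d F) ⟩
  σ ^ d * σ ^ F * τ ^ (n ∸ ∣ S ∣)             ≡⟨ *-assoc (σ ^ d) _ _ ⟩
  σ ^ d * (σ ^ F * τ ^ (n ∸ ∣ S ∣))           ≡⟨ cong (σ ^ d *_) (sym (∏-free σ τ S (freeᵇ M S) (λ w w∈S → cong (λ b → not b ∧ allᵇ (λ u → not (lookup S u ∧ lookup (lookup M u) w)) (allFin n)) w∈S))) ⟩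
  σ ^ d * (τ ^ F * P)                         ≤⟨ *-monoˡ-≤ (τ ^ F * P) (^-monoˡ-≤ d σ≤τ) ⟩
  τ ^ d * (τ ^ F * P)                         ≡⟨ sym (*-assoc (τ ^ d) _ _) ⟩
  τ ^ d * τ ^ F * P                           ≡⟨ cong (_* P) (trans (sym (^-distribˡ-+-* τ d F)) (cong (τ ^_) t-split)) ⟩
  τ ^ t * P                                   ≡⟨ cong (τ ^ t *_) (sym (trans (*-identityˡ _) (*-identityˡ P))) ⟩
  τ ^ t * (1 * (1 * P)) ∎
  where
  open ≤-Reasoning
  F = free M S
  F≤t : F ≤ t
  F≤t = ≤ᵇ⇒≤ F t (subst T (sym et) _)
  d = t ∸ F
  t-split : d + F ≡ t
  t-split = m∸n+n≡m F≤t
  P = ∏ n (λ w → if lookup S w then 1 else if freeᵇ M S w then σ else τ)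

-- Bernoulli's inequality and the lazy occupancy process

bernoulli-above : ∀ y x m → y ^ m * (y + suc m * x) ≤ (y + x) ^ suc m
bernoulli-above y x zero = ≤-reflexive (base y x)
  where
  base : ∀ y x → 1 * (y + (x + 0 * x)) ≡ (y + x) * 1
  base = solve-∀
bernoulli-above y x (suc m) = begin
  y * y ^ m * (y + suc (suc m) * x)                                    ≤⟨ m≤m+n _ (x * (y ^ m * (suc m * x))) ⟩
  y * y ^ m * (y + suc (suc m) * x) + x * (y ^ m * (suc m * x))        ≡⟨ expand y x (suc m * x) (y ^ m) ⟩
  (y + x) * (y ^ m * (y + suc m * x))                                  ≤⟨ *-monoʳ-≤ (y + x) (bernoulli-above y x m) ⟩
  (y + x) ^ suc (suc m) ∎
  where
  open ≤-Reasoning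
  expand : ∀ y x w p → y * p * (y + (x + w)) + x * (p * w) ≡ (y + x) * (p * (y + w))
  expand = solve-∀

-- This is `(1 - b / (y + b)) ^ q ≥ 1 - q * b / (y + b)`, multiplied by `(y + b) ^ suc q` and with
-- the negative term moved across.
bernoulli-below : ∀ y b q → (y + b) ^ suc q ≤ y ^ q * (y + b) + q * b * (y + b) ^ q
bernoulli-below y b zero = ≤-reflexive (base y b)
  where
  base : ∀ y b → (y + b) * 1 ≡ 1 * (y + b) + 0
  base = solve-∀
bernoulli-below y b (suc q) = begin
  (y + b) * (y + b) ^ suc q
    ≡⟨ *-distribʳ-+ ((y + b) ^ suc q) y b ⟩
  y * (y + b) ^ suc q + b * (y + b) ^ suc q
    ≤⟨ +-monoˡ-≤ _ (*-monoʳ-≤ y (bernoulli-below y b q)) ⟩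
  y * (y ^ q * (y + b) + q * b * (y + b) ^ q) + b * (y + b) ^ suc q
    ≤⟨ m≤m+n _ (b * (q * b * (y + b) ^ q)) ⟩
  y * (y ^ q * (y + b) + q * b * (y + b) ^ q) + b * (y + b) ^ suc q + b * (q * b * (y + b) ^ q)
    ≡⟨ collect y b (y ^ q) (q * b) ((y + b) ^ q) ⟩
  y ^ suc q * (y + b) + suc q * b * (y + b) ^ suc q ∎
  where
  open ≤-Reasoning
  collect : ∀ y b p r s → y * (p * (y + b) + r * s) + b * ((y + b) * s) + b * (r * s) ≡ y * p * (y + b) + (b + r) * ((y + b) * s)
  collect = solve-∀

slots : ℕ → ℕ → ∀ {m} → Subset m → ℕ
slots α β []          = 1
slots α β (true ∷ I)  = β * slots α β I
slots α β (false ∷ I) = α * slots α β I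

slots-power : ∀ α β {m} (I : Subset m) → α ^ ∣ I ∣ * slots α β I ≡ β ^ ∣ I ∣ * α ^ m
slots-power α β [] = refl
slots-power α β (true ∷ I) = trans (mv α (α ^ ∣ I ∣) β _) (trans (cong (α * β *_) (slots-power α β I)) (mv′ α β (β ^ ∣ I ∣) _))
  where
  mv : ∀ a p b s → a * p * (b * s) ≡ a * b * (p * s)
  mv = solve-∀
  mv′ : ∀ a b p s → a * b * (p * s) ≡ b * p * (a * s)
  mv′ = solve-∀
slots-power α β (false ∷ I) = trans (mv (α ^ ∣ I ∣) α _) (trans (cong (α *_) (slots-power α β I)) (mv α (β ^ ∣ I ∣) _))
  where
  mv : ∀ p a s → p * (a * s) ≡ a * (p * s)
  mv = solve-∀

-- Each of m slots throws a ball into one of N boxes, with weight β per box, or stays idle, with weight α;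
-- choosing m = n slots, the set of busy slots plays the role of the independent set.
module Slots (N C E α β γ : ℕ) (β≤ : γ + β ≡ α + β * N) where

  Δ B : ℕ
  Δ = γ + β
  B = C + E

  𝒢 : ℕ → ℕ → ℕ
  𝒢 m a = ∑ (allSubsets m) (λ I → slots α β I * occ N B C ∣ I ∣ a)

  𝒢-suc : ∀ m a → 𝒢 (suc m) a ≡ β * ((N ∸ a) * 𝒢 m (suc a) + a * 𝒢 m a) + α * 𝒢 m a
  𝒢-suc m a = trans (∑-subsets {m} (λ I → slots α β I * occ N B C ∣ I ∣ a)) (cong₂ _+_ thrown idle)
    where
    𝒮 = allSubsets m
    O : ∀ (I : Subset m) → ℕ → ℕ
    O I = occ N B C ∣ I ∣
    w : Subset m → ℕ
    w = slots α β
    mv : ∀ b w r o a o′ → b * w * (r * o + a * o′) ≡ b * (r * (w * o) + a * (w * o′))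
    mv = solve-∀
    thrown : ∑ 𝒮 (λ I → β * w I * ((N ∸ a) * O I (suc a) + a * O I a)) ≡ β * ((N ∸ a) * 𝒢 m (suc a) + a * 𝒢 m a)
    thrown = trans (∑-cong 𝒮 (λ I → mv β (w I) (N ∸ a) (O I (suc a)) a (O I a)))
      (trans (∑-*ˡ 𝒮 β _) (cong (β *_) (trans (∑-+ 𝒮 _ _) (cong₂ _+_ (∑-*ˡ 𝒮 (N ∸ a) _) (∑-*ˡ 𝒮 a _)))))
    idle : ∑ 𝒮 (λ I → α * w I * O I a) ≡ α * 𝒢 m a
    idle = trans (∑-cong 𝒮 (λ I → *-assoc α (w I) (O I a))) (∑-*ˡ 𝒮 α _)

  -- `Δ` is the total weight of a slot and `γ` the weight of the choices missing a given box. So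
  -- `e j / Δ ^ j` is the mean factor of an initially empty box after `j` slots: `B` minus `E` times
  -- the probability `(γ / Δ) ^ j` of staying empty. The recursion avoids that subtraction.
  e : ℕ → ℕ
  e zero    = C
  e (suc j) = Δ * e j + β * (E * γ ^ j)

  e-total : ∀ j → e j + E * γ ^ j ≡ B * Δ ^ j
  e-total zero    = trans (cong (C +_) (*-identityʳ E)) (sym (*-identityʳ B))
  e-total (suc j) = trans (collect′ γ β (e j) E (γ ^ j)) (trans (cong (Δ *_) (e-total j)) (mv Δ B (Δ ^ j)))
    where
    collect′ : ∀ γ β e E g → (γ + β) * e + β * (E * g) + E * (γ * g) ≡ (γ + β) * (e + E * g)
    collect′ = solve-∀
    mv : ∀ d b p → d * (b * p) ≡ b * (d * p)
    mv = solve-∀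

  -- Negative dependence of the boxes: the mean of the product over the `r` empty boxes is at most
  -- the product of their single means. A slot hits at most one box, so one more slot changes the
  -- left-hand side by a term linear in the number of boxes, while the right-hand side changes as a
  -- power; Bernoulli's inequality compares the two.
  𝒢-bound : ∀ j a r → a + r ≡ N → 𝒢 j a * (Δ ^ j) ^ r ≤ Δ ^ j * (B ^ a * e j ^ r)
  𝒢-bound zero a r refl = ≤-reflexive (trans (cong₂ _*_ (trans (+-identityʳ (1 * (B ^ a * C ^ (a + r ∸ a)))) (*-identityˡ _)) (^-zeroˡ r))
    (trans (*-identityʳ (B ^ a * C ^ (a + r ∸ a))) (trans (cong (λ s → B ^ a * C ^ s) (m+n∸m≡n a r)) (sym (*-identityˡ _)))))
  𝒢-bound (suc j) a zero eq = begin
    𝒢 (suc j) a * 1              ≡⟨ cong (_* 1) (𝒢-suc j a) ⟩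
    (β * ((N ∸ a) * 𝒢 j (suc a) + a * 𝒢 j a) + α * 𝒢 j a) * 1
      ≡⟨ cong (λ r → (β * (r * 𝒢 j (suc a) + a * 𝒢 j a) + α * 𝒢 j a) * 1) (trans (cong (_∸ a) (trans (sym eq) (+-identityʳ a))) (n∸n≡0 a)) ⟩
    (β * (0 * 𝒢 j (suc a) + a * 𝒢 j a) + α * 𝒢 j a) * 1
      ≡⟨ collect α β a (𝒢 j (suc a)) (𝒢 j a) ⟩
    (α + β * a) * (𝒢 j a * 1)    ≡⟨ cong (_* (𝒢 j a * 1)) (trans (cong (λ s → α + β * s) (trans (sym (+-identityʳ a)) eq)) (sym β≤)) ⟩
    Δ * (𝒢 j a * 1)              ≤⟨ *-monoʳ-≤ Δ (𝒢-bound j a zero eq) ⟩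
    Δ * (Δ ^ j * (B ^ a * 1))    ≡⟨ sym (*-assoc Δ (Δ ^ j) _) ⟩
    Δ ^ suc j * (B ^ a * 1) ∎
    where
    open ≤-Reasoning
    collect : ∀ α β a x y → (β * (0 * x + a * y) + α * y) * 1 ≡ (α + β * a) * (y * 1)
    collect = solve-∀
  𝒢-bound (suc j) a (suc r) eq = begin
    𝒢 (suc j) a * (Δ * D) ^ suc r
      ≡⟨ cong₂ _*_ (trans (𝒢-suc j a) (cong (λ s → β * (s * g′ + a * g) + α * g) left)) (^-distribʳ-* Δ D (suc r)) ⟩
    (β * (suc r * g′ + a * g) + α * g) * (Δ ^ suc r * (D * D ^ r))
      ≡⟨ regroup (Δ ^ suc r) β (suc r) g′ a g α D (D ^ r) ⟩
    Δ ^ suc r * (β * suc r * D * (g′ * D ^ r) + (β * a + α) * (g * (D * D ^ r)))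
      ≤⟨ *-monoʳ-≤ (Δ ^ suc r) (+-mono-≤ (*-monoʳ-≤ (β * suc r * D) (𝒢-bound j (suc a) r (trans (sym (+-suc a r)) eq)))
                                          (*-monoʳ-≤ (β * a + α) (𝒢-bound j a (suc r) eq))) ⟩
    Δ ^ suc r * (β * suc r * D * (D * (B * B ^ a * ε ^ r)) + (β * a + α) * (D * (B ^ a * (ε * ε ^ r))))
      ≡⟨ regroup′ (Δ ^ suc r) β (suc r) D B (B ^ a) ε (ε ^ r) a α ⟩
    Δ ^ suc r * (D * (B ^ a * (ε ^ r * (β * suc r * (B * D) + (β * a + α) * ε))))
      ≡⟨ cong (λ z → Δ ^ suc r * (D * (B ^ a * (ε ^ r * z)))) bracket ⟩
    Δ * Δ ^ r * (D * (B ^ a * (ε ^ r * (Δ * ε + suc r * x))))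
      ≡⟨ regroup″ Δ (Δ ^ r) D (B ^ a) (ε ^ r) (Δ * ε + suc r * x) ⟩
    Δ * D * (B ^ a * (Δ ^ r * ε ^ r * (Δ * ε + suc r * x)))
      ≡⟨ cong (λ z → Δ * D * (B ^ a * (z * (Δ * ε + suc r * x)))) (sym (^-distribʳ-* Δ ε r)) ⟩
    Δ * D * (B ^ a * ((Δ * ε) ^ r * (Δ * ε + suc r * x)))
      ≤⟨ *-monoʳ-≤ (Δ * D) (*-monoʳ-≤ (B ^ a) (bernoulli-above (Δ * ε) x r)) ⟩
    Δ ^ suc j * (B ^ a * e (suc j) ^ suc r) ∎
    where
    open ≤-Reasoning
    D = Δ ^ j
    g = 𝒢 j a
    g′ = 𝒢 j (suc a)
    ε = e j
    x = β * (E * γ ^ j)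
    left : N ∸ a ≡ suc r
    left = trans (cong (_∸ a) (sym eq)) (m+n∸m≡n a (suc r))
    bracket : β * suc r * (B * D) + (β * a + α) * ε ≡ Δ * ε + suc r * x
    bracket = trans (cong (λ z → β * suc r * z + (β * a + α) * ε) (sym (e-total j)))
      (trans (collect α β (suc r) a ε (E * γ ^ j)) (cong (λ d → d * ε + suc r * x) (trans (cong (λ s → α + β * s) eq) (sym β≤))))
      where
      collect : ∀ α β r a ε w → β * r * (ε + w) + (β * a + α) * ε ≡ (α + β * (a + r)) * ε + r * (β * w)
      collect = solve-∀
    regroup : ∀ Z β r g′ a g α D p → (β * (r * g′ + a * g) + α * g) * (Z * (D * p)) ≡ Z * (β * r * D * (g′ * p) + (β * a + α) * (g * (D * p)))
    regroup = solve-∀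
    regroup′ : ∀ Z β r D B b ε q a α → Z * (β * r * D * (D * (B * b * q)) + (β * a + α) * (D * (b * (ε * q)))) ≡
               Z * (D * (b * (q * (β * r * (B * D) + (β * a + α) * ε))))
    regroup′ = solve-∀
    regroup″ : ∀ d p D b q z → d * p * (D * (b * (q * z))) ≡ d * D * (b * (p * q * z))
    regroup″ = solve-∀

module FirstMoment (n : ℕ) .{{_ : NonZero n}} (σ δ k t : ℕ) (k≤n : k ≤ n) (α β γ : ℕ)
                   (γ+β : γ + β ≡ α + β * (n ∸ k)) where

  τ N C E : ℕ
  τ = σ + δ
  N = n ∸ k
  C = τ * k + σ * N
  E = δ * N

  open Slots N C E α β γ γ+β public

  C+E : C + E ≡ n * τ
  C+E = trans (collect σ δ k N) (cong (_* τ) (m+[n∸m]≡n k≤n))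
    where
    collect : ∀ s d k N → (s + d) * k + s * N + d * N ≡ (k + N) * (s + d)
    collect = solve-∀

  badTotal : ℕ
  badTotal = ∑ (allMaps n n) (λ f → bad (G f) k t)

  first-moment : badTotal * (σ ^ t * τ ^ N) * (β ^ k * α ^ n) * (Δ ^ n) ^ N ≤ τ ^ t * (α ^ k * (Δ ^ n * e n ^ N))
  first-moment = begin
    badTotal * (σ ^ t * τ ^ N) * (β ^ k * α ^ n) * (Δ ^ n) ^ N
      ≤⟨ *-monoˡ-≤ ((Δ ^ n) ^ N) (*-monoˡ-≤ (β ^ k * α ^ n) weighted) ⟩
    τ ^ t * ∑ 𝒮 (λ S → ⟦ ∣ S ∣ ≡ᵇ k ⟧ * occ N B C k 0) * (β ^ k * α ^ n) * (Δ ^ n) ^ N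
      ≡⟨ cong (_* (Δ ^ n) ^ N) (*-assoc (τ ^ t) _ (β ^ k * α ^ n)) ⟩
    τ ^ t * (∑ 𝒮 (λ S → ⟦ ∣ S ∣ ≡ᵇ k ⟧ * occ N B C k 0) * (β ^ k * α ^ n)) * (Δ ^ n) ^ N
      ≤⟨ *-monoˡ-≤ ((Δ ^ n) ^ N) (*-monoʳ-≤ (τ ^ t) slotted) ⟩
    τ ^ t * (α ^ k * 𝒢 n 0) * (Δ ^ n) ^ N
      ≡⟨ mv (τ ^ t) (α ^ k) (𝒢 n 0) ((Δ ^ n) ^ N) ⟩
    τ ^ t * (α ^ k * (𝒢 n 0 * (Δ ^ n) ^ N))
      ≤⟨ *-monoʳ-≤ (τ ^ t) (*-monoʳ-≤ (α ^ k) (𝒢-bound n 0 N refl)) ⟩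
    τ ^ t * (α ^ k * (Δ ^ n * (1 * e n ^ N)))
      ≡⟨ cong (λ z → τ ^ t * (α ^ k * (Δ ^ n * z))) (*-identityˡ _) ⟩
    τ ^ t * (α ^ k * (Δ ^ n * e n ^ N)) ∎
    where
    open ≤-Reasoning
    𝒮 = allSubsets n
    𝓜 = allMaps n n
    W = σ ^ t * τ ^ N
    mv : ∀ a b c d → a * (b * c) * d ≡ a * (b * (c * d))
    mv = solve-∀
    expected : ∀ S → ∑ 𝓜 (λ f → ⟦ ∣ S ∣ ≡ᵇ k ⟧ * weight σ τ (G f) S) ≤ ⟦ ∣ S ∣ ≡ᵇ k ⟧ * occ N B C k 0
    expected S with ∣ S ∣ ≡ᵇ k in eq
    ... | false = ≤-reflexive (∑-zero 𝓜)
    ... | true  = ≤-trans (≤-reflexive (∑-*ˡ 𝓜 1 _)) (*-monoʳ-≤ 1 (≤-trans (Moment.∑-weight σ τ (m≤m+n σ δ) S)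
        (≤-reflexive (trans (cong (λ m → occ (n ∸ m) (n * τ) (τ * m + σ * (n ∸ m)) m 0) (≡ᵇ⇒≡′ {∣ S ∣} eq))
                            (cong (λ b → occ N b C k 0) (sym C+E))))))
    weighted : badTotal * W ≤ τ ^ t * ∑ 𝒮 (λ S → ⟦ ∣ S ∣ ≡ᵇ k ⟧ * occ N B C k 0)
    weighted = begin
      badTotal * W
        ≡⟨ sym (∑-*ʳ 𝓜 W _) ⟩
      ∑ 𝓜 (λ f → bad (G f) k t * W)
        ≡⟨ ∑-cong 𝓜 (λ f → sym (∑-*ʳ 𝒮 W _)) ⟩
      ∑ 𝓜 (λ f → ∑ 𝒮 (λ S → ⟦ indepOfSizeᵇ (G f) k S ⟧ * ⟦ free (G f) S ≤ᵇ t ⟧ * W))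
        ≤⟨ ∑-mono 𝓜 (λ f → ∑-mono 𝒮 (λ S → bad-weight σ τ (m≤m+n σ δ) (G f) k t S)) ⟩
      ∑ 𝓜 (λ f → ∑ 𝒮 (λ S → τ ^ t * (⟦ ∣ S ∣ ≡ᵇ k ⟧ * weight σ τ (G f) S)))
        ≡⟨ ∑-swap 𝓜 𝒮 _ ⟩
      ∑ 𝒮 (λ S → ∑ 𝓜 (λ f → τ ^ t * (⟦ ∣ S ∣ ≡ᵇ k ⟧ * weight σ τ (G f) S)))
        ≡⟨ ∑-cong 𝒮 (λ S → ∑-*ˡ 𝓜 (τ ^ t) _) ⟩
      ∑ 𝒮 (λ S → τ ^ t * ∑ 𝓜 (λ f → ⟦ ∣ S ∣ ≡ᵇ k ⟧ * weight σ τ (G f) S))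
        ≡⟨ ∑-*ˡ 𝒮 (τ ^ t) _ ⟩
      τ ^ t * ∑ 𝒮 (λ S → ∑ 𝓜 (λ f → ⟦ ∣ S ∣ ≡ᵇ k ⟧ * weight σ τ (G f) S))
        ≤⟨ *-monoʳ-≤ (τ ^ t) (∑-mono 𝒮 expected) ⟩
      τ ^ t * ∑ 𝒮 (λ S → ⟦ ∣ S ∣ ≡ᵇ k ⟧ * occ N B C k 0) ∎
    -- The second tilt: of all sets of busy slots in `𝒢 n 0` only those of size `k` are kept. The
    -- odds of a busy slot are at the disposal of each block.
    slotted : ∑ 𝒮 (λ S → ⟦ ∣ S ∣ ≡ᵇ k ⟧ * occ N B C k 0) * (β ^ k * α ^ n) ≤ α ^ k * 𝒢 n 0
    slotted = begin
      ∑ 𝒮 (λ S → ⟦ ∣ S ∣ ≡ᵇ k ⟧ * occ N B C k 0) * (β ^ k * α ^ n)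
        ≡⟨ sym (∑-*ʳ 𝒮 (β ^ k * α ^ n) _) ⟩
      ∑ 𝒮 (λ S → ⟦ ∣ S ∣ ≡ᵇ k ⟧ * occ N B C k 0 * (β ^ k * α ^ n))
        ≤⟨ ∑-mono 𝒮 pointwise ⟩
      ∑ 𝒮 (λ S → α ^ k * (slots α β S * occ N B C ∣ S ∣ 0))
        ≡⟨ ∑-*ˡ 𝒮 (α ^ k) _ ⟩
      α ^ k * 𝒢 n 0 ∎
      where
      swap : ∀ o z → 1 * o * z ≡ z * o
      swap = solve-∀
      pointwise : ∀ S → ⟦ ∣ S ∣ ≡ᵇ k ⟧ * occ N B C k 0 * (β ^ k * α ^ n) ≤ α ^ k * (slots α β S * occ N B C ∣ S ∣ 0)
      pointwise S with ∣ S ∣ ≡ᵇ k in eq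
      ... | false = z≤n
      ... | true  = ≤-reflexive (trans (swap (occ N B C k 0) (β ^ k * α ^ n)) (trans
          (cong (λ m → β ^ m * α ^ n * occ N B C m 0) (sym size))
          (trans (cong (_* occ N B C ∣ S ∣ 0) (sym (slots-power α β S)))
            (trans (*-assoc (α ^ ∣ S ∣) _ _) (cong (λ m → α ^ m * (slots α β S * occ N B C ∣ S ∣ 0)) size)))))
        where
        size : ∣ S ∣ ≡ k
        size = ≡ᵇ⇒≡′ {∣ S ∣} eq

-- Numerical form of the first moment bound

-- Write `n = suc m`. The fraction `1 / n` lost to bad sets is won back from the rounding: a set
-- that is not bad has at least `t + 1` free vertices, and `n * t ≤ (n - 1) * (t + 1)` because
-- `t ≤ n - 1`.
growth-step : ∀ m q ρ j k x x′ b .{{_ : NonZero q}} → ρ * q ≤ m → suc k ≤ j * q → suc m * b ≤ x →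
  suc (ρ * q) * x ≤ suc k * x′ + suc (ρ * q) * b → ρ * x ≤ j * x′
growth-step m q ρ j k x x′ b t≤m k<jq few ext = *-cancelˡ-≤ (suc m * q) {{m*n≢0 (suc m) q}} (begin
  suc m * q * (ρ * x)        ≡⟨ mv m q ρ x ⟩
  (t + m * t) * x            ≤⟨ *-monoˡ-≤ x (+-monoˡ-≤ (m * t) t≤m) ⟩
  (m + m * t) * x            ≤⟨ +-cancelʳ-≤ (suc t * x) _ _ cancelled ⟩
  suc m * (suc k * x′)       ≤⟨ *-monoʳ-≤ (suc m) (*-monoˡ-≤ x′ k<jq) ⟩
  suc m * (j * q * x′)       ≡⟨ mv′ (suc m) q j x′ ⟩
  suc m * q * (j * x′) ∎)
  where
  open ≤-Reasoning
  t = ρ * q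
  mv : ∀ m q ρ x → suc m * q * (ρ * x) ≡ (ρ * q + m * (ρ * q)) * x
  mv = solve-∀
  mv′ : ∀ m q j x → m * (j * q * x) ≡ m * q * (j * x)
  mv′ = solve-∀
  expand : ∀ m t x → (m + m * t) * x + suc t * x ≡ suc m * (suc t * x)
  expand = solve-∀
  distr : ∀ m a t b → m * (a + t * b) ≡ m * a + t * (m * b)
  distr = solve-∀
  cancelled : (m + m * t) * x + suc t * x ≤ suc m * (suc k * x′) + suc t * x
  cancelled = begin
    (m + m * t) * x + suc t * x           ≡⟨ expand m t x ⟩
    suc m * (suc t * x)                   ≤⟨ *-monoʳ-≤ (suc m) ext ⟩
    suc m * (suc k * x′ + suc t * b)      ≡⟨ distr (suc m) (suc k * x′) (suc t) b ⟩
    suc m * (suc k * x′) + suc t * (suc m * b) ≤⟨ +-monoʳ-≤ (suc m * (suc k * x′)) (*-monoʳ-≤ (suc t) few) ⟩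
    suc m * (suc k * x′) + suc t * x ∎

growth : ∀ {n} (M : AdjMat n) → IsSimpleGraph M → ∀ ρ j q k → .{{NonZero q}} → ρ * q < n → suc k ≤ j * q →
         n * bad M k (ρ * q) ≤ X k M → ρ * X k M ≤ j * X (suc k) M
growth {suc m} M simple ρ j q k (s≤s t≤m) k<jq few =
  growth-step m q ρ j k (X k M) (X (suc k) M) (bad M k (ρ * q)) t≤m k<jq few (extensions≤ M simple k (ρ * q))

-- Powers of `a / b ≤ 1` decrease with the exponent. The lemma trades the exponents `n`, `k` and
-- `n - k` for fixed multiples of `q`.
pow-exchange : ∀ {a b x y} → a ≤ b → x ≤ y → a ^ y * b ^ x ≤ a ^ x * b ^ y
pow-exchange {a} {b} {x} {y} a≤b x≤y = subst (λ y → a ^ y * b ^ x ≤ a ^ x * b ^ y) (m+[n∸m]≡n x≤y) (begin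
  a ^ (x + d) * b ^ x      ≡⟨ cong (_* b ^ x) (^-distribˡ-+-* a x d) ⟩
  a ^ x * a ^ d * b ^ x    ≤⟨ *-monoˡ-≤ (b ^ x) (*-monoʳ-≤ (a ^ x) (^-monoˡ-≤ d a≤b)) ⟩
  a ^ x * b ^ d * b ^ x    ≡⟨ mv (a ^ x) (b ^ d) (b ^ x) ⟩
  a ^ x * (b ^ x * b ^ d)  ≡⟨ cong (a ^ x *_) (sym (^-distribˡ-+-* b x d)) ⟩
  a ^ x * b ^ (x + d) ∎)
  where
  open ≤-Reasoning
  d = y ∸ x
  mv : ∀ a b c → a * b * c ≡ a * (c * b)
  mv = solve-∀

-- The tilting parameters of an interval lo * q ≤ k < hi * q: free vertices have weight σ / (σ + δ),
-- slots hold a ball with odds β / α, and e₁ / e₂ bounds the probability that a box stays empty from below.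
record Block : Set where
  constructor block
  field
    lo hi gain σ δ α β e₁ e₂ : ℕ

open Block

-- Everything is in units of `q`, where `D * q ≤ n ≤ suc D * q`. `L` and `H` bound `(n - k) / q` and
-- `Δ / q` from below, `U / V` bounds `Δ / (α * n)` from above, and `bn / bd` bounds the mean factor
-- of a box divided by `n * τ` from above. The `q`-th power of `Snum / Sden` bounds the mean number
-- of bad sets of a random map, up to `2 ^ D`.
module Rates (D : ℕ) (b : Block) where
  L τ H bd bn U V Snum Sden : ℕ
  L = D ∸ hi b
  τ = σ b + δ b
  H = α b * D + β b * L
  bd = τ * D * e₂ b
  bn = bd ∸ δ b * L * e₁ b
  U = α b * suc D + β b * (suc D ∸ lo b)
  V = α b * suc D
  Snum = τ ^ gain b * α b ^ hi b * (U ^ D * bn ^ L)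
  Sden = σ b ^ gain b * β b ^ hi b * (V ^ D * bd ^ L)

-- `hi≤gain` turns the guaranteed growth rate `gain / hi` into monotonicity. `empty` makes `e₁ / e₂`
-- a lower bound for the probability of an empty box. `gap` puts the rate of bad sets below the rate
-- `rn / rd` of independent sets by the factor `η / (η + 1)`.
record Valid (D η rn rd : ℕ) (b : Block) : Set where
  open Rates D b
  field
    hi≤D    : hi b ≤ D
    lo≤D   : lo b ≤ D
    gain<D    : gain b < D
    hi≤gain : hi b ≤ gain b
    σ>0       : 0 < σ b
    β>0       : 0 < β b
    β≤α       : β b ≤ α b
    e₂>0      : 0 < e₂ b
    tail≤bd   : δ b * L * e₁ b ≤ bd
    empty     : e₁ b * H ^ suc D ≤ e₂ b * (H ∸ β b) ^ suc D
    gap       : suc η * (Snum * rd) ≤ η * (Sden * rn)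

module BlockBound (D η rn rd : ℕ) (b : Block) (valid : Valid D η rn rd b) (n q k : ℕ)
                  (D>0 : 0 < D) (n≥ : D * q ≤ n) (n≤ : n ≤ D * q + D) (D≤q : D ≤ q)
                  (k≥ : lo b * q ≤ k) (k< : k < hi b * q) where
  open Valid valid
  open Rates D b

  instance
    D≢0 : NonZero D
    D≢0 = >-nonZero D>0
    q≢0 : NonZero q
    q≢0 = >-nonZero (≤-trans D>0 D≤q)
    n≢0 : NonZero n
    n≢0 = >-nonZero (≤-trans (>-nonZero⁻¹ (D * q) {{m*n≢0 D q}}) n≥)
    α≢0 : NonZero (α b)
    α≢0 = >-nonZero (≤-trans β>0 β≤α)
    τ≢0 : NonZero τ
    τ≢0 = >-nonZero (≤-trans σ>0 (m≤m+n (σ b) (δ b)))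
    e₂≢0 : NonZero (e₂ b)
    e₂≢0 = >-nonZero e₂>0
    bd≢0 : NonZero bd
    bd≢0 = m*n≢0 (τ * D) (e₂ b) {{m*n≢0 τ D}}
    V≢0 : NonZero V
    V≢0 = m*n≢0 (α b) (suc D)
    H≢0 : NonZero H
    H≢0 = >-nonZero (≤-trans (>-nonZero⁻¹ (α b * D) {{m*n≢0 (α b) D}}) (m≤m+n (α b * D) (β b * L)))

  k<n : k < n
  k<n = ≤-trans k< (≤-trans (*-monoˡ-≤ q hi≤D) n≥)

  N = n ∸ k

  k+N : k + N ≡ n
  k+N = m+[n∸m]≡n (<⇒≤ k<n)

  L+hi : L + hi b ≡ D
  L+hi = m∸n+n≡m hi≤D

  n≤′ : n ≤ suc D * q
  n≤′ = ≤-trans n≤ (≤-trans (+-monoʳ-≤ (D * q) D≤q) (≤-reflexive (+-comm (D * q) q)))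

  Lq≤N : L * q ≤ N
  Lq≤N = +-cancelˡ-≤ (hi b * q) (L * q) N (begin
    hi b * q + L * q   ≡⟨ trans (sym (*-distribʳ-+ q (hi b) L)) (cong (_* q) (trans (+-comm (hi b) L) L+hi)) ⟩
    D * q                ≤⟨ n≥ ⟩
    n                    ≡⟨ sym k+N ⟩
    k + N                ≤⟨ +-monoˡ-≤ N (<⇒≤ k<) ⟩
    hi b * q + N ∎)
    where open ≤-Reasoning

  Ln≤DN : L * n ≤ D * N
  Ln≤DN = +-cancelˡ-≤ (hi b * n) (L * n) (D * N) (begin
    hi b * n + L * n   ≡⟨ trans (sym (*-distribʳ-+ n (hi b) L)) (cong (_* n) (trans (+-comm (hi b) L) L+hi)) ⟩
    D * n                ≡⟨ trans (cong (D *_) (sym k+N)) (*-distribˡ-+ D k N) ⟩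
    D * k + D * N        ≤⟨ +-monoˡ-≤ (D * N) (begin
      D * k                ≤⟨ *-monoʳ-≤ D (<⇒≤ k<) ⟩
      D * (hi b * q)     ≡⟨ mv D (hi b) q ⟩
      hi b * (D * q)     ≤⟨ *-monoʳ-≤ (hi b) n≥ ⟩
      hi b * n ∎) ⟩
    hi b * n + D * N ∎)
    where
    open ≤-Reasoning
    mv : ∀ a b c → a * (b * c) ≡ b * (a * c)
    mv = solve-∀

  N-upper : suc D * N ≤ n * (suc D ∸ lo b)
  N-upper = +-cancelˡ-≤ (n * lo b) (suc D * N) (n * (suc D ∸ lo b)) (begin
    n * lo b + suc D * N             ≤⟨ +-monoˡ-≤ (suc D * N) (begin
      n * lo b                         ≤⟨ *-monoˡ-≤ (lo b) n≤′ ⟩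
      suc D * q * lo b                 ≡⟨ trans (*-assoc (suc D) q (lo b)) (cong (suc D *_) (*-comm q (lo b))) ⟩
      suc D * (lo b * q)               ≤⟨ *-monoʳ-≤ (suc D) k≥ ⟩
      suc D * k ∎) ⟩
    suc D * k + suc D * N               ≡⟨ trans (sym (*-distribˡ-+ (suc D) k N)) (trans (cong (suc D *_) k+N) (*-comm (suc D) n)) ⟩
    n * suc D                           ≡⟨ cong (n *_) (sym (m+[n∸m]≡n (≤-trans lo≤D (n≤1+n D)))) ⟩
    n * (lo b + (suc D ∸ lo b))   ≡⟨ *-distribˡ-+ n (lo b) _ ⟩
    n * lo b + n * (suc D ∸ lo b) ∎)
    where open ≤-Reasoning

  β≤Δ : β b ≤ α b * n + β b * N
  β≤Δ = ≤-trans β≤α (≤-trans (m≤m*n (α b) n) (m≤m+n (α b * n) (β b * N)))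

  γ : ℕ
  γ = (α b * n + β b * N) ∸ β b

  -- The idle weight is `α b * n`, so that the odds `β b * N / (α b * n)` of a busy slot depend only
  -- on the proportion `k / n`.
  open FirstMoment n (σ b) (δ b) k (gain b * q) (<⇒≤ k<n) (α b * n) (β b) γ (m∸n+n≡m β≤Δ) public
    using (Δ; e; e-total; C+E; badTotal; first-moment)

  Δ≡ : Δ ≡ α b * n + β b * N
  Δ≡ = m∸n+n≡m β≤Δ

  instance
    Δ≢0 : NonZero Δ
    Δ≢0 = >-nonZero (≤-trans β>0 (m≤n+m (β b) γ))

  Hq≤Δ : H * q ≤ Δ
  Hq≤Δ = begin
    (α b * D + β b * L) * q        ≡⟨ mv (α b) D (β b) L q ⟩
    α b * (D * q) + β b * (L * q)  ≤⟨ +-mono-≤ (*-monoʳ-≤ (α b) n≥) (*-monoʳ-≤ (β b) Lq≤N) ⟩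
    α b * n + β b * N              ≡⟨ sym Δ≡ ⟩
    Δ ∎
    where
    open ≤-Reasoning
    mv : ∀ a d b l q → (a * d + b * l) * q ≡ a * (d * q) + b * (l * q)
    mv = solve-∀

  H′ : ℕ
  H′ = H ∸ β b

  H′+β : H′ + β b ≡ H
  H′+β = m∸n+n≡m (≤-trans β≤α (≤-trans (m≤m*n (α b) D) (m≤m+n (α b * D) (β b * L))))

  -- By Bernoulli a box escapes `q` slots with probability at least `1 - q * β / Δ`, and
  -- `q / Δ ≤ 1 / H`. Since `n ≤ suc D * q`, the power `suc D` of this estimate then covers all `n`
  -- slots.
  empty-q : H′ * Δ ^ q ≤ H * γ ^ q
  empty-q = *-cancelˡ-≤ Δ (+-cancelʳ-≤ (Δ * β b * Δ ^ q) (Δ * (H′ * Δ ^ q)) (Δ * (H * γ ^ q)) (begin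
    Δ * (H′ * Δ ^ q) + Δ * β b * Δ ^ q               ≡⟨ collect Δ H′ (β b) (Δ ^ q) ⟩
    (H′ + β b) * (Δ * Δ ^ q)                         ≡⟨ cong (_* Δ ^ suc q) H′+β ⟩
    H * Δ ^ suc q                                    ≤⟨ *-monoʳ-≤ H (bernoulli-below γ (β b) q) ⟩
    H * (γ ^ q * Δ + q * β b * Δ ^ q)                ≡⟨ distr H (γ ^ q) Δ q (β b) (Δ ^ q) ⟩
    Δ * (H * γ ^ q) + H * q * (β b * Δ ^ q)          ≤⟨ +-monoʳ-≤ (Δ * (H * γ ^ q)) (*-monoˡ-≤ (β b * Δ ^ q) Hq≤Δ) ⟩
    Δ * (H * γ ^ q) + Δ * (β b * Δ ^ q)              ≡⟨ cong (Δ * (H * γ ^ q) +_) (sym (*-assoc Δ (β b) _)) ⟩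
    Δ * (H * γ ^ q) + Δ * β b * Δ ^ q ∎))
    where
    open ≤-Reasoning
    collect : ∀ d h b p → d * (h * p) + d * b * p ≡ (h + b) * (d * p)
    collect = solve-∀
    distr : ∀ h g d q b p → h * (g * d + q * b * p) ≡ d * (h * g) + h * q * (b * p)
    distr = solve-∀

  empty-n : e₁ b * Δ ^ n ≤ e₂ b * γ ^ n
  empty-n = *-cancelʳ-≤ (e₁ b * Δ ^ n) (e₂ b * γ ^ n) (H ^ suc D * Δ ^ Q)
      {{m*n≢0 (H ^ suc D) (Δ ^ Q) {{m^n≢0 H (suc D)}} {{m^n≢0 Δ Q}}}} (begin
    e₁ b * Δ ^ n * (H ^ suc D * Δ ^ Q)            ≡⟨ mv (e₁ b) (Δ ^ n) (H ^ suc D) (Δ ^ Q) ⟩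
    e₁ b * H ^ suc D * (Δ ^ Q * Δ ^ n)            ≤⟨ *-monoˡ-≤ (Δ ^ Q * Δ ^ n) empty ⟩
    e₂ b * H′ ^ suc D * (Δ ^ Q * Δ ^ n)           ≡⟨ mv′ (e₂ b) (H′ ^ suc D) (Δ ^ Q) (Δ ^ n) ⟩
    e₂ b * (H′ ^ suc D * Δ ^ Q) * Δ ^ n           ≤⟨ *-monoˡ-≤ (Δ ^ n) (*-monoʳ-≤ (e₂ b) powers) ⟩
    e₂ b * (H ^ suc D * γ ^ Q) * Δ ^ n            ≡⟨ mv″ (e₂ b) (H ^ suc D) (γ ^ Q) (Δ ^ n) ⟩
    e₂ b * H ^ suc D * (γ ^ Q * Δ ^ n)            ≤⟨ *-monoʳ-≤ (e₂ b * H ^ suc D) (pow-exchange (m≤m+n γ (β b)) (≤-trans n≤′ (≤-reflexive (*-comm (suc D) q)))) ⟩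
    e₂ b * H ^ suc D * (γ ^ n * Δ ^ Q)            ≡⟨ mv‴ (e₂ b) (H ^ suc D) (γ ^ n) (Δ ^ Q) ⟩
    e₂ b * γ ^ n * (H ^ suc D * Δ ^ Q) ∎)
    where
    open ≤-Reasoning
    Q = q * suc D
    mv : ∀ a b c d → a * b * (c * d) ≡ a * c * (d * b)
    mv = solve-∀
    mv′ : ∀ a b c d → a * b * (c * d) ≡ a * (b * c) * d
    mv′ = solve-∀
    mv″ : ∀ a b c d → a * (b * c) * d ≡ a * b * (c * d)
    mv″ = solve-∀
    mv‴ : ∀ a b c d → a * b * (c * d) ≡ a * c * (b * d)
    mv‴ = solve-∀
    powers : H′ ^ suc D * Δ ^ Q ≤ H ^ suc D * γ ^ Q
    powers = begin
      H′ ^ suc D * Δ ^ (q * suc D)      ≡⟨ cong (H′ ^ suc D *_) (sym (^-*-assoc Δ q (suc D))) ⟩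
      H′ ^ suc D * (Δ ^ q) ^ suc D      ≡⟨ sym (^-distribʳ-* H′ (Δ ^ q) (suc D)) ⟩
      (H′ * Δ ^ q) ^ suc D              ≤⟨ ^-monoˡ-≤ (suc D) empty-q ⟩
      (H * γ ^ q) ^ suc D               ≡⟨ ^-distribʳ-* H (γ ^ q) (suc D) ⟩
      H ^ suc D * (γ ^ q) ^ suc D       ≡⟨ cong (H ^ suc D *_) (^-*-assoc γ q (suc D)) ⟩
      H ^ suc D * γ ^ (q * suc D) ∎

  bn+tail : bn + δ b * L * e₁ b ≡ bd
  bn+tail = m∸n+n≡m tail≤bd

  e-upper : D * e₂ b * e n ≤ bn * n * Δ ^ n
  e-upper = +-cancelʳ-≤ (D * (δ b * N) * (e₁ b * Δ ^ n)) (D * e₂ b * e n) (bn * n * Δ ^ n) (begin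
    D * e₂ b * e n + D * (δ b * N) * (e₁ b * Δ ^ n)    ≤⟨ +-monoʳ-≤ (D * e₂ b * e n) (*-monoʳ-≤ (D * (δ b * N)) empty-n) ⟩
    D * e₂ b * e n + D * (δ b * N) * (e₂ b * γ ^ n)    ≡⟨ collect D (e₂ b) (e n) (δ b * N) (γ ^ n) ⟩
    D * e₂ b * (e n + δ b * N * γ ^ n)                 ≡⟨ cong (D * e₂ b *_) (trans (e-total n) (cong (_* Δ ^ n) C+E)) ⟩
    D * e₂ b * (n * τ * Δ ^ n)                         ≡⟨ collect′ D (e₂ b) n τ (Δ ^ n) ⟩
    bd * (n * Δ ^ n)                                   ≡⟨ cong (_* (n * Δ ^ n)) (sym bn+tail) ⟩
    (bn + δ b * L * e₁ b) * (n * Δ ^ n)                ≡⟨ collect″ bn (δ b) L (e₁ b) n (Δ ^ n) ⟩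
    bn * n * Δ ^ n + δ b * (L * n) * (e₁ b * Δ ^ n)    ≤⟨ +-monoʳ-≤ (bn * n * Δ ^ n) (*-monoˡ-≤ (e₁ b * Δ ^ n) (*-monoʳ-≤ (δ b) Ln≤DN)) ⟩
    bn * n * Δ ^ n + δ b * (D * N) * (e₁ b * Δ ^ n)    ≡⟨ cong (λ z → bn * n * Δ ^ n + z * (e₁ b * Δ ^ n)) (mv (δ b) D N) ⟩
    bn * n * Δ ^ n + D * (δ b * N) * (e₁ b * Δ ^ n) ∎)
    where
    open ≤-Reasoning
    mv : ∀ a b c → a * (b * c) ≡ b * (a * c)
    mv = solve-∀
    collect : ∀ D e₂ e s g → D * e₂ * e + D * s * (e₂ * g) ≡ D * e₂ * (e + s * g)
    collect = solve-∀
    collect′ : ∀ D e n t p → D * e * (n * t * p) ≡ t * D * e * (n * p)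
    collect′ = solve-∀
    collect″ : ∀ b d l e n p → (b + d * l * e) * (n * p) ≡ b * n * p + d * (l * n) * (e * p)
    collect″ = solve-∀

  Δ-upper : suc D * Δ ≤ n * U
  Δ-upper = begin
    suc D * Δ                                    ≡⟨ cong (suc D *_) Δ≡ ⟩
    suc D * (α b * n + β b * N)                  ≡⟨ mv (suc D) (α b) n (β b) N ⟩
    n * (α b * suc D) + β b * (suc D * N)        ≤⟨ +-monoʳ-≤ (n * (α b * suc D)) (*-monoʳ-≤ (β b) N-upper) ⟩
    n * (α b * suc D) + β b * (n * (suc D ∸ lo b)) ≡⟨ mv′ n (α b * suc D) (β b) (suc D ∸ lo b) ⟩
    n * U ∎
    where
    open ≤-Reasoning
    mv : ∀ d a n b N → d * (a * n + b * N) ≡ n * (a * d) + b * (d * N)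
    mv = solve-∀
    mv′ : ∀ n x b y → n * x + b * (n * y) ≡ n * (x + b * y)
    mv′ = solve-∀

  t : ℕ
  t = gain b * q

  -- The number `n ^ n` of maps appears as `n ^ k * n ^ N`: the first factor comes from the idle
  -- weight, the second from the mean factors of the `N` boxes.
  scaled : badTotal * (σ b ^ t * bd ^ N * (β b ^ k * V ^ n)) ≤ n ^ n * (τ ^ t * α b ^ k * (U ^ n * bn ^ N))
  scaled = *-cancelʳ-≤ _ _ (n ^ n * (Δ ^ n) ^ N) {{m*n≢0 (n ^ n) _ {{m^n≢0 n n}} {{m^n≢0 (Δ ^ n) N {{m^n≢0 Δ n}}}}}} (begin
    badTotal * (σ b ^ t * bd ^ N * (β b ^ k * V ^ n)) * (n ^ n * P)
      ≡⟨ cong₂ (λ x y → badTotal * (σ b ^ t * x * (β b ^ k * y)) * (n ^ n * P))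
               (trans (cong (_^ N) (*-assoc τ D (e₂ b))) (^-distribʳ-* τ (D * e₂ b) N)) (^-distribʳ-* (α b) (suc D) n) ⟩
    badTotal * (σ b ^ t * (τ ^ N * (D * e₂ b) ^ N) * (β b ^ k * (α b ^ n * suc D ^ n))) * (n ^ n * P)
      ≡⟨ mv badTotal (σ b ^ t) (τ ^ N) ((D * e₂ b) ^ N) (β b ^ k) (α b ^ n) (suc D ^ n) (n ^ n) P ⟩
    badTotal * (σ b ^ t * τ ^ N) * (β b ^ k * (α b ^ n * n ^ n)) * P * ((D * e₂ b) ^ N * suc D ^ n)
      ≡⟨ cong (λ z → badTotal * (σ b ^ t * τ ^ N) * (β b ^ k * z) * P * ((D * e₂ b) ^ N * suc D ^ n)) (sym (^-distribʳ-* (α b) n n)) ⟩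
    badTotal * (σ b ^ t * τ ^ N) * (β b ^ k * (α b * n) ^ n) * P * ((D * e₂ b) ^ N * suc D ^ n)
      ≤⟨ *-monoˡ-≤ ((D * e₂ b) ^ N * suc D ^ n) first-moment ⟩
    τ ^ t * ((α b * n) ^ k * (Δ ^ n * e n ^ N)) * ((D * e₂ b) ^ N * suc D ^ n)
      ≡⟨ mv′ (τ ^ t) ((α b * n) ^ k) (Δ ^ n) (e n ^ N) ((D * e₂ b) ^ N) (suc D ^ n) ⟩
    τ ^ t * (α b * n) ^ k * ((suc D ^ n * Δ ^ n) * ((D * e₂ b) ^ N * e n ^ N))
      ≡⟨ cong₂ (λ x y → τ ^ t * (α b * n) ^ k * (x * y)) (sym (^-distribʳ-* (suc D) Δ n)) (sym (^-distribʳ-* (D * e₂ b) (e n) N)) ⟩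
    τ ^ t * (α b * n) ^ k * ((suc D * Δ) ^ n * (D * e₂ b * e n) ^ N)
      ≤⟨ *-monoʳ-≤ (τ ^ t * (α b * n) ^ k) (*-mono-≤ (^-monoˡ-≤ n Δ-upper) (^-monoˡ-≤ N e-upper)) ⟩
    τ ^ t * (α b * n) ^ k * ((n * U) ^ n * (bn * n * Δ ^ n) ^ N)
      ≡⟨ cong (τ ^ t * (α b * n) ^ k *_) (cong₂ _*_ (^-distribʳ-* n U n) (trans (^-distribʳ-* (bn * n) (Δ ^ n) N) (cong (_* P) (^-distribʳ-* bn n N)))) ⟩
    τ ^ t * (α b * n) ^ k * ((n ^ n * U ^ n) * (bn ^ N * n ^ N * P))
      ≡⟨ cong (λ z → τ ^ t * z * ((n ^ n * U ^ n) * (bn ^ N * n ^ N * P))) (^-distribʳ-* (α b) n k) ⟩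
    τ ^ t * (α b ^ k * n ^ k) * ((n ^ n * U ^ n) * (bn ^ N * n ^ N * P))
      ≡⟨ mv″ (τ ^ t) (α b ^ k) (n ^ k) (n ^ n) (U ^ n) (bn ^ N) (n ^ N) P ⟩
    n ^ k * n ^ N * (τ ^ t * α b ^ k * (U ^ n * bn ^ N)) * (n ^ n * P)
      ≡⟨ cong (λ z → z * (τ ^ t * α b ^ k * (U ^ n * bn ^ N)) * (n ^ n * P)) (trans (sym (^-distribˡ-+-* n k N)) (cong (n ^_) k+N)) ⟩
    n ^ n * (τ ^ t * α b ^ k * (U ^ n * bn ^ N)) * (n ^ n * P) ∎)
    where
    open ≤-Reasoning
    P = (Δ ^ n) ^ N
    mv : ∀ T s t d b a D n P → T * (s * (t * d) * (b * (a * D))) * (n * P) ≡ T * (s * t) * (b * (a * n)) * P * (d * D)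
    mv = solve-∀
    mv′ : ∀ a b c d e f → a * (b * (c * d)) * (e * f) ≡ a * b * ((f * c) * (e * d))
    mv′ = solve-∀
    mv″ : ∀ t a nk nn u b nN P → t * (a * nk) * ((nn * u) * (b * nN * P)) ≡ nk * nN * (t * a * (u * b)) * (nn * P)
    mv″ = solve-∀

  U≤2V : U ≤ 2 * V
  U≤2V = begin
    V + β b * (suc D ∸ lo b)   ≤⟨ +-monoʳ-≤ V (*-mono-≤ β≤α (m∸n≤m (suc D) (lo b))) ⟩
    V + V                         ≡⟨ cong (V +_) (sym (+-identityʳ V)) ⟩
    2 * V ∎
    where open ≤-Reasoning

  -- The exponents are pushed to the worst end of the block. As `β ≤ α` and `bn ≤ bd`, `k` may rise
  -- to `hi * q` and `N` may drop to `L * q`. As `V ≤ U`, `n` may rise to `D * q + D`, and the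
  -- surplus `D` costs at most `(U / V) ^ D ≤ 2 ^ D`.
  total-bound : badTotal * Sden ^ q ≤ 2 ^ D * n ^ n * Snum ^ q
  total-bound = *-cancelʳ-≤ _ _ c {{c≢0}} (begin
    badTotal * Sden ^ q * c
      ≡⟨ cong (λ z → badTotal * z * c) (rates (σ b) (gain b) (β b) (hi b) V D bd L) ⟩
    badTotal * (σt * βj * (V ^ (D * q) * bd ^ (L * q))) * c
      ≡⟨ mv badTotal σt βj (V ^ (D * q)) (bd ^ (L * q)) (α b ^ k) (V ^ n) (V ^ D) (bd ^ N) ⟩
    badTotal * σt * (βj * α b ^ k) * (V ^ (D * q) * V ^ D * V ^ n * (bd ^ (L * q) * bd ^ N))
      ≤⟨ *-monoˡ-≤ _ (*-monoʳ-≤ (badTotal * σt) (pow-exchange β≤α (<⇒≤ k<))) ⟩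
    badTotal * σt * (β b ^ k * αj) * (V ^ (D * q) * V ^ D * V ^ n * (bd ^ (L * q) * bd ^ N))
      ≡⟨ mv′ badTotal σt (β b ^ k) αj (V ^ (D * q)) (V ^ D) (V ^ n) (bd ^ (L * q)) (bd ^ N) ⟩
    badTotal * (σt * bd ^ N * (β b ^ k * V ^ n)) * (αj * (V ^ (D * q) * V ^ D * bd ^ (L * q)))
      ≤⟨ *-monoˡ-≤ _ scaled ⟩
    n ^ n * (τt * α b ^ k * (U ^ n * bn ^ N)) * (αj * (V ^ (D * q) * V ^ D * bd ^ (L * q)))
      ≡⟨ cong (λ z → n ^ n * (τt * α b ^ k * (U ^ n * bn ^ N)) * (αj * (z * bd ^ (L * q)))) (sym (^-distribˡ-+-* V (D * q) D)) ⟩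
    n ^ n * (τt * α b ^ k * (U ^ n * bn ^ N)) * (αj * (V ^ (D * q + D) * bd ^ (L * q)))
      ≡⟨ mv″ (n ^ n) τt (α b ^ k) (U ^ n) (bn ^ N) αj (V ^ (D * q + D)) (bd ^ (L * q)) ⟩
    n ^ n * τt * α b ^ k * αj * ((V ^ (D * q + D) * U ^ n) * (bn ^ N * bd ^ (L * q)))
      ≤⟨ *-monoʳ-≤ (n ^ n * τt * α b ^ k * αj) (*-mono-≤ slack (pow-exchange (m∸n≤m bd (δ b * L * e₁ b)) Lq≤N)) ⟩
    n ^ n * τt * α b ^ k * αj * ((V ^ n * (U ^ (D * q) * (2 ^ D * V ^ D))) * (bn ^ (L * q) * bd ^ N))
      ≡⟨ mv‴ (n ^ n) τt (α b ^ k) αj (V ^ n) (U ^ (D * q)) (2 ^ D) (V ^ D) (bn ^ (L * q)) (bd ^ N) ⟩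
    2 ^ D * n ^ n * (τt * αj * (U ^ (D * q) * bn ^ (L * q))) * c
      ≡⟨ cong (λ z → 2 ^ D * n ^ n * z * c) (sym (rates τ (gain b) (α b) (hi b) U D bn L)) ⟩
    2 ^ D * n ^ n * Snum ^ q * c ∎)
    where
    open ≤-Reasoning
    σt = σ b ^ t
    τt = τ ^ t
    βj = β b ^ (hi b * q)
    αj = α b ^ (hi b * q)
    c = α b ^ k * V ^ n * V ^ D * bd ^ N
    c≢0 : NonZero c
    c≢0 = m*n≢0 (α b ^ k * V ^ n * V ^ D) (bd ^ N)
      {{m*n≢0 (α b ^ k * V ^ n) (V ^ D) {{m*n≢0 (α b ^ k) (V ^ n) {{m^n≢0 (α b) k}} {{m^n≢0 V n}}}} {{m^n≢0 V D}}}} {{m^n≢0 bd N}}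
    rates : ∀ s g x j v d w l → (s ^ g * x ^ j * (v ^ d * w ^ l)) ^ q ≡ s ^ (g * q) * x ^ (j * q) * (v ^ (d * q) * w ^ (l * q))
    rates s g x j v d w l = trans (^-distribʳ-* (s ^ g * x ^ j) (v ^ d * w ^ l) q) (cong₂ _*_
      (trans (^-distribʳ-* (s ^ g) (x ^ j) q) (cong₂ _*_ (^-*-assoc s g q) (^-*-assoc x j q)))
      (trans (^-distribʳ-* (v ^ d) (w ^ l) q) (cong₂ _*_ (^-*-assoc v d q) (^-*-assoc w l q))))
    slack : V ^ (D * q + D) * U ^ n ≤ V ^ n * (U ^ (D * q) * (2 ^ D * V ^ D))
    slack = begin
      V ^ (D * q + D) * U ^ n             ≤⟨ pow-exchange (m≤m+n V _) n≤ ⟩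
      V ^ n * U ^ (D * q + D)             ≡⟨ cong (V ^ n *_) (^-distribˡ-+-* U (D * q) D) ⟩
      V ^ n * (U ^ (D * q) * U ^ D)       ≤⟨ *-monoʳ-≤ (V ^ n) (*-monoʳ-≤ (U ^ (D * q)) (≤-trans (^-monoˡ-≤ D U≤2V) (≤-reflexive (^-distribʳ-* 2 V D)))) ⟩
      V ^ n * (U ^ (D * q) * (2 ^ D * V ^ D)) ∎
    mv : ∀ T s b v w a vn vd wn → T * (s * b * (v * w)) * (a * vn * vd * wn) ≡ T * s * (b * a) * (v * vd * vn * (w * wn))
    mv = solve-∀
    mv′ : ∀ T s b a v vd vn w wn → T * s * (b * a) * (v * vd * vn * (w * wn)) ≡ T * (s * wn * (b * vn)) * (a * (v * vd * w))
    mv′ = solve-∀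
    mv″ : ∀ n t ak u bn aj v w → n * (t * ak * (u * bn)) * (aj * (v * w)) ≡ n * t * ak * aj * ((v * u) * (bn * w))
    mv″ = solve-∀
    mv‴ : ∀ n t ak aj vn u two vd bl bN → n * t * ak * aj * ((vn * (u * (two * vd))) * (bl * bN)) ≡
          two * n * (t * aj * (u * bl)) * (ak * vn * vd * bN)
    mv‴ = solve-∀

-- Bootstrapping along blocks

≤ᵇ-sound : ∀ {m n} → (m ≤ᵇ n) ≡ true → m ≤ n
≤ᵇ-sound {m} {n} e = ≤ᵇ⇒≤ m n (subst T (sym e) _)

-- The conditions form a list of comparisons of numerals, so that one Boolean evaluation certifies a
-- whole chain of blocks.
constraints : ℕ → ℕ → Block × ℕ × ℕ → List (ℕ × ℕ)
constraints D η (b , rn , rd) =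
  (hi b , D) ∷ (lo b , D) ∷ (suc (gain b) , D) ∷ (hi b , gain b) ∷ (1 , σ b) ∷ (1 , β b) ∷ (β b , α b) ∷ (1 , e₂ b) ∷
  (1 , rn) ∷ (1 , rd) ∷ (δ b * L * e₁ b , bd) ∷ (e₁ b * H ^ suc D , e₂ b * (H ∸ β b) ^ suc D) ∷
  (suc η * (Snum * rd) , η * (Sden * rn)) ∷ []
  where open Rates D b

satisfiedᵇ : ℕ × ℕ → Bool
satisfiedᵇ (x , y) = x ≤ᵇ y

validᵇ : ℕ → ℕ → Block × ℕ × ℕ → Bool
validᵇ D η s = allᵇ satisfiedᵇ (constraints D η s)

valid : ∀ D η b rn rd → validᵇ D η (b , rn , rd) ≡ true → Valid D η rn rd b × 0 < rn × 0 < rd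
valid D η b rn rd e = record
  { hi≤D = g (here refl) ; lo≤D = g (there (here refl)) ; gain<D = g (there (there (here refl)))
  ; hi≤gain = g (there (there (there (here refl)))) ; σ>0 = g (there (there (there (there (here refl)))))
  ; β>0 = g (there (there (there (there (there (here refl))))))
  ; β≤α = g (there (there (there (there (there (there (here refl)))))))
  ; e₂>0 = g (there (there (there (there (there (there (there (here refl))))))))
  ; tail≤bd = g (there (there (there (there (there (there (there (there (there (there (here refl)))))))))))
  ; empty = g (there (there (there (there (there (there (there (there (there (there (there (here refl))))))))))))
  ; gap = g (there (there (there (there (there (there (there (there (there (there (there (there (here refl)))))))))))))
  } , g (there (there (there (there (there (there (there (there (here refl))))))))) , g (there (there (there (there (there (there (there (there (there (here refl))))))))))
  where
  g : ∀ {x y} → (x , y) ∈ constraints D η (b , rn , rd) → x ≤ y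
  g i = ≤ᵇ-sound (allᵇ-∈ satisfiedᵇ e i)

-- Along a chain of blocks, (rn / rd) ^ q is a lower bound for X at the start of each block, up to a polynomial factor.
stages : ℕ → ℕ → List Block → List (Block × ℕ × ℕ)
stages rn rd []       = []
stages rn rd (b ∷ bs) = (b , rn , rd) ∷ stages (rn * gain b ^ (hi b ∸ lo b)) (rd * hi b ^ (hi b ∸ lo b)) bs

linkedᵇ : ℕ → List Block → ℕ → Bool
linkedᵇ i []       j = i ≡ᵇ j
linkedᵇ i (b ∷ bs) j = (lo b ≡ᵇ i) ∧ (i ≤ᵇ hi b) ∧ linkedᵇ (hi b) bs j

Within : ℕ → Block → ℕ → Set
Within q b k = lo b * q ≤ k × k < hi b * q

module Chain {n} (M : AdjMat n) (simple : IsSimpleGraph M) (D η q P : ℕ) (n≥ : D * q ≤ n) .{{_ : NonZero q}} .{{P≢0 : NonZero P}} where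

  -- The bad sets are at most a fraction `1 / n` of `(rn / rd) ^ q / P`, the lower bound for `X` at
  -- the start of the block.
  Quiet : Block × ℕ × ℕ → Set
  Quiet (b , rn , rd) = ∀ k → Within q b k → P * n * rd ^ q * bad M k (gain b * q) ≤ rn ^ q

  Sound : Block × ℕ × ℕ → Set
  Sound (b , rn , rd) = Valid D η rn rd b × 0 < rn × 0 < rd

  x : ℕ → ℕ
  x k = X k M

  module InBlock (b : Block) (rn rd : ℕ) (sound : Sound (b , rn , rd)) (quiet : Quiet (b , rn , rd))
                 (base : rn ^ q ≤ P * rd ^ q * x (lo b * q)) where
    open Valid (proj₁ sound)

    i = lo b * q

    instance
      rd≢0 : NonZero rd
      rd≢0 = >-nonZero (proj₂ (proj₂ sound))

    few : ∀ k → Within q b k → x i ≤ x k → n * bad M k (gain b * q) ≤ x k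
    few k w i≤k = *-cancelˡ-≤ (P * rd ^ q) {{m*n≢0 P (rd ^ q) {{P≢0}} {{m^n≢0 rd q}}}} (begin
      P * rd ^ q * (n * bad M k (gain b * q))  ≡⟨ mv P (rd ^ q) n (bad M k (gain b * q)) ⟩
      P * n * rd ^ q * bad M k (gain b * q)    ≤⟨ quiet k w ⟩
      rn ^ q                                   ≤⟨ base ⟩
      P * rd ^ q * x i                         ≤⟨ *-monoʳ-≤ (P * rd ^ q) i≤k ⟩
      P * rd ^ q * x k ∎)
      where
      open ≤-Reasoning
      mv : ∀ p r n b → p * r * (n * b) ≡ p * n * r * b
      mv = solve-∀

    grows : ∀ k → Within q b k → x i ≤ x k → gain b * x k ≤ hi b * x (suc k)
    grows k w i≤k = growth M simple (gain b) (hi b) q k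
      (≤-trans (*-monoˡ-< q gain<D) n≥) (proj₂ w) (few k w i≤k)

    increases : ∀ k → Within q b k → x i ≤ x k → x k ≤ x (suc k)
    increases k w@(_ , k<) i≤k with hi b | k< | hi≤gain | grows k w i≤k
    ... | suc j | _ | j≤g | g = *-cancelˡ-≤ (suc j) (≤-trans (*-monoˡ-≤ (x k) j≤g) g)

    -- The two halves need each other: bad sets are controlled relative to `X` at the left end `i`,
    -- so the step at `i + d` is available only if `X` has not fallen below its value there.
    ahead : ∀ d → i + d ≤ hi b * q → x i ≤ x (i + d) × gain b ^ d * x i ≤ hi b ^ d * x (i + d)
    ahead zero    _ = ≤-reflexive (cong x (sym (+-identityʳ i))) , ≤-reflexive (cong (λ k → 1 * x k) (sym (+-identityʳ i)))
    ahead (suc d) le with ahead d (≤-trans (+-monoʳ-≤ i (n≤1+n d)) le)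
    ... | i≤k , pow = ≤-trans i≤k (≤-trans (increases (i + d) w i≤k) (≤-reflexive (cong x (sym (+-suc i d))))) , (begin
      gain b * gain b ^ d * x i            ≡⟨ *-assoc (gain b) (gain b ^ d) (x i) ⟩
      gain b * (gain b ^ d * x i)          ≤⟨ *-monoʳ-≤ (gain b) pow ⟩
      gain b * (hi b ^ d * x (i + d))      ≡⟨ mv (gain b) (hi b ^ d) (x (i + d)) ⟩
      hi b ^ d * (gain b * x (i + d))      ≤⟨ *-monoʳ-≤ (hi b ^ d) (grows (i + d) w i≤k) ⟩
      hi b ^ d * (hi b * x (suc (i + d)))  ≡⟨ mv′ (hi b ^ d) (hi b) (x (suc (i + d))) ⟩
      hi b * hi b ^ d * x (suc (i + d))    ≡⟨ cong (λ k → hi b * hi b ^ d * x k) (sym (+-suc i d)) ⟩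
      hi b * hi b ^ d * x (i + suc d) ∎)
      where
      open ≤-Reasoning
      w : Within q b (i + d)
      w = m≤m+n i d , ≤-trans (≤-reflexive (sym (+-suc i d))) le
      mv : ∀ a b c → a * (b * c) ≡ b * (a * c)
      mv = solve-∀
      mv′ : ∀ a b c → a * (b * c) ≡ b * a * c
      mv′ = solve-∀

  monotone : ∀ i rn rd bs j → linkedᵇ i bs j ≡ true → All Sound (stages rn rd bs) → All Quiet (stages rn rd bs) →
             rn ^ q ≤ P * rd ^ q * x (i * q) → ∀ k → i * q ≤ k → k < j * q → x k ≤ x (suc k)
  monotone i rn rd [] j lnk _ _ _ k i≤k k<j = ⊥-elim (<⇒≱ k<j (subst (λ i → i * q ≤ k) (≡ᵇ⇒≡′ {i} {j} lnk) i≤k))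
  monotone i rn rd (b ∷ bs) j lnk (s ∷ ss) (t ∷ ts) base k i≤k k<j with ∧-split {lo b ≡ᵇ i} lnk
  ... | lo≡ , lnk′ with ≡ᵇ⇒≡′ {lo b} {i} lo≡ | ∧-split {i ≤ᵇ hi b} lnk′
  ...   | refl | i≤hi , rest with k <? hi b * q
  ...     | yes k<hi = increases k (i≤k , k<hi)
              (subst (λ m → x (lo b * q) ≤ x m) (m+[n∸m]≡n i≤k) (proj₁ (ahead (k ∸ lo b * q) (≤-trans (≤-reflexive (m+[n∸m]≡n i≤k)) (<⇒≤ k<hi)))))
    where open InBlock b rn rd s t base
  ...     | no k≮hi = monotone (hi b) _ _ bs j rest ss ts base′ k (≮⇒≥ k≮hi) k<j
    where
    open InBlock b rn rd s t base using (ahead)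
    open ≤-Reasoning
    d = hi b ∸ lo b
    i+d : lo b * q + d * q ≡ hi b * q
    i+d = trans (sym (*-distribʳ-+ q (lo b) d)) (cong (_* q) (m+[n∸m]≡n (≤ᵇ-sound {lo b} {hi b} i≤hi)))
    mv : ∀ p r x g → p * r * x * g ≡ p * r * (g * x)
    mv = solve-∀
    mv′ : ∀ p r h x → p * r * (h * x) ≡ p * (r * h) * x
    mv′ = solve-∀
    base′ : (rn * gain b ^ d) ^ q ≤ P * (rd * hi b ^ d) ^ q * x (hi b * q)
    base′ = begin
      (rn * gain b ^ d) ^ q                             ≡⟨ trans (^-distribʳ-* rn (gain b ^ d) q) (cong (rn ^ q *_) (^-*-assoc (gain b) d q)) ⟩
      rn ^ q * gain b ^ (d * q)                         ≤⟨ *-monoˡ-≤ (gain b ^ (d * q)) base ⟩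
      P * rd ^ q * x (lo b * q) * gain b ^ (d * q)      ≡⟨ mv P (rd ^ q) (x (lo b * q)) (gain b ^ (d * q)) ⟩
      P * rd ^ q * (gain b ^ (d * q) * x (lo b * q))    ≤⟨ *-monoʳ-≤ (P * rd ^ q) (proj₂ (ahead (d * q) (≤-reflexive i+d))) ⟩
      P * rd ^ q * (hi b ^ (d * q) * x (lo b * q + d * q)) ≡⟨ mv′ P (rd ^ q) (hi b ^ (d * q)) (x (lo b * q + d * q)) ⟩
      P * (rd ^ q * hi b ^ (d * q)) * x (lo b * q + d * q) ≡⟨ cong₂ (λ z m → P * z * x m) (trans (cong (rd ^ q *_) (sym (^-*-assoc (hi b) d q))) (sym (^-distribʳ-* rd (hi b ^ d) q))) i+d ⟩
      P * (rd * hi b ^ d) ^ q * x (hi b * q) ∎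

-- Exceptional events for a random map

eventᵇ : ∀ {n} → ℕ → ℕ → Block × ℕ × ℕ → ℕ → AdjMat n → Bool
eventᵇ {n} q P (b , rn , rd) k M =
  ((lo b * q ≤ᵇ k) ∧ (suc k ≤ᵇ hi b * q)) ∧ not (P * n * rd ^ q * bad M k (gain b * q) ≤ᵇ rn ^ q)

-- Markov's inequality: the event makes the number of bad sets exceed `(rn / rd) ^ q / (P * n)`,
-- whereas its mean is at most `2 ^ D * (Snum / Sden) ^ q`. By `gap` the quotient contains
-- `(η / suc η) ^ q`.
event-bound : ∀ D η q P n b rn rd k → Valid D η rn rd b → 0 < rn → 0 < D → D * q ≤ n → n ≤ D * q + D → D ≤ q →
  ∑ (allMaps n n) (λ f → ⟦ eventᵇ q P (b , rn , rd) k (G f) ⟧) * suc η ^ q ≤ P * n * (2 ^ D * n ^ n) * η ^ q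
event-bound D η q P n b rn rd k v rn>0 D>0 n≥ n≤ D≤q with lo b * q ≤ᵇ k in e₁ | suc k ≤ᵇ hi b * q in e₂
... | false | _     = ≤-trans (≤-reflexive (cong (_* suc η ^ q) (∑-zero (allMaps n n)))) z≤n
... | true  | false = ≤-trans (≤-reflexive (cong (_* suc η ^ q) (∑-zero (allMaps n n)))) z≤n
... | true  | true  = *-cancelʳ-≤ _ _ (rn ^ q * Sden ^ q) {{m*n≢0 (rn ^ q) (Sden ^ q) {{m^n≢0 rn q}} {{m^n≢0 Sden q}}}} (begin
    Tn * suc η ^ q * (rn ^ q * Sden ^ q)
      ≡⟨ mv Tn (suc η ^ q) (rn ^ q) (Sden ^ q) ⟩
    suc η ^ q * (Tn * rn ^ q * Sden ^ q)
      ≤⟨ *-monoʳ-≤ (suc η ^ q) (*-monoˡ-≤ (Sden ^ q) markov) ⟩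
    suc η ^ q * (P * n * rd ^ q * badTotal * Sden ^ q)
      ≡⟨ mv′ (suc η ^ q) (P * n) (rd ^ q) badTotal (Sden ^ q) ⟩
    suc η ^ q * (P * n * rd ^ q) * (badTotal * Sden ^ q)
      ≤⟨ *-monoʳ-≤ (suc η ^ q * (P * n * rd ^ q)) total-bound ⟩
    suc η ^ q * (P * n * rd ^ q) * (2 ^ D * n ^ n * Snum ^ q)
      ≡⟨ mv″ (suc η ^ q) (P * n) (rd ^ q) (2 ^ D * n ^ n) (Snum ^ q) ⟩
    P * n * (2 ^ D * n ^ n) * (suc η ^ q * (Snum ^ q * rd ^ q))
      ≤⟨ *-monoʳ-≤ (P * n * (2 ^ D * n ^ n)) gap-q ⟩
    P * n * (2 ^ D * n ^ n) * (η ^ q * (Sden ^ q * rn ^ q))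
      ≡⟨ mv‴ (P * n * (2 ^ D * n ^ n)) (η ^ q) (Sden ^ q) (rn ^ q) ⟩
    P * n * (2 ^ D * n ^ n) * η ^ q * (rn ^ q * Sden ^ q) ∎)
  where
  open ≤-Reasoning
  open Rates D b
  open Valid v using (gap; σ>0; β>0)
  open BlockBound D η rn rd b v n q k D>0 n≥ n≤ D≤q (≤ᵇ-sound e₁) (≤ᵇ-sound e₂) using (badTotal; total-bound; V≢0; bd≢0)
  instance
    rn≢0 : NonZero rn
    rn≢0 = >-nonZero rn>0
    Sden≢0 : NonZero Sden
    Sden≢0 = m*n≢0 _ _ {{m*n≢0 _ _ {{m^n≢0 (σ b) (gain b) {{>-nonZero σ>0}}}} {{m^n≢0 (β b) (hi b) {{>-nonZero β>0}}}}}}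
                       {{m*n≢0 _ _ {{m^n≢0 V D}} {{m^n≢0 bd L}}}}
  Tn = ∑ (allMaps n n) (λ f → ⟦ not (P * n * rd ^ q * bad (G f) k (gain b * q) ≤ᵇ rn ^ q) ⟧)
  exceeds : ∀ x y → ⟦ not (x ≤ᵇ y) ⟧ * y ≤ x
  exceeds x y with x ≤ᵇ y in e
  ... | true  = z≤n
  ... | false = ≤-trans (≤-reflexive (*-identityˡ y)) (<⇒≤ (≰⇒> λ le → subst T e (≤⇒≤ᵇ le)))
  markov : Tn * rn ^ q ≤ P * n * rd ^ q * badTotal
  markov = begin
    Tn * rn ^ q ≡⟨ sym (∑-*ʳ (allMaps n n) (rn ^ q) _) ⟩
    ∑ (allMaps n n) (λ f → ⟦ not (P * n * rd ^ q * bad (G f) k (gain b * q) ≤ᵇ rn ^ q) ⟧ * rn ^ q)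
      ≤⟨ ∑-mono (allMaps n n) (λ f → exceeds (P * n * rd ^ q * bad (G f) k (gain b * q)) (rn ^ q)) ⟩
    ∑ (allMaps n n) (λ f → P * n * rd ^ q * bad (G f) k (gain b * q))
      ≡⟨ ∑-*ˡ (allMaps n n) (P * n * rd ^ q) _ ⟩
    P * n * rd ^ q * badTotal ∎
  pow₃ : ∀ a b c → (a * (b * c)) ^ q ≡ a ^ q * (b ^ q * c ^ q)
  pow₃ a b c = trans (^-distribʳ-* a (b * c) q) (cong (a ^ q *_) (^-distribʳ-* b c q))
  gap-q : suc η ^ q * (Snum ^ q * rd ^ q) ≤ η ^ q * (Sden ^ q * rn ^ q)
  gap-q = subst₂ _≤_ (pow₃ (suc η) Snum rd) (pow₃ η Sden rn) (^-monoˡ-≤ q gap)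
  mv : ∀ T h r s → T * h * (r * s) ≡ h * (T * r * s)
  mv = solve-∀
  mv′ : ∀ h p r b s → h * (p * r * b * s) ≡ h * (p * r) * (b * s)
  mv′ = solve-∀
  mv″ : ∀ h p r z s → h * (p * r) * (z * s) ≡ p * z * (h * (s * r))
  mv″ = solve-∀
  mv‴ : ∀ z e s r → z * (e * (s * r)) ≡ z * e * (r * s)
  mv‴ = solve-∀

-- Binomials and exponentials

C-factorial : ∀ a b → ((a + b) choose b) * (a ! * b !) ≡ (a + b) !
C-factorial a zero = trans (+-identityʳ (a ! * 1)) (trans (*-identityʳ (a !)) (cong _! (sym (+-identityʳ a))))
C-factorial zero (suc b) = trans (cong (_* (1 * suc b !)) (nCn≡1 (suc b))) (trans (+-identityʳ (1 * suc b !)) (+-identityʳ (suc b !)))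
C-factorial (suc a) (suc b) = begin
  (suc (a + suc b) choose suc b) * (suc a ! * suc b !)
    ≡⟨ cong (_* (suc a ! * suc b !)) (sym (nCk+nC[k+1]≡[n+1]C[k+1] (a + suc b) b)) ⟩
  (((a + suc b) choose b) + ((a + suc b) choose suc b)) * (suc a ! * suc b !)
    ≡⟨ split ((a + suc b) choose b) ((a + suc b) choose suc b) (suc a) (a !) (suc b) (b !) ⟩
  ((a + suc b) choose b) * (suc a ! * b !) * suc b + ((a + suc b) choose suc b) * (a ! * suc b !) * suc a
    ≡⟨ cong₂ (λ u v → u * suc b + v * suc a) left (C-factorial a (suc b)) ⟩
  (a + suc b) ! * suc b + (a + suc b) ! * suc a
    ≡⟨ factor ((a + suc b) !) (suc b) (suc a) ⟩
  (suc a + suc b) * (a + suc b) ! ∎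
  where
  open ≡-Reasoning
  split : ∀ c d a a! b b! → (c + d) * (a * a! * (b * b!)) ≡ c * (a * a! * b!) * b + d * (a! * (b * b!)) * a
  split = solve-∀
  factor : ∀ f b a → f * b + f * a ≡ (a + b) * f
  factor = solve-∀
  left : ((a + suc b) choose b) * (suc a ! * b !) ≡ (a + suc b) !
  left = trans (cong (λ m → (m choose b) * (suc a ! * b !)) (+-suc a b)) (trans (C-factorial (suc a) b) (cong _! (sym (+-suc a b))))

-- The shape comes from `256 ^ m = (1 + 3) ^ (4 * m)`: of its `4 * m + 1` binomial terms
-- `C(4m, m) * 27 ^ m` is the largest. The proof compares the quotients of consecutive values of
-- both sides; `poly` writes the difference as a polynomial with nonnegative coefficients.
central-factorial : ∀ m → 256 ^ m * ((3 * m) ! * m !) ≤ suc (4 * m) * (27 ^ m * (4 * m) !)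
central-factorial zero    = ≤-refl
central-factorial (suc m) = *-cancelˡ-≤ (suc (4 * m)) (begin
  suc (4 * m) * (256 * 256 ^ m * ((3 * suc m) ! * (suc m * m !)))
    ≡⟨ cong (λ z → suc (4 * m) * (256 * 256 ^ m * (z * (suc m * m !)))) (trans (cong _! (3* m)) refl) ⟩
  suc (4 * m) * (256 * 256 ^ m * ((3 + 3 * m) * ((2 + 3 * m) * ((1 + 3 * m) * (3 * m) !)) * (suc m * m !)))
    ≡⟨ mv (suc (4 * m)) (256 ^ m) (3 + 3 * m) (2 + 3 * m) (1 + 3 * m) ((3 * m) !) (suc m) (m !) ⟩
  256 * (3 + 3 * m) * (2 + 3 * m) * (1 + 3 * m) * suc m * suc (4 * m) * (256 ^ m * ((3 * m) ! * m !))
    ≤⟨ *-mono-≤ (ratio m) (central-factorial m) ⟩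
  27 * (5 + 4 * m) * (4 + 4 * m) * (3 + 4 * m) * (2 + 4 * m) * suc (4 * m) * (suc (4 * m) * (27 ^ m * (4 * m) !))
    ≡⟨ mv′ (27 ^ m) (5 + 4 * m) (4 + 4 * m) (3 + 4 * m) (2 + 4 * m) (suc (4 * m)) ((4 * m) !) ⟩
  suc (4 * m) * ((5 + 4 * m) * (27 * 27 ^ m * ((4 + 4 * m) * ((3 + 4 * m) * ((2 + 4 * m) * (suc (4 * m) * (4 * m) !))))))
    ≡⟨ cong₂ (λ a b → suc (4 * m) * (a * (27 * 27 ^ m * b))) (cong suc (sym (4* m))) (cong _! (sym (4* m))) ⟩
  suc (4 * m) * (suc (4 * suc m) * (27 * 27 ^ m * (4 * suc m) !)) ∎)
  where
  open ≤-Reasoning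
  3* : ∀ m → 3 * suc m ≡ 3 + 3 * m
  3* m = *-suc 3 m
  4* : ∀ m → 4 * suc m ≡ 4 + 4 * m
  4* m = *-suc 4 m
  mv : ∀ s p a b c f m g → s * (256 * p * (a * (b * (c * f)) * (m * g))) ≡ 256 * a * b * c * m * s * (p * (f * g))
  mv = solve-∀
  mv′ : ∀ p a b c d s f → 27 * a * b * c * d * s * (s * (p * f)) ≡ s * (a * (27 * p * (b * (c * (d * (s * f))))))
  mv′ = solve-∀
  ratio : ∀ m → 256 * (3 + 3 * m) * (2 + 3 * m) * (1 + 3 * m) * suc m * suc (4 * m) ≤
                27 * (5 + 4 * m) * (4 + 4 * m) * (3 + 4 * m) * (2 + 4 * m) * suc (4 * m)
  ratio m = *-monoˡ-≤ (suc (4 * m)) (≤-trans (m≤m+n (256 * (3 + 3 * m) * (2 + 3 * m) * (1 + 3 * m) * suc m) (suc m * (3456 * (m * m) + 4944 * m + 1704))) (≤-reflexive (poly m)))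
    where
    poly : ∀ m → 256 * (3 + 3 * m) * (2 + 3 * m) * (1 + 3 * m) * suc m + suc m * (3456 * (m * m) + 4944 * m + 1704) ≡
           27 * (5 + 4 * m) * (4 + 4 * m) * (3 + 4 * m) * (2 + 4 * m)
    poly = solve-∀

central-binomial : ∀ m → 256 ^ m ≤ suc (4 * m) * 27 ^ m * ((4 * m) choose m)
central-binomial m = *-cancelʳ-≤ (256 ^ m) (suc (4 * m) * 27 ^ m * ((4 * m) choose m)) ((3 * m) ! * m !)
    {{m*n≢0 ((3 * m) !) (m !) {{>-nonZero (1≤n! (3 * m))}} {{>-nonZero (1≤n! m)}}}} (begin
  256 ^ m * ((3 * m) ! * m !)                               ≤⟨ central-factorial m ⟩
  suc (4 * m) * (27 ^ m * (4 * m) !)                        ≡⟨ cong (λ z → suc (4 * m) * (27 ^ m * z !)) (four m) ⟩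
  suc (4 * m) * (27 ^ m * (3 * m + m) !)                    ≡⟨ cong (λ z → suc (4 * m) * (27 ^ m * z)) (sym (C-factorial (3 * m) m)) ⟩
  suc (4 * m) * (27 ^ m * (((3 * m + m) choose m) * ((3 * m) ! * m !))) ≡⟨ cong (λ z → suc (4 * m) * (27 ^ m * ((z choose m) * ((3 * m) ! * m !)))) (sym (four m)) ⟩
  suc (4 * m) * (27 ^ m * (((4 * m) choose m) * ((3 * m) ! * m !))) ≡⟨ mv (suc (4 * m)) (27 ^ m) ((4 * m) choose m) ((3 * m) ! * m !) ⟩
  suc (4 * m) * 27 ^ m * ((4 * m) choose m) * ((3 * m) ! * m !) ∎)
  where
  open ≤-Reasoning
  four : ∀ m → 4 * m ≡ 3 * m + m
  four = solve-∀
  mv : ∀ a b c d → a * (b * (c * d)) ≡ a * b * c * d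
  mv = solve-∀

suc≤2^ : ∀ j → suc j ≤ 2 ^ j
suc≤2^ zero    = ≤-refl
suc≤2^ (suc j) = ≤-trans (+-mono-≤ (m^n>0 2 j) (suc≤2^ j)) (≤-reflexive (cong (2 ^ j +_) (sym (+-identityʳ (2 ^ j)))))

doubling : ∀ h → 2 * suc h ^ suc h ≤ suc (suc h) ^ suc h
doubling h = begin
  2 * (suc h * suc h ^ h)          ≡⟨ mv (suc h) (suc h ^ h) ⟩
  suc h ^ h * (suc h + suc h * 1)  ≤⟨ bernoulli-above (suc h) 1 h ⟩
  (suc h + 1) ^ suc h              ≡⟨ cong (_^ suc h) (+-comm (suc h) 1) ⟩
  suc (suc h) ^ suc h ∎
  where
  open ≤-Reasoning
  mv : ∀ a b → 2 * (a * b) ≡ b * (a + a * 1)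
  mv = solve-∀

-- By `doubling`, `6 * η` factors `suc η / η` multiply to at least `2 ^ 6`. If `q` contains `j` such
-- groups, then `A * q ^ 5` is at most `W * suc j ^ 5`, which is below `suc j ^ 6 ≤ 2 ^ (6 * j)`
-- once `W ≤ j`.
exponential-wins : ∀ η .{{_ : NonZero η}} A → ∃ λ Q → ∀ q → Q ≤ q → A * q ^ 5 * η ^ q < suc η ^ q
exponential-wins η@(suc h) A = W * E , λ q Q≤q →
  let j = q / E
      s = q % E
      q≡ : q ≡ s + j * E
      q≡ = m≡m%n+[m/n]*n q E
      q≤ : q ≤ suc j * E
      q≤ = ≤-trans (≤-reflexive q≡) (+-monoˡ-≤ (j * E) (<⇒≤ (m%n<n q E)))
      W≤j : W ≤ j
      W≤j = ≤-trans (≤-reflexive (sym (m*n/n≡m W E))) (/-monoˡ-≤ E Q≤q)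
  in begin-strict
    A * q ^ 5 * η ^ q                       ≤⟨ *-monoˡ-≤ (η ^ q) (*-monoʳ-≤ A (^-monoˡ-≤ 5 q≤)) ⟩
    A * (suc j * E) ^ 5 * η ^ q             ≡⟨ cong (λ z → A * z * η ^ q) (trans (^-distribʳ-* (suc j) E 5) (*-comm (suc j ^ 5) (E ^ 5))) ⟩
    A * (E ^ 5 * suc j ^ 5) * η ^ q         ≡⟨ cong (_* η ^ q) (sym (*-assoc A (E ^ 5) _)) ⟩
    W * suc j ^ 5 * η ^ q                   <⟨ *-monoˡ-< (η ^ q) {{m^n≢0 η q}} (*-monoˡ-< (suc j ^ 5) {{m^n≢0 (suc j) 5}} (s≤s W≤j)) ⟩
    suc j ^ 6 * η ^ q                       ≤⟨ *-monoˡ-≤ (η ^ q) (^-monoˡ-≤ 6 (suc≤2^ j)) ⟩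
    (2 ^ j) ^ 6 * η ^ q                     ≡⟨ cong₂ (λ a b → a * η ^ b) (^-*-assoc 2 j 6) q≡ ⟩
    2 ^ (j * 6) * η ^ (s + j * E)           ≡⟨ cong (2 ^ (j * 6) *_) (^-distribˡ-+-* η s (j * E)) ⟩
    2 ^ (j * 6) * (η ^ s * η ^ (j * E))     ≡⟨ mv (2 ^ (j * 6)) (η ^ s) (η ^ (j * E)) ⟩
    η ^ s * (2 ^ (j * 6) * η ^ (j * E))     ≡⟨ cong (λ z → η ^ s * (2 ^ (j * 6) * η ^ z)) (exps j) ⟩
    η ^ s * (2 ^ (j * 6) * η ^ (η * (j * 6))) ≡⟨ cong (λ z → η ^ s * (2 ^ (j * 6) * z)) (sym (^-*-assoc η η (j * 6))) ⟩
    η ^ s * (2 ^ (j * 6) * (η ^ η) ^ (j * 6)) ≡⟨ cong (η ^ s *_) (sym (^-distribʳ-* 2 (η ^ η) (j * 6))) ⟩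
    η ^ s * (2 * η ^ η) ^ (j * 6)           ≤⟨ *-mono-≤ (^-monoˡ-≤ s (n≤1+n η)) (^-monoˡ-≤ (j * 6) (doubling h)) ⟩
    suc η ^ s * (suc η ^ η) ^ (j * 6)       ≡⟨ cong (suc η ^ s *_) (trans (^-*-assoc (suc η) η (j * 6)) (cong (suc η ^_) (sym (exps j)))) ⟩
    suc η ^ s * suc η ^ (j * E)             ≡⟨ sym (^-distribˡ-+-* (suc η) s (j * E)) ⟩
    suc η ^ (s + j * E)                     ≡⟨ cong (suc η ^_) (sym q≡) ⟩
    suc η ^ q ∎
  where
  open ≤-Reasoning
  E W : ℕ
  E = 6 * η
  W = A * E ^ 5
  mv : ∀ a b c → a * (b * c) ≡ b * (a * c)
  mv = solve-∀
  exps : ∀ j → j * (6 * η) ≡ η * (j * 6)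
  exps j = mv″ j η
    where
    mv″ : ∀ j e → j * (6 * e) ≡ e * (j * 6)
    mv″ = solve-∀

-- The general theorem and its numerical instance

⟦not-allᵇ-not⟧ : ∀ {A : Set} (p : A → Bool) xs → ⟦ not (allᵇ (λ x → not (p x)) xs) ⟧ ≤ ∑ xs (λ x → ⟦ p x ⟧)
⟦not-allᵇ-not⟧ p []       = z≤n
⟦not-allᵇ-not⟧ p (x ∷ xs) with p x
... | true  = s≤s z≤n
... | false = ⟦not-allᵇ-not⟧ p xs

-- `n` may exceed `D * q` by `D`. Multiplied by `c` this is at most `q`, and the extra `1` in
-- `suc (c * D)` pays for it.
coverage : ∀ a c D q n top k → .{{NonZero a}} → a * suc k ≤ c * n → n ≤ D * q + D → c * D ≤ q → suc (c * D) ≤ a * top → k < top * q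
coverage a c D q n top k le n≤ cD≤q room = *-cancelˡ-≤ a (begin
  a * suc k            ≤⟨ le ⟩
  c * n                ≤⟨ *-monoʳ-≤ c n≤ ⟩
  c * (D * q + D)      ≡⟨ mv c D q ⟩
  c * D + c * D * q    ≤⟨ +-monoˡ-≤ (c * D * q) cD≤q ⟩
  suc (c * D) * q      ≤⟨ *-monoˡ-≤ q room ⟩
  a * top * q          ≡⟨ *-assoc a top q ⟩
  a * (top * q) ∎)
  where
  open ≤-Reasoning
  mv : ∀ c D q → c * (D * q + D) ≡ c * D + c * D * q
  mv = solve-∀

threshold : ∀ Q D c q → 2 + (Q + (D + c * D)) ≤ q → 2 ≤ q × Q ≤ q × D ≤ q × c * D ≤ q
threshold Q D c q le =
  ≤-trans (m≤m+n 2 (Q + (D + c * D))) le ,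
  ≤-trans (≤-trans (m≤m+n Q (D + c * D)) inner) le ,
  ≤-trans (≤-trans (≤-trans (m≤m+n D (c * D)) (m≤n+m (D + c * D) Q)) inner) le ,
  ≤-trans (≤-trans (≤-trans (m≤n+m (c * D) D) (m≤n+m (D + c * D) Q)) inner) le
  where
  inner : Q + (D + c * D) ≤ 2 + (Q + (D + c * D))
  inner = m≤n+m (Q + (D + c * D)) 2

quotient : ∀ D W n .{{_ : NonZero D}} → D * W ≤ n → ∃ λ q → W ≤ q × D * q ≤ n × n ≤ D * q + D
quotient D W n DW≤n = q ,
  ≤-trans (≤-reflexive (sym (m*n/n≡m W D))) (/-monoˡ-≤ D (≤-trans (≤-reflexive (*-comm W D)) DW≤n)) ,
  ≤-trans (≤-trans (≤-reflexive (*-comm D q)) (m≤n+m (q * D) r)) (≤-reflexive (sym n≡)) ,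
  ≤-trans (≤-reflexive n≡) (≤-trans (+-monoˡ-≤ (q * D) (<⇒≤ (m%n<n n D)))
    (≤-reflexive (trans (+-comm D (q * D)) (cong (_+ D) (*-comm q D)))))
  where
  q = n / D
  r = n % D
  n≡ : n ≡ r + q * D
  n≡ = m≡m%n+[m/n]*n n D

-- The polynomial losses are `n` for the choice of `k`, `suc n * n` for the margin in `Quiet` and
-- `n * n` for the passage from maps to trees.
fifth-power : ∀ m l d n p q e t x → suc n ≤ d * q → x ≤ l * (n * (suc n * n * (t * (n * n * p)) * e)) →
  m * x ≤ m * l * (t * d ^ 5) * q ^ 5 * e * p
fifth-power m l d n p q e t x n< x≤ = begin
  m * x                                                         ≤⟨ *-monoʳ-≤ m x≤ ⟩
  m * (l * (n * (suc n * n * (t * (n * n * p)) * e)))           ≡⟨ mv m l n (suc n) t p e ⟩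
  m * l * (t * (suc n * (n * (n * (n * (n * 1)))))) * e * p     ≤⟨ *-monoˡ-≤ p (*-monoˡ-≤ e (*-monoʳ-≤ (m * l) (*-monoʳ-≤ t fifth))) ⟩
  m * l * (t * (d ^ 5 * q ^ 5)) * e * p                         ≡⟨ cong (λ z → z * e * p) (mv′ (m * l) t (d ^ 5) (q ^ 5)) ⟩
  m * l * (t * d ^ 5) * q ^ 5 * e * p ∎
  where
  open ≤-Reasoning
  mv : ∀ m l n s d p e → m * (l * (n * (s * n * (d * (n * n * p)) * e))) ≡ m * l * (d * (s * (n * (n * (n * (n * 1)))))) * e * p
  mv = solve-∀
  mv′ : ∀ a b c d → a * (b * (c * d)) ≡ a * (b * c) * d
  mv′ = solve-∀
  fifth : suc n * n ^ 4 ≤ d ^ 5 * q ^ 5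
  fifth = ≤-trans (*-mono-≤ n< (^-monoˡ-≤ 4 (≤-trans (n≤1+n n) n<))) (≤-reflexive (^-distribʳ-* d q 5))

IncreasingUpTo : ∀ {n} → ℕ → ℕ → AdjMat n → Set
IncreasingUpTo {n} a c M = ∀ k → a * suc k ≤ c * n → X k M ≤ X (suc k) M

module Main (i₀ η a c u v : ℕ) .{{_ : NonZero i₀}} .{{_ : NonZero η}} .{{_ : NonZero a}}
            (central : ∀ m → u ^ m ≤ suc (4 * m) * v ^ m * ((4 * m) choose m)) (early late : List Block) (top : ℕ)
            (early-linked : linkedᵇ 0 early i₀ ≡ true) (late-linked : linkedᵇ i₀ late top ≡ true)
            (early-valid : allᵇ (validᵇ (5 * i₀) η) (stages 1 1 early) ≡ true)
            (late-valid : allᵇ (validᵇ (5 * i₀) η) (stages (u ^ i₀) (v ^ i₀) late) ≡ true)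
            (room : suc (c * (5 * i₀)) ≤ a * top) where

  -- A multiple of five, so that the path bound at about `n / 5` enters exactly at a block boundary.
  D : ℕ
  D = 5 * i₀

  instance
    D≢0 : NonZero D
    D≢0 = m*n≢0 5 i₀

  𝒯 : List (Block × ℕ × ℕ)
  𝒯 = stages 1 1 early ++ stages (u ^ i₀) (v ^ i₀) late

  Sound : Block × ℕ × ℕ → Set
  Sound (b , rn , rd) = Valid D η rn rd b × 0 < rn × 0 < rd

  sounds : ∀ ss → allᵇ (validᵇ D η) ss ≡ true → All Sound ss
  sounds ss e = All.tabulate λ {(b , rn , rd)} i → valid D η b rn rd (allᵇ-∈ (validᵇ D η) e i)

  𝒯-sound : All Sound 𝒯
  𝒯-sound = ++⁺ (sounds (stages 1 1 early) early-valid) (sounds (stages (u ^ i₀) (v ^ i₀) late) late-valid)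

  -- Some stage has an event at some `k < n`. Both existential quantifiers are negated `allᵇ`, the
  -- form in which `⟦not-allᵇ-not⟧` gives the union bound.
  noisyᵇ : ∀ {n} → ℕ → AdjMat n → Bool
  noisyᵇ {n} q M = not (allᵇ (λ s → not (not (allᵇ (λ k → not (eventᵇ q (suc n) s k M)) (upTo n)))) 𝒯)

  module _ {n q : ℕ} .{{_ : NonZero q}} (n≥ : D * q ≤ n) (n≤ : n ≤ D * q + D) where

    module _ (M : AdjMat n) (simple : IsSimpleGraph M) (acyclic : ¬ HasCycle M) where
      open Chain M simple D η q (suc n) n≥ using (Quiet; monotone)
      open PathBound M simple acyclic using (X-path)

      quiet : noisyᵇ q M ≡ false → All Quiet 𝒯
      quiet e = All.tabulate λ {(b , rn , rd)} i k w → silent b rn rd k w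
        (allᵇ-∈ (λ k → not (eventᵇ q (suc n) (b , rn , rd) k M))
          (double (allᵇ-∈ (λ s → not (not (allᵇ (λ k → not (eventᵇ q (suc n) s k M)) (upTo n)))) (unnot e) i))
          (∈-upTo⁺ (≤-trans (proj₂ w) (≤-trans (*-monoˡ-≤ q (Valid.hi≤D (proj₁ (All.lookup 𝒯-sound i)))) n≥))))
        where
        unnot : ∀ {b} → not b ≡ false → b ≡ true
        unnot {true} _ = refl
        double : ∀ {b} → not (not b) ≡ true → b ≡ true
        double {true} _ = refl
        ≤ᵇ-complete : ∀ {m n} → m ≤ n → (m ≤ᵇ n) ≡ true
        ≤ᵇ-complete {m} {n} le with m ≤ᵇ n | ≤⇒≤ᵇ {m} {n} le
        ... | true | _ = refl
        silent : ∀ b rn rd k → Within q b k → not (eventᵇ q (suc n) (b , rn , rd) k M) ≡ true →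
                 suc n * n * rd ^ q * bad M k (gain b * q) ≤ rn ^ q
        silent b rn rd k (lo≤k , k<hi) e rewrite ≤ᵇ-complete lo≤k | ≤ᵇ-complete k<hi = ≤ᵇ-sound (double e)

      early-base : 1 ^ q ≤ suc n * 1 ^ q * X (0 * q) M
      early-base = ≤-trans (≤-reflexive (sym (*-identityʳ (1 ^ q))))
        (*-mono-≤ {1 ^ q} {suc n * 1 ^ q} {1} (m≤n*m (1 ^ q) (suc n)) (X-path 0))

      late-base : (u ^ i₀) ^ q ≤ suc n * (v ^ i₀) ^ q * X (i₀ * q) M
      late-base = begin
        (u ^ i₀) ^ q                          ≡⟨ ^-*-assoc u i₀ q ⟩
        u ^ m                                 ≤⟨ central m ⟩
        suc (4 * m) * v ^ m * ((4 * m) choose m)    ≤⟨ *-mono-≤ (*-monoˡ-≤ (v ^ m) (s≤s (≤-trans (m≤n+m (4 * m) m) 5m≤n)))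
                                                     (≤-trans (C-mono m 4m≤) (X-path m)) ⟩
        suc n * v ^ m * X m M                  ≡⟨ cong (λ z → suc n * z * X m M) (sym (^-*-assoc v i₀ q)) ⟩
        suc n * (v ^ i₀) ^ q * X m M ∎
        where
        open ≤-Reasoning
        m = i₀ * q
        5m≤n : 5 * m ≤ n
        5m≤n = ≤-trans (≤-reflexive (sym (*-assoc 5 i₀ q))) n≥
        4m≤ : 4 * m ≤ suc n ∸ m
        4m≤ = ≤-trans (≤-reflexive (sym (m+n∸m≡n m (4 * m)))) (∸-monoˡ-≤ m (≤-trans 5m≤n (n≤1+n n)))

      increasing : noisyᵇ q M ≡ false → c * D ≤ q → IncreasingUpTo a c M
      increasing e cD≤q k le with k <? i₀ * q
      ... | yes k< = monotone 0 1 1 early i₀ early-linked (sounds (stages 1 1 early) early-valid)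
                       (All.tabulate (λ i → All.lookup (quiet e) (∈-++⁺ˡ i))) early-base k z≤n k<
      ... | no k≮  = monotone i₀ (u ^ i₀) (v ^ i₀) late top late-linked (sounds (stages (u ^ i₀) (v ^ i₀) late) late-valid)
                       (All.tabulate (λ i → All.lookup (quiet e) (∈-++⁺ʳ (stages 1 1 early) i))) late-base k (≮⇒≥ k≮)
                       (coverage a c D q n top k le n≤ cD≤q room)

    noisy-count : D ≤ q → ∑ (allMaps n n) (λ f → ⟦ noisyᵇ q (G f) ⟧) * suc η ^ q ≤
                  length 𝒯 * (n * (suc n * n * (2 ^ D * n ^ n) * η ^ q))
    noisy-count D≤q = begin
      ∑ 𝓜 (λ f → ⟦ noisyᵇ q (G f) ⟧) * suc η ^ q
        ≤⟨ *-monoˡ-≤ (suc η ^ q) (∑-mono 𝓜 (λ f → ≤-trans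
             (⟦not-allᵇ-not⟧ (λ s → not (allᵇ (λ k → not (eventᵇ q (suc n) s k (G f))) (upTo n))) 𝒯)
             (∑-mono 𝒯 (λ s → ⟦not-allᵇ-not⟧ (λ k → eventᵇ q (suc n) s k (G f)) (upTo n))))) ⟩
      ∑ 𝓜 (λ f → ∑ 𝒯 (λ s → ∑ (upTo n) (λ k → ⟦ eventᵇ q (suc n) s k (G f) ⟧))) * suc η ^ q
        ≡⟨ cong (_* suc η ^ q) (trans (∑-swap 𝓜 𝒯 (λ f s → ∑ (upTo n) (λ k → ⟦ eventᵇ q (suc n) s k (G f) ⟧))) (∑-cong 𝒯 (λ s → ∑-swap 𝓜 (upTo n) (λ f k → ⟦ eventᵇ q (suc n) s k (G f) ⟧)))) ⟩
      ∑ 𝒯 (λ s → ∑ (upTo n) (λ k → ∑ 𝓜 (λ f → ⟦ eventᵇ q (suc n) s k (G f) ⟧))) * suc η ^ q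
        ≡⟨ sym (∑-*ʳ 𝒯 (suc η ^ q) _) ⟩
      ∑ 𝒯 (λ s → ∑ (upTo n) (λ k → ∑ 𝓜 (λ f → ⟦ eventᵇ q (suc n) s k (G f) ⟧)) * suc η ^ q)
        ≤⟨ ∑-mono-All 𝒯-sound per-stage ⟩
      ∑ 𝒯 (λ _ → n * Z)
        ≡⟨ ∑-const 𝒯 (n * Z) ⟩
      length 𝒯 * (n * Z) ∎
      where
      open ≤-Reasoning
      𝓜 = allMaps n n
      Z = suc n * n * (2 ^ D * n ^ n) * η ^ q
      per-stage : ∀ s → Sound s → ∑ (upTo n) (λ k → ∑ 𝓜 (λ f → ⟦ eventᵇ q (suc n) s k (G f) ⟧)) * suc η ^ q ≤ n * Z
      per-stage (b , rn , rd) (v , rn>0 , _) = begin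
        ∑ (upTo n) (λ k → ∑ 𝓜 (λ f → ⟦ eventᵇ q (suc n) (b , rn , rd) k (G f) ⟧)) * suc η ^ q
          ≡⟨ sym (∑-*ʳ (upTo n) (suc η ^ q) _) ⟩
        ∑ (upTo n) (λ k → ∑ 𝓜 (λ f → ⟦ eventᵇ q (suc n) (b , rn , rd) k (G f) ⟧) * suc η ^ q)
          ≤⟨ ∑-mono (upTo n) (λ k → event-bound D η q (suc n) n b rn rd k v rn>0 (>-nonZero⁻¹ D) n≥ n≤ D≤q) ⟩
        ∑ (upTo n) (λ _ → Z)
          ≡⟨ trans (∑-const (upTo n) Z) (cong (_* Z) (length-upTo n)) ⟩
        n * Z ∎

  constant : ℕ → ℕ
  constant m = m * length 𝒯 * (2 ^ D * (2 + D) ^ 5)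

  module _ (m n q : ℕ) (n≥ : D * q ≤ n) (n≤ : n ≤ D * q + D) (2≤q : 2 ≤ q) (D≤q : D ≤ q) (cD≤q : c * D ≤ q)
           (wins : constant m * q ^ 5 * η ^ q < suc η ^ q) where

    instance
      q≢0 : NonZero q
      q≢0 = >-nonZero (≤-trans (s≤s z≤n) 2≤q)

    2≤n : 2 ≤ n
    2≤n = ≤-trans 2≤q (≤-trans (m≤n*m q D) n≥)

    instance
      n≢0 : NonZero n
      n≢0 = >-nonZero (≤-trans (s≤s z≤n) 2≤n)

    n^n : n ^ n ≡ n * n * n ^ (n ∸ 2)
    n^n = trans (cong (n ^_) (sym (m+[n∸m]≡n 2≤n))) (sym (*-assoc n n (n ^ (n ∸ 2))))

    suc-n≤ : suc n ≤ (2 + D) * q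
    suc-n≤ = begin
      suc n                ≤⟨ s≤s n≤ ⟩
      suc (D * q + D)      ≡⟨ cong suc (+-comm (D * q) D) ⟩
      suc D + D * q        ≤⟨ +-monoˡ-≤ (D * q) (+-mono-≤ (≤-trans (s≤s z≤n) 2≤q) D≤q) ⟩
      q + q + D * q        ≡⟨ +-assoc q q (D * q) ⟩
      (2 + D) * q ∎
      where open ≤-Reasoning

    noisy-trees : ℕ
    noisy-trees = ∑ (allMaps n n) (λ f → ⟦ noisyᵇ q (G f) ⟧)

    few-noisy : m * noisy-trees < n ^ (n ∸ 2)
    few-noisy = *-cancelʳ-< (suc η ^ q) (m * noisy-trees) (n ^ (n ∸ 2)) (begin-strict
      m * noisy-trees * suc η ^ q
        ≡⟨ *-assoc m noisy-trees (suc η ^ q) ⟩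
      m * (noisy-trees * suc η ^ q)
        ≤⟨ fifth-power m (length 𝒯) (2 + D) n (n ^ (n ∸ 2)) q (η ^ q) (2 ^ D) (noisy-trees * suc η ^ q) suc-n≤
             (≤-trans (noisy-count n≥ n≤ D≤q) (≤-reflexive (cong (λ z → length 𝒯 * (n * (suc n * n * (2 ^ D * z) * η ^ q))) n^n))) ⟩
      constant m * q ^ 5 * η ^ q * n ^ (n ∸ 2)
        <⟨ *-monoˡ-< (n ^ (n ∸ 2)) {{m^n≢0 n (n ∸ 2)}} wins ⟩
      suc η ^ q * n ^ (n ∸ 2)
        ≡⟨ *-comm (suc η ^ q) (n ^ (n ∸ 2)) ⟩
      n ^ (n ∸ 2) * suc η ^ q ∎)
      where open ≤-Reasoning

    tree-noisy : ∀ {M : AdjMat n} → IsTree M × ¬ IncreasingUpTo a c M →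
                 ∃ λ f → f ∈ allMaps n n × G f ≡ M × noisyᵇ q (G f) ≡ true
    tree-noisy {M} ((simple , connected , acyclic) , ¬inc) with TreeMap.tree-map M simple connected acyclic 2≤n
    ... | f , Gf≡M = f , ∈-allMaps f , Gf≡M , trans (cong (noisyᵇ q) Gf≡M) noisy
      where
      noisy : noisyᵇ q M ≡ true
      noisy with noisyᵇ q M in e
      ... | true  = refl
      ... | false = ⊥-elim (¬inc (increasing n≥ n≤ M simple acyclic e cD≤q))

    -- A map determines its graph, so distinct bad trees have distinct noisy maps, and the count of
    -- noisy maps bounds the count of bad trees.
    few-bad : (L : List (AdjMat n)) → Unique L → All (λ M → IsTree M × ¬ IncreasingUpTo a c M) L → m * length L < n ^ (n ∸ 2)
    few-bad L uniq bads = ≤-<-trans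
      (*-monoʳ-≤ m (length≤∑ (≡-dec (≡-dec Bool._≟_)) G (allMaps n n) (λ f → noisyᵇ q (G f)) L uniq (All.map tree-noisy bads)))
      few-noisy

  few-bad-trees : (m : ℕ) → ∃[ N ] ((n : ℕ) → N ≤ n → (L : List (AdjMat n)) → Unique L →
    All (λ M → IsTree M × ¬ IncreasingUpTo a c M) L → m * length L < n ^ (n ∸ 2))
  few-bad-trees m = let Q , wins = exponential-wins η (constant m) in
    D * (2 + (Q + (D + c * D))) , λ n N≤n →
      let q , W≤q , n≥ , n≤ = quotient D (2 + (Q + (D + c * D))) n N≤n
          2≤q , Q≤q , D≤q , cD≤q = threshold Q D c q W≤q
      in few-bad m n q n≥ n≤ 2≤q D≤q cD≤q (wins q Q≤q)

-- Fitted numerically for D = 4000. The early gains are coarse; the late ones are close to the largest growth rates that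
-- the first moment bound allows. The last block ends at 1124 / 4000 = 0.281 > 0.28096.
earlyBlocks : List Block
earlyBlocks =
  block 0   400 1600 1 5 100 3  97 100 ∷
  block 400 600 1200 1 5 100 6  94 100 ∷
  block 600 800 800  1 5 100 10 91 100 ∷ []

-- Blocks of unit length let `gain` follow the falling growth rate closely. At `d = 323` both `hi`
-- and `gain` are 1124: the guaranteed rate has come down to exactly 1.
lateBlock : ℕ → Block
lateBlock d = block (800 + d) (801 + d) ((183000 + 21 * d ^ 2 / 500 ∸ 232 * d) / 100)
  (1688 ∸ d) (612 + d) 2000 (510 + d) (80880 + d ^ 2 / 125 ∸ 57 * d / 2) 100000

lateBlocks : List Block
lateBlocks = map lateBlock (upTo 324)

-- Decided by evaluation: 324 blocks with thirteen comparisons of explicit integers each.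
lateBlocks-valid : allᵇ (validᵇ (5 * 800) 10) (stages (256 ^ 800) (27 ^ 800) lateBlocks) ≡ true
lateBlocks-valid = refl

theorem1p7 : (m : ℕ) → ∃[ N ] ((n : ℕ) → N ≤ n → (L : List (AdjMat n)) → Unique L →
    All (λ M → IsTree M × ¬ InitiallyIncreasing M) L →
    m * length L < n ^ (n ∸ 2))
theorem1p7 = Main.few-bad-trees 800 10 100000 28096 256 27 central-binomial earlyBlocks lateBlocks 1124
  refl refl refl lateBlocks-valid (≤ᵇ-sound refl)
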